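{- Let $q>1$ be a square-free integer, let $P=\phi(q)/q$, and let $0=s_1<s_2<s_3<\cdots$ be the squares modulo $q$ in increasing order. Then $$\frac1q\sum_{s_i<q}(s_{i+1}-s_i)^2\ll 2^{\omega(q)}\,P\,(\log q)\prod_{p\mid q}\Big(1+\frac1{\sqrt p}\Big),$$ with an absolute implied constant.
   Context: For square-free $q$, an integer $s$ is called a square modulo $q$ if $s$ is a square modulo $p$ for every prime $p$ dividing $q$; $0$ counts as a square. The sequence $(s_i)$ enumerates all non-negative integers that are squares modulo $q$ (so for the largest $s_i<q$ the next term is $s_{i+1}=q$). $\phi$ is Euler's totient function, $\omega(q)$ is the number of distinct prime divisors of $q$, and the product runs over primes. $f\ll g$ means $|f|\le Cg$ for some constant $C>0$. -}

module Defs where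

open import Data.Bool using (T; true; false; if_then_else_)
open import Data.Integer as ℤ using (ℤ; +_; +[1+_])
import Data.Integer.Divisibility as ℤ
import Data.Integer.Properties as ℤ
open import Data.List using (List; []; _∷_; length; filter; map; foldr; upTo; mapMaybe)
import Data.Maybe as Maybe
open import Data.Nat as ℕ using (ℕ; zero; suc; NonZero; z≤n; s≤s)
import Data.Nat.Properties as ℕ
open import Data.Nat.Coprimality using (coprime?)
open import Data.Nat.Divisibility using (_∣_; _∣?_)
open import Data.Nat.ListAction using (sum)
open import Data.Nat.Primality using (Prime; prime?; prime⇒nonZero)
import Data.Nat.Solver as ℕ-Solver
open import Data.Product using (∃; _×_; _,_; proj₁; proj₂)
open import Data.Rational as ℚ using (ℚ; 0ℚ; 1ℚ; ½; mkℚ; _/_; 1/_; ∣_∣)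
import Data.Rational.Properties as ℚ
import Data.Rational.Solver as ℚ-Solver
open import Data.Rational.Unnormalised as ℚᵘ using (mkℚᵘ)
import Data.Rational.Unnormalised.Properties as ℚᵘ
open import Data.Sum using (inj₁; inj₂)
open import Relation.Binary.PropositionalEquality
open import Relation.Nullary using (yes; no; contradiction)
open import Relation.Nullary.Decidable using (dec⇒maybe; _×-dec_)

frac≤ : ∀ a b c d .{{_ : NonZero b}} .{{_ : NonZero d}} →
        a ℕ.* d ℕ.≤ c ℕ.* b → + a / b ℚ.≤ + c / d
frac≤ a (suc b) c (suc d) le = ℚ.toℚᵘ-cancel-≤
  (ℚᵘ.≤-trans (ℚᵘ.≤-reflexive (ℚ.toℚᵘ-fromℚᵘ (mkℚᵘ (+ a) b)))
  (ℚᵘ.≤-trans (ℚᵘ.*≤* (subst₂ ℤ._≤_ (ℤ.pos-* a (suc d)) (ℤ.pos-* c (suc b)) (ℤ.+≤+ le)))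
              (ℚᵘ.≤-reflexive (ℚᵘ.≃-sym (ℚ.toℚᵘ-fromℚᵘ (mkℚᵘ (+ c) d))))))

frac+ : ∀ a b d → + a / suc d ℚ.+ + b / suc d ≡ + (a ℕ.+ b) / suc d
frac+ a b d = ℚ.toℚᵘ-injective
  (ℚᵘ.≃-trans (ℚ.toℚᵘ-homo-+ (+ a / suc d) (+ b / suc d))
  (ℚᵘ.≃-trans (ℚᵘ.+-cong (ℚ.toℚᵘ-fromℚᵘ (mkℚᵘ (+ a) d)) (ℚ.toℚᵘ-fromℚᵘ (mkℚᵘ (+ b) d)))
  (ℚᵘ.≃-trans (ℚᵘ.*≡* eq) (ℚᵘ.≃-sym (ℚ.toℚᵘ-fromℚᵘ (mkℚᵘ (+ (a ℕ.+ b)) d))))))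
  where
  D = + suc d
  eq : (+ a ℤ.* D ℤ.+ + b ℤ.* D) ℤ.* D ≡ (+ (a ℕ.+ b)) ℤ.* (D ℤ.* D)
  eq = trans (cong (ℤ._* D) (sym (ℤ.*-distribʳ-+ D (+ a) (+ b)))) (ℤ.*-assoc (+ a ℤ.+ + b) D D)

module _ where
  open ℚ-Solver.+-*-Solver

  sum-cancel : ∀ b c → (b ℚ.+ c) ℚ.- b ≡ c
  sum-cancel = solve 2 (λ b c → (b :+ c) :- b := c) refl

  diff-cancel : ∀ a b → (a ℚ.- b) ℚ.+ b ≡ a
  diff-cancel = solve 2 (λ a b → (a :- b) :+ b := a) refl

  neg-diff : ∀ a b → ℚ.- (a ℚ.- b) ≡ b ℚ.- a
  neg-diff = solve 2 (λ a b → :- (a :- b) := b :- a) refl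

  sum-of-diffs : ∀ a b c d → (a ℚ.- b) ℚ.+ (c ℚ.- d) ≡ (a ℚ.+ c) ℚ.- (b ℚ.+ d)
  sum-of-diffs = solve 4 (λ a b c d → (a :- b) :+ (c :- d) := (a :+ c) :- (b :+ d)) refl

  *-telescope : ∀ a b c d → a ℚ.* (c ℚ.- d) ℚ.+ (a ℚ.- b) ℚ.* d ≡ a ℚ.* c ℚ.- b ℚ.* d
  *-telescope = solve 4 (λ a b c d → a :* (c :- d) :+ (a :- b) :* d := a :* c :- b :* d) refl

  clear-denominators : ∀ a b u v →
    a ℚ.* b ℚ.* (u ℚ.- v) ≡ b ℚ.* (a ℚ.* u) ℚ.- a ℚ.* (b ℚ.* v)
  clear-denominators =
    solve 4 (λ a b u v → a :* b :* (u :- v) := b :* (a :* u) :- a :* (b :* v)) refl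

-‿≤ : ∀ a b c → a ℚ.≤ b ℚ.+ c → a ℚ.- b ℚ.≤ c
-‿≤ a b c le = subst (a ℚ.- b ℚ.≤_) (sum-cancel b c) (ℚ.+-monoˡ-≤ (ℚ.- b) le)

∣∣≤ : ∀ a b c → a ℚ.≤ b ℚ.+ c → b ℚ.≤ a ℚ.+ c → ∣ a ℚ.- b ∣ ℚ.≤ c
∣∣≤ a b c p q with ℚ.∣p∣≡p∨∣p∣≡-p (a ℚ.- b)
... | inj₁ e = subst (ℚ._≤ c) (sym e) (-‿≤ a b c p)
... | inj₂ e = subst (ℚ._≤ c) (sym (trans e (neg-diff a b))) (-‿≤ b a c q)

halves : ∀ e → ½ ℚ.* e ℚ.+ ½ ℚ.* e ≡ e
halves e = trans (sym (ℚ.*-distribʳ-+ e ½ ½)) (ℚ.*-identityˡ e)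

*-pos : ∀ {a b} → 0ℚ ℚ.< a → 0ℚ ℚ.< b → 0ℚ ℚ.< a ℚ.* b
*-pos {a} {b} p q = ℚ.positive⁻¹ (a ℚ.* b)
  {{ℚ.pos*pos⇒pos a {{ℚ.positive p}} b {{ℚ.positive q}}}}

half-pos : ∀ {e} → 0ℚ ℚ.< e → 0ℚ ℚ.< ½ ℚ.* e
half-pos = *-pos (ℚ.positive⁻¹ ½)

*-mono-≤ : ∀ {a b c d} → 0ℚ ℚ.≤ a → 0ℚ ℚ.≤ d → a ℚ.≤ b → c ℚ.≤ d → a ℚ.* c ℚ.≤ b ℚ.* d
*-mono-≤ {a} {b} {c} {d} a≥0 d≥0 a≤b c≤d = ℚ.≤-trans
  (ℚ.*-monoˡ-≤-nonNeg a {{ℚ.nonNegative a≥0}} c≤d)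
  (ℚ.*-monoʳ-≤-nonNeg d {{ℚ.nonNegative d≥0}} a≤b)

archimedean : ∀ e → 0ℚ ℚ.< e → ∃ λ N → + 1 / suc N ℚ.≤ e
archimedean e e>0 with ℚ.positive e>0
archimedean e@(mkℚ +[1+ n ] d _) e>0 | _ = d ,
  subst (+ 1 / suc d ℚ.≤_) (ℚ.↥p/↧p≡p e)
    (frac≤ 1 (suc d) (suc n) (suc d) (ℕ.*-monoˡ-≤ (suc d) (s≤s (z≤n {n}))))

-- Reals are not quotiented: two sequences represent the same real when each is ≤ the other.

Cauchy : (ℕ → ℚ) → Set
Cauchy x = ∀ ε → 0ℚ ℚ.< ε →
  ∃ λ N → ∀ m n → N ℕ.≤ m → N ℕ.≤ n → ∣ x m ℚ.- x n ∣ ℚ.≤ ε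

record ℝ : Set where
  constructor mkℝ
  field
    seq    : ℕ → ℚ
    cauchy : Cauchy seq

open ℝ public

infix 4 _≤_ _<_

_≤_ : ℝ → ℝ → Set
x ≤ y = ∀ ε → 0ℚ ℚ.< ε → ∃ λ N → ∀ n → N ℕ.≤ n → seq x n ℚ.≤ seq y n ℚ.+ ε

_<_ : ℝ → ℝ → Set
x < y = ∃ λ ε → 0ℚ ℚ.< ε × ∃ λ N → ∀ n → N ℕ.≤ n → seq x n ℚ.+ ε ℚ.≤ seq y n

Cauchy-const : ∀ a → Cauchy (λ _ → a)
Cauchy-const a ε ε>0 = 0 , λ _ _ _ _ → subst (λ z → ∣ z ∣ ℚ.≤ ε) (sym (ℚ.+-inverseʳ a)) (ℚ.<⇒≤ ε>0)

Cauchy-+ : ∀ {x y} → Cauchy x → Cauchy y → Cauchy (λ n → x n ℚ.+ y n)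
Cauchy-+ {x} {y} cx cy ε ε>0 with cx (½ ℚ.* ε) (half-pos ε>0) | cy (½ ℚ.* ε) (half-pos ε>0)
... | N , hx | M , hy = N ℕ.⊔ M , λ m n Nm Nn →
  subst₂ ℚ._≤_
    (cong ∣_∣ (sum-of-diffs (x m) (x n) (y m) (y n)))
    (halves ε)
    (ℚ.≤-trans (ℚ.∣p+q∣≤∣p∣+∣q∣ (x m ℚ.- x n) (y m ℚ.- y n))
      (ℚ.+-mono-≤ (hx m n (ℕ.m⊔n≤o⇒m≤o N M Nm) (ℕ.m⊔n≤o⇒m≤o N M Nn))
                  (hy m n (ℕ.m⊔n≤o⇒n≤o N M Nm) (ℕ.m⊔n≤o⇒n≤o N M Nn))))

Cauchy⇒bounded : ∀ {x} → Cauchy x →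
  ∃ λ B → 0ℚ ℚ.< B × ∃ λ N → ∀ n → N ℕ.≤ n → ∣ x n ∣ ℚ.≤ B
Cauchy⇒bounded {x} cx with cx 1ℚ (ℚ.positive⁻¹ 1ℚ)
... | N , h = 1ℚ ℚ.+ ∣ x N ∣
            , ℚ.+-mono-<-≤ (ℚ.positive⁻¹ 1ℚ) (ℚ.0≤∣p∣ (x N))
            , N , λ n N≤n → subst (λ z → ∣ z ∣ ℚ.≤ 1ℚ ℚ.+ ∣ x N ∣)
                    (diff-cancel (x n) (x N))
                    (ℚ.≤-trans (ℚ.∣p+q∣≤∣p∣+∣q∣ (x n ℚ.- x N) (x N))
                      (ℚ.+-monoˡ-≤ ∣ x N ∣ (h n N N≤n ℕ.≤-refl)))

split-ε : ∀ B → 0ℚ ℚ.< B → ∀ ε → 0ℚ ℚ.< ε → ∃ λ δ → 0ℚ ℚ.< δ × B ℚ.* δ ≡ ½ ℚ.* ε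
split-ε B B>0 ε ε>0 = δ , *-pos (ℚ.positive⁻¹ (1/ B) {{ℚ.1/pos⇒pos B}}) (half-pos ε>0) ,
    trans (sym (ℚ.*-assoc B (1/ B) (½ ℚ.* ε)))
      (trans (cong (ℚ._* (½ ℚ.* ε)) (ℚ.*-inverseʳ B)) (ℚ.*-identityˡ (½ ℚ.* ε)))
  where
  instance
    pos-B = ℚ.positive B>0
    nz-B  = ℚ.pos⇒nonZero B
  δ = 1/ B ℚ.* (½ ℚ.* ε)

∣*∣≤ : ∀ a b {c d} → 0ℚ ℚ.≤ d → ∣ a ∣ ℚ.≤ c → ∣ b ∣ ℚ.≤ d → ∣ a ℚ.* b ∣ ℚ.≤ c ℚ.* d
∣*∣≤ a b {c} {d} d≥0 p q = subst (ℚ._≤ c ℚ.* d) (sym (ℚ.∣p*q∣≡∣p∣*∣q∣ a b))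
                             (*-mono-≤ (ℚ.0≤∣p∣ a) d≥0 p q)

*-close : ∀ a b c d A B δ η ε → 0ℚ ℚ.≤ δ → 0ℚ ℚ.≤ B →
  A ℚ.* δ ≡ ½ ℚ.* ε → B ℚ.* η ≡ ½ ℚ.* ε → ∣ a ∣ ℚ.≤ A → ∣ d ∣ ℚ.≤ B →
  ∣ a ℚ.- b ∣ ℚ.≤ η → ∣ c ℚ.- d ∣ ℚ.≤ δ → ∣ a ℚ.* c ℚ.- b ℚ.* d ∣ ℚ.≤ ε
*-close a b c d A B δ η ε δ≥0 B≥0 Aδ Bη a≤A d≤B ab cd = begin
  ∣ a ℚ.* c ℚ.- b ℚ.* d ∣                          ≡⟨ cong ∣_∣ (*-telescope a b c d) ⟨
  ∣ a ℚ.* (c ℚ.- d) ℚ.+ (a ℚ.- b) ℚ.* d ∣          ≤⟨ ℚ.∣p+q∣≤∣p∣+∣q∣ (a ℚ.* (c ℚ.- d)) ((a ℚ.- b) ℚ.* d) ⟩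
  ∣ a ℚ.* (c ℚ.- d) ∣ ℚ.+ ∣ (a ℚ.- b) ℚ.* d ∣      ≤⟨ ℚ.+-mono-≤ (∣*∣≤ a (c ℚ.- d) δ≥0 a≤A cd)
                                                                 (∣*∣≤ (a ℚ.- b) d B≥0 ab d≤B) ⟩
  A ℚ.* δ ℚ.+ η ℚ.* B                              ≡⟨ cong₂ ℚ._+_ Aδ (trans (ℚ.*-comm η B) Bη) ⟩
  ½ ℚ.* ε ℚ.+ ½ ℚ.* ε                              ≡⟨ halves ε ⟩
  ε                                                ∎
  where open ℚ.≤-Reasoning

Cauchy-* : ∀ {x y} → Cauchy x → Cauchy y → Cauchy (λ n → x n ℚ.* y n)
Cauchy-* {x} {y} cx cy ε ε>0 =
  let A , A>0 , N₁ , hA = Cauchy⇒bounded cx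
      B , B>0 , N₂ , hB = Cauchy⇒bounded cy
      δ , δ>0 , Aδ = split-ε A A>0 ε ε>0
      η , η>0 , Bη = split-ε B B>0 ε ε>0
      N₃ , hy = cy δ δ>0
      N₄ , hx = cx η η>0
  in (N₁ ℕ.⊔ N₂) ℕ.⊔ (N₃ ℕ.⊔ N₄) , λ m n Nm Nn →
    let N₁₂≤m = ℕ.m⊔n≤o⇒m≤o (N₁ ℕ.⊔ N₂) (N₃ ℕ.⊔ N₄) Nm
        N₃₄≤m = ℕ.m⊔n≤o⇒n≤o (N₁ ℕ.⊔ N₂) (N₃ ℕ.⊔ N₄) Nm
        N₁₂≤n = ℕ.m⊔n≤o⇒m≤o (N₁ ℕ.⊔ N₂) (N₃ ℕ.⊔ N₄) Nn
        N₃₄≤n = ℕ.m⊔n≤o⇒n≤o (N₁ ℕ.⊔ N₂) (N₃ ℕ.⊔ N₄) Nn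
    in *-close (x m) (x n) (y m) (y n) A B δ η ε (ℚ.<⇒≤ δ>0) (ℚ.<⇒≤ B>0) Aδ Bη
         (hA m (ℕ.m⊔n≤o⇒m≤o N₁ N₂ N₁₂≤m)) (hB n (ℕ.m⊔n≤o⇒n≤o N₁ N₂ N₁₂≤n))
         (hx m n (ℕ.m⊔n≤o⇒n≤o N₃ N₄ N₃₄≤m) (ℕ.m⊔n≤o⇒n≤o N₃ N₄ N₃₄≤n))
         (hy m n (ℕ.m⊔n≤o⇒m≤o N₃ N₄ N₃₄≤m) (ℕ.m⊔n≤o⇒m≤o N₃ N₄ N₃₄≤n))

1/-lipschitz : ∀ e a b → (e>0 : 0ℚ ℚ.< e) → (e≤a : e ℚ.≤ a) → (e≤b : e ℚ.≤ b) → ∀ ε →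
  .{{_ : ℚ.NonZero a}} → .{{_ : ℚ.NonZero b}} →
  ∣ a ℚ.- b ∣ ℚ.≤ e ℚ.* e ℚ.* ε → ∣ 1/ a ℚ.- 1/ b ∣ ℚ.≤ ε
1/-lipschitz e a b e>0 e≤a e≤b ε h = ℚ.*-cancelˡ-≤-pos (e ℚ.* e) {{ℚ.pos*pos⇒pos e e}}
  (begin
    e ℚ.* e ℚ.* ∣ 1/ a ℚ.- 1/ b ∣      ≤⟨ ℚ.*-monoʳ-≤-nonNeg ∣ 1/ a ℚ.- 1/ b ∣
                                           {{ℚ.∣-∣-nonNeg (1/ a ℚ.- 1/ b)}}
                                           (*-mono-≤ (ℚ.<⇒≤ e>0) (ℚ.<⇒≤ b>0) e≤a e≤b) ⟩
    a ℚ.* b ℚ.* ∣ 1/ a ℚ.- 1/ b ∣      ≡⟨ cong (ℚ._* ∣ 1/ a ℚ.- 1/ b ∣)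
                                           (ℚ.0≤p⇒∣p∣≡p (ℚ.<⇒≤ (*-pos a>0 b>0))) ⟨
    ∣ a ℚ.* b ∣ ℚ.* ∣ 1/ a ℚ.- 1/ b ∣  ≡⟨ ℚ.∣p*q∣≡∣p∣*∣q∣ (a ℚ.* b) (1/ a ℚ.- 1/ b) ⟨
    ∣ a ℚ.* b ℚ.* (1/ a ℚ.- 1/ b) ∣    ≡⟨ cong ∣_∣ eq ⟩
    ∣ ℚ.- (a ℚ.- b) ∣                  ≡⟨ ℚ.∣-p∣≡∣p∣ (a ℚ.- b) ⟩
    ∣ a ℚ.- b ∣                        ≤⟨ h ⟩
    e ℚ.* e ℚ.* ε                      ∎)
  where
  open ℚ.≤-Reasoning
  instance pos-e = ℚ.positive e>0
  a>0 = ℚ.<-≤-trans e>0 e≤a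
  b>0 = ℚ.<-≤-trans e>0 e≤b
  eq : a ℚ.* b ℚ.* (1/ a ℚ.- 1/ b) ≡ ℚ.- (a ℚ.- b)
  eq = trans (clear-denominators a b (1/ a) (1/ b))
       (trans (cong₂ (λ s t → b ℚ.* s ℚ.- a ℚ.* t) (ℚ.*-inverseʳ a) (ℚ.*-inverseʳ b))
       (trans (cong₂ ℚ._-_ (ℚ.*-identityʳ b) (ℚ.*-identityʳ a)) (sym (neg-diff a b))))

within⇒Cauchy : ∀ {x} → (∀ k l → x k ℚ.≤ x l ℚ.+ + 1 / suc l) → Cauchy x
within⇒Cauchy {x} h ε ε>0 with archimedean ε ε>0
... | N , N≤ε = N , λ m n Nm Nn → ∣∣≤ (x m) (x n) ε (go m n Nn) (go n m Nm)
  where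
  go : ∀ m n → N ℕ.≤ n → x m ℚ.≤ x n ℚ.+ ε
  go m n N≤n = ℚ.≤-trans (h m n) (ℚ.+-monoʳ-≤ (x n) (ℚ.≤-trans
    (frac≤ 1 (suc n) 1 (suc N) (ℕ.*-monoʳ-≤ 1 (s≤s N≤n))) N≤ε))

fromℚ : ℚ → ℝ
fromℚ a = mkℝ (λ _ → a) (Cauchy-const a)

fromℕ : ℕ → ℝ
fromℕ n = fromℚ (+ n / 1)

0ℝ 1ℝ : ℝ
0ℝ = fromℚ 0ℚ
1ℝ = fromℚ 1ℚ

infixl 6 _+_
infixl 7 _*_

_+_ : ℝ → ℝ → ℝ
x + y = mkℝ (λ n → seq x n ℚ.+ seq y n) (Cauchy-+ {seq x} {seq y} (cauchy x) (cauchy y))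

_*_ : ℝ → ℝ → ℝ
x * y = mkℝ (λ n → seq x n ℚ.* seq y n) (Cauchy-* {seq x} {seq y} (cauchy x) (cauchy y))

-- The initial terms, which may vanish, are dropped before inverting termwise.
reciprocal : (x : ℝ) → 0ℝ < x → ℝ
reciprocal x (e , e>0 , N , h) = mkℝ (λ n → (1/ seq x (N ℕ.+ n)) {{nz n}}) cauchy-1/
  where
  e≤x : ∀ n → e ℚ.≤ seq x (N ℕ.+ n)
  e≤x n = subst (ℚ._≤ seq x (N ℕ.+ n)) (ℚ.+-identityˡ e) (h (N ℕ.+ n) (ℕ.m≤m+n N n))
  nz : ∀ n → ℚ.NonZero (seq x (N ℕ.+ n))
  nz n = ℚ.>-nonZero (ℚ.<-≤-trans e>0 (e≤x n))
  cauchy-1/ : Cauchy (λ n → (1/ seq x (N ℕ.+ n)) {{nz n}})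
  cauchy-1/ ε ε>0 with cauchy x (e ℚ.* e ℚ.* ε) (*-pos (*-pos e>0 e>0) ε>0)
  ... | M , k = M , λ m n Mm Mn →
    1/-lipschitz e (seq x (N ℕ.+ m)) (seq x (N ℕ.+ n)) e>0 (e≤x m) (e≤x n) ε {{nz m}} {{nz n}}
      (k (N ℕ.+ m) (N ℕ.+ n) (ℕ.m≤n⇒m≤o+n N Mm) (ℕ.m≤n⇒m≤o+n N Mn))

⌊√_⌋ : ℕ → ℕ
⌊√ zero ⌋  = 0
⌊√ suc n ⌋ = if suc ⌊√ n ⌋ ℕ.* suc ⌊√ n ⌋ ℕ.≤ᵇ suc n then suc ⌊√ n ⌋ else ⌊√ n ⌋

⌊√⌋-spec : ∀ n → ⌊√ n ⌋ ℕ.* ⌊√ n ⌋ ℕ.≤ n × n ℕ.< suc ⌊√ n ⌋ ℕ.* suc ⌊√ n ⌋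
⌊√⌋-spec zero = z≤n , s≤s z≤n
⌊√⌋-spec (suc n) with ⌊√ n ⌋ | ⌊√⌋-spec n
... | r | lo , hi with suc r ℕ.* suc r ℕ.≤ᵇ suc n in eq
... | true  = ℕ.≤ᵇ⇒≤ _ _ (subst T (sym eq) _)
                      , ℕ.≤-<-trans hi (ℕ.*-mono-< (ℕ.n<1+n (suc r)) (ℕ.n<1+n (suc r)))
... | false = ℕ.m≤n⇒m≤1+n lo
                      , ℕ.≰⇒> (λ le → subst T eq (ℕ.≤⇒≤ᵇ le))

sq-cancel-< : ∀ a b → a ℕ.* a ℕ.< b ℕ.* b → a ℕ.< b
sq-cancel-< a b lt with a ℕ.<? b
... | yes p = p
... | no ¬p = contradiction (ℕ.*-mono-≤ (ℕ.≮⇒≥ ¬p) (ℕ.≮⇒≥ ¬p)) (ℕ.<⇒≱ lt)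

√-seq : ℕ → ℕ → ℚ
√-seq n k = + ⌊√ n ℕ.* (suc k ℕ.* suc k) ⌋ / suc k

√-within : ∀ n k l → √-seq n k ℚ.≤ √-seq n l ℚ.+ + 1 / suc l
√-within n k l = subst (√-seq n k ℚ.≤_) (sym (frac+ s 1 l))
  (frac≤ r K (s ℕ.+ 1) L (subst (λ t → r ℕ.* L ℕ.≤ t ℕ.* K) (ℕ.+-comm 1 s)
    (ℕ.<⇒≤ (sq-cancel-< (r ℕ.* L) (suc s ℕ.* K) (begin-strict
      (r ℕ.* L) ℕ.* (r ℕ.* L)           ≡⟨ sw r L ⟩
      (r ℕ.* r) ℕ.* (L ℕ.* L)           ≤⟨ ℕ.*-monoˡ-≤ (L ℕ.* L) (proj₁ (⌊√⌋-spec (n ℕ.* (K ℕ.* K)))) ⟩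
      (n ℕ.* (K ℕ.* K)) ℕ.* (L ℕ.* L)   ≡⟨ solve 3 (λ n k l → n :* k :* l := n :* l :* k) refl n (K ℕ.* K) (L ℕ.* L) ⟩
      (n ℕ.* (L ℕ.* L)) ℕ.* (K ℕ.* K)   <⟨ ℕ.*-monoˡ-< (K ℕ.* K) (proj₂ (⌊√⌋-spec (n ℕ.* (L ℕ.* L)))) ⟩
      (suc s ℕ.* suc s) ℕ.* (K ℕ.* K)   ≡⟨ sw (suc s) K ⟨
      (suc s ℕ.* K) ℕ.* (suc s ℕ.* K)   ∎)))))
  where
  open ℕ-Solver.+-*-Solver
  open ℕ.≤-Reasoning
  K = suc k
  L = suc l
  r = ⌊√ n ℕ.* (K ℕ.* K) ⌋
  s = ⌊√ n ℕ.* (L ℕ.* L) ⌋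
  sw : ∀ a b → (a ℕ.* b) ℕ.* (a ℕ.* b) ≡ (a ℕ.* a) ℕ.* (b ℕ.* b)
  sw = solve 2 (λ a b → (a :* b) :* (a :* b) := (a :* a) :* (b :* b)) refl

-- √n = lim ⌊√(n K²)⌋ / K, with K = k + 1
√ : ℕ → ℝ
√ n = mkℝ (λ k → + ⌊√ n ℕ.* (suc k ℕ.* suc k) ⌋ / suc k) (within⇒Cauchy (√-within n))

√-positive : ∀ n → .{{NonZero n}} → 0ℝ < √ n
√-positive n = 1ℚ , ℚ.positive⁻¹ 1ℚ , 0 , λ k _ →
  subst (ℚ._≤ √-seq n k) (sym (ℚ.+-identityˡ 1ℚ)) (frac≤ 1 1 ⌊√ n ℕ.* (suc k ℕ.* suc k) ⌋ (suc k)
    (subst₂ ℕ._≤_ (sym (ℕ.*-identityˡ (suc k))) (sym (ℕ.*-identityʳ _))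
      (ℕ.s≤s⁻¹ (sq-cancel-< (suc k) (suc ⌊√ n ℕ.* (suc k ℕ.* suc k) ⌋)
        (ℕ.≤-<-trans (ℕ.m≤n*m (suc k ℕ.* suc k) n)
          (proj₂ (⌊√⌋-spec (n ℕ.* (suc k ℕ.* suc k)))))))))

1/√ : (n : ℕ) → .{{NonZero n}} → ℝ
1/√ n = reciprocal (√ n) (√-positive n)

-- harmonic a n = ∑_{1 ≤ i ≤ n} 1/(a + i)
harmonic : ℕ → ℕ → ℚ
harmonic a zero    = 0ℚ
harmonic a (suc n) = harmonic a n ℚ.+ + 1 / suc (a ℕ.+ n)

harmonic-+ : ∀ a m n → harmonic a (m ℕ.+ n) ≡ harmonic a m ℚ.+ harmonic (a ℕ.+ m) n
harmonic-+ a m zero = trans (cong (harmonic a) (ℕ.+-identityʳ m)) (sym (ℚ.+-identityʳ _))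
harmonic-+ a m (suc n) = trans (cong (harmonic a) (ℕ.+-suc m n))
  (trans (cong₂ (λ s t → s ℚ.+ + 1 / suc t) (harmonic-+ a m n) (sym (ℕ.+-assoc a m n)))
         (ℚ.+-assoc (harmonic a m) (harmonic (a ℕ.+ m) n) (+ 1 / suc (a ℕ.+ m ℕ.+ n))))

harmonic-≥ : ∀ a n d → a ℕ.+ n ℕ.≤ suc d → + n / suc d ℚ.≤ harmonic a n
harmonic-≥ a zero    d le = ℚ.≤-reflexive (ℚ.0/n≡0 (suc d))
harmonic-≥ a (suc n) d le = subst (ℚ._≤ harmonic a (suc n))
  (trans (frac+ n 1 d) (cong (λ t → + t / suc d) (ℕ.+-comm n 1)))
  (ℚ.+-mono-≤ (harmonic-≥ a n d (ℕ.≤-trans (ℕ.+-monoʳ-≤ a (ℕ.n≤1+n n)) le))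
    (frac≤ 1 (suc d) 1 (suc (a ℕ.+ n)) (ℕ.*-monoʳ-≤ 1 (subst (ℕ._≤ suc d) (ℕ.+-suc a n) le))))

harmonic-≤ : ∀ a n d → suc d ℕ.≤ suc a → harmonic a n ℚ.≤ + n / suc d
harmonic-≤ a zero    d le = ℚ.≤-reflexive (sym (ℚ.0/n≡0 (suc d)))
harmonic-≤ a (suc n) d le = subst (harmonic a (suc n) ℚ.≤_)
  (trans (frac+ n 1 d) (cong (λ t → + t / suc d) (ℕ.+-comm n 1)))
  (ℚ.+-mono-≤ (harmonic-≤ a n d le)
    (frac≤ 1 (suc (a ℕ.+ n)) 1 (suc d) (ℕ.*-monoʳ-≤ 1 (ℕ.≤-trans le (s≤s (ℕ.m≤m+n a n))))))

refine-≥ : ∀ a n k → harmonic a n ℚ.≤ harmonic (a ℕ.* suc k) (n ℕ.* suc k)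
refine-≥ a zero    k = ℚ.≤-refl
refine-≥ a (suc n) k = subst (harmonic a (suc n) ℚ.≤_)
  (trans (sym (harmonic-+ (a ℕ.* K) (n ℕ.* K) K)) (cong (harmonic (a ℕ.* K)) (ℕ.+-comm (n ℕ.* K) K)))
  (ℚ.+-mono-≤ (refine-≥ a n k) (subst (λ t → + 1 / suc (a ℕ.+ n) ℚ.≤ harmonic t K)
    (ℕ.*-distribʳ-+ K a n)
    (ℚ.≤-trans
      (frac≤ 1 (suc (a ℕ.+ n)) K (suc (a ℕ.+ n) ℕ.* K)
        (ℕ.≤-reflexive (trans (ℕ.*-identityˡ _) (ℕ.*-comm (suc (a ℕ.+ n)) K))))
      (harmonic-≥ ((a ℕ.+ n) ℕ.* K) K _ (ℕ.≤-reflexive (ℕ.+-comm ((a ℕ.+ n) ℕ.* K) K))))))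
  where K = suc k

refine-≤ : ∀ a n k → harmonic (suc a ℕ.* suc k) (n ℕ.* suc k) ℚ.≤ harmonic a n
refine-≤ a zero    k = ℚ.≤-refl
refine-≤ a (suc n) k = subst (ℚ._≤ harmonic a (suc n))
  (trans (sym (harmonic-+ (suc a ℕ.* K) (n ℕ.* K) K))
         (cong (harmonic (suc a ℕ.* K)) (ℕ.+-comm (n ℕ.* K) K)))
  (ℚ.+-mono-≤ (refine-≤ a n k) (subst (λ t → harmonic t K ℚ.≤ + 1 / suc (a ℕ.+ n))
    (ℕ.*-distribʳ-+ K (suc a) n)
    (ℚ.≤-trans
      (harmonic-≤ (suc (a ℕ.+ n) ℕ.* K) K _ (ℕ.n≤1+n _))
      (frac≤ K (suc (a ℕ.+ n) ℕ.* K) 1 (suc (a ℕ.+ n))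
        (ℕ.≤-reflexive (trans (ℕ.*-comm K (suc (a ℕ.+ n))) (sym (ℕ.*-identityˡ _))))))))
  where K = suc k

harmonic-shift : ∀ a n → harmonic a n ℚ.≤ harmonic (suc a) n ℚ.+ + 1 / suc a
harmonic-shift a n = ℚ.≤-trans
  (subst (ℚ._≤ harmonic a (suc n)) (ℚ.+-identityʳ (harmonic a n))
    (ℚ.+-monoʳ-≤ (harmonic a n) (ℚ.nonNegative⁻¹ _ {{ℚ.normalize-nonNeg 1 (suc (a ℕ.+ n))}})))
  (ℚ.≤-reflexive (trans (harmonic-+ a 1 n)
    (trans (cong₂ (λ s t → 0ℚ ℚ.+ + 1 / suc s ℚ.+ harmonic t n) (ℕ.+-identityʳ a) (ℕ.+-comm a 1))
    (trans (cong (ℚ._+ harmonic (suc a) n) (ℚ.+-identityˡ (+ 1 / suc a)))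
           (ℚ.+-comm (+ 1 / suc a) (harmonic (suc a) n))))))

log-within : ∀ c k l →
  harmonic (suc k) (c ℕ.* suc k) ℚ.≤ harmonic (suc l) (c ℕ.* suc l) ℚ.+ + 1 / suc l
log-within c k l = begin
  harmonic K (c ℕ.* K)                          ≤⟨ refine-≥ K (c ℕ.* K) l ⟩
  harmonic (K ℕ.* L) (c ℕ.* K ℕ.* L)            ≡⟨ cong₂ harmonic (ℕ.*-comm K L)
                                                     (solve 3 (λ c k l → c :* k :* l := c :* l :* k) refl c K L) ⟩
  harmonic (L ℕ.* K) (c ℕ.* L ℕ.* K)            ≤⟨ refine-≤ l (c ℕ.* L) k ⟩
  harmonic l (c ℕ.* L)                          ≤⟨ harmonic-shift l (c ℕ.* L) ⟩
  harmonic L (c ℕ.* L) ℚ.+ + 1 / L              ∎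
  where
  open ℚ.≤-Reasoning
  open ℕ-Solver.+-*-Solver
  K = suc k
  L = suc l

-- log q = ∫₁^q dt/t, as the limit of its right Riemann sums of mesh 1/K, K = k + 1:
-- ∑_{1 ≤ j ≤ (q-1)K} (1/K) · 1/(1 + j/K) = ∑_{1 ≤ j ≤ (q-1)K} 1/(K + j)
log : (q : ℕ) → .{{NonZero q}} → ℝ
log q = mkℝ (λ k → harmonic (suc k) (ℕ.pred q ℕ.* suc k)) (within⇒Cauchy (log-within (ℕ.pred q)))

SquareFree : ℕ → Set
SquareFree q = ∀ d → d ℕ.* d ∣ q → d ≡ 1

-- Counting residues from 0 instead of 1 changes nothing: gcd 0 q = gcd q q.
φ : ℕ → ℕ
φ q = length (filter (λ k → coprime? k q) (upTo q))

primeDivisors : (q : ℕ) → List (∃ λ p → Prime p × p ∣ q)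
primeDivisors q = mapMaybe (λ p → Maybe.map (p ,_) (dec⇒maybe (prime? p ×-dec p ∣? q))) (upTo (suc q))

ω : ℕ → ℕ
ω q = length (primeDivisors q)

∏[1+1/√p] : ℕ → ℝ
∏[1+1/√p] q = foldr (λ (p , p-prime , _) r → (1ℝ + 1/√ p {{prime⇒nonZero p-prime}}) * r) 1ℝ
                    (primeDivisors q)

IsSquareMod : ℕ → ℤ → Set
IsSquareMod q s = ∀ p → Prime p → p ∣ q → ∃ λ x → + p ℤ.∣ x ℤ.* x ℤ.- s

-- s lists, in increasing order and indexed from 0, the non-negative squares modulo q.
record EnumeratesSquaresMod (q : ℕ) (s : ℕ → ℕ) : Set where
  field
    increasing : ∀ i → s i ℕ.< s (suc i)
    sound      : ∀ i → IsSquareMod q (+ s i)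
    complete   : ∀ n → IsSquareMod q (+ n) → ∃ λ i → s i ≡ n

-- An increasing s has i ≤ s i, so every i with s i < q occurs in upTo q.
∑-squared-gaps : ℕ → (ℕ → ℕ) → ℕ
∑-squared-gaps q s =
  sum (map (λ i → (s (suc i) ℕ.∸ s i) ℕ.^ 2) (filter (λ i → s i ℕ.<? q) (upTo q)))

{-# OPTIONS --safe #-}
module Submission where

-- A gap of length g contributes, for every h < g, g − h windows of h consecutive integers without
-- squares, so ∑ g² is controlled by the number of empty windows of each length h. Chebyshev's
-- inequality bounds that number by the variance of the number of squares in a window, which must be
-- at most a constant times its mean times ∏(1 + 1/√p). For odd p, twice the indicator of the squares
-- modulo p is f = r + 1[p ∣ ·], where r(x) counts the roots of y² = x, and with χ = r − 1
--   ∑ₓ f(x − a) f(x − b) = (p + 1) + (p + 1) 1[p ∣ k] + χ(k) + χ(−k),   k = a − b.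
-- Expanding the product over p ∣ q leaves products of the kernels 1[p ∣ ·] and χ(± ·), whose
-- convolution operators have norms 1 and √p, since ∑ₓ χ(x − a) χ(x − b) = p 1[p ∣ k] − 1. Norms
-- multiply over coprime moduli, and the sum of such a kernel over the pairs in a
-- window exceeds its main term by at most the norm times the length. Collecting terms, the local
-- factors are 2(p + 1)(1 + p/(p+1) · 1/√p), exactly what is needed up to ∏ p²/(p² − 1) ≤ 2.

-- The factor `log q` is a harmonic number: if y denotes the product of the local factors, at most q
-- y / h of the q windows of length h are empty, and only h ≤ q has to be considered, because q is
-- itself a square modulo q and so no gap below it passes it. Norms of convolution operators take
-- the place of exponential sums: every norm comes from double counting over ℤ/p, and no complex
-- characters or Gauss sums appear. Since √p is irrational, a kernel carries only an upper bound for
-- its norm. For χ any positive σ with p ≤ σ² will do, and σ = pρ is taken with a rational ρ ≥ 1/√p,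
-- so that all estimates stay in ℚ. The prime 2 is set apart because the count of the solutions of
-- y² - z² = a - b divides by 2. Every integer is a square modulo 2, so the weight there is
-- constant.

module SquareGaps where

  open import Defs hiding (_+_; _*_; _≤_; _<_)
  open import Data.Integer as ℤ using (ℤ) renaming (+_ to pos)
  import Data.Integer.DivMod as ℤ/
  open import Data.Integer.Divisibility.Signed as ℤ∣ using (divides) renaming (_∣_ to _∣ℤ_; _∣?_ to _∣ℤ?_)
  import Data.Integer.Properties as ℤ
  import Data.Integer.Solver as ℤ-Solver
  open import Data.List as List using (List; []; _∷_; _++_; filter; map; upTo; length; foldr; mapMaybe)
  open import Data.List.Membership.Propositional using (_∈_)
  open import Data.List.Membership.Propositional.Properties using (∈-upTo⁺)
  import Data.List.Properties as List
  open import Data.List.Relation.Unary.All as All using (All; []; _∷_)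
  open import Data.List.Relation.Unary.AllPairs using (AllPairs; []; _∷_)
  import Data.List.Relation.Unary.AllPairs.Properties as AllPairs
  open import Data.List.Relation.Unary.Any using (here; there)
  open import Data.Maybe as Maybe using (Maybe)
  open import Data.Nat as ℕ using (ℕ; zero; suc; NonZero; z≤n; s≤s)
  open import Data.Nat.Coprimality as Coprime using (Coprime; coprime?)
  open import Data.Nat.Divisibility as ℕ∣ using (_∣_; _∣?_)
  import Data.Nat.DivMod as ℕ/
  open import Data.Nat.GCD as GCD using (module Bézout)
  open import Data.Nat.ListAction using (sum; product)
  open import Data.Nat.ListAction.Properties using (sum-++; ∈⇒∣product)
  open import Data.Nat.Primality using
    (Prime; prime?; prime⇒nonZero; prime⇒nonTrivial; prime⇒irreducible; euclidsLemma)
  open import Data.Nat.Primality.Factorisation using (factorise; factorisationHasAllPrimeFactors)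
  import Data.Nat.Properties as ℕ
  open import Data.Product using (∃; ∃₂; _×_; _,_; proj₁; proj₂)
  open import Data.Rational as ℚ using (ℚ; 0ℚ; 1ℚ; _/_; _+_; _*_; _-_; -_; _≤_; _<_)
  import Data.Rational.Properties as ℚ
  import Data.Rational.Solver as ℚ-Solver
  import Data.Rational.Unnormalised as ℚᵘ
  import Data.Rational.Unnormalised.Properties as ℚᵘ
  open import Data.Sum using (_⊎_; inj₁; inj₂)
  open import Function using (_∘_)
  open import Relation.Binary.PropositionalEquality
  open import Relation.Nullary using (Dec; yes; no; contradiction; ¬_)
  open import Relation.Nullary.Decidable using (dec⇒maybe; _×-dec_)

  open ℚ-Solver.+-*-Solver
  module ℤS = ℤ-Solver.+-*-Solver

  -- Order arithmetic on ℚ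

  0≤* : ∀ {a b} → 0ℚ ≤ a → 0ℚ ≤ b → 0ℚ ≤ a * b
  0≤* {a} {b} p q = subst (_≤ a * b) (ℚ.*-zeroʳ a) (ℚ.*-monoˡ-≤-nonNeg a {{ℚ.nonNegative p}} q)

  0≤+ : ∀ {a b} → 0ℚ ≤ a → 0ℚ ≤ b → 0ℚ ≤ a + b
  0≤+ = ℚ.+-mono-≤

  *-monoˡ : ∀ {a b c} → 0ℚ ≤ c → a ≤ b → c * a ≤ c * b
  *-monoˡ {c = c} c≥0 = ℚ.*-monoˡ-≤-nonNeg c {{ℚ.nonNegative c≥0}}

  *-monoʳ : ∀ {a b c} → 0ℚ ≤ c → a ≤ b → a * c ≤ b * c
  *-monoʳ {c = c} c≥0 = ℚ.*-monoʳ-≤-nonNeg c {{ℚ.nonNegative c≥0}}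

  *-cancelˡ : ∀ {a b c} → 0ℚ < c → c * a ≤ c * b → a ≤ b
  *-cancelˡ {c = c} c>0 = ℚ.*-cancelˡ-≤-pos c {{ℚ.positive c>0}}

  0≤1 : 0ℚ ≤ 1ℚ
  0≤1 = ℚ.nonNegative⁻¹ 1ℚ

  0<1 : 0ℚ < 1ℚ
  0<1 = ℚ.positive⁻¹ 1ℚ

  ≤-by : ∀ {a b} c → 0ℚ ≤ c → b ≡ a + c → a ≤ b
  ≤-by {a} c c≥0 eq = subst₂ _≤_ (ℚ.+-identityʳ a) (sym eq) (ℚ.+-monoʳ-≤ a c≥0)

  0≤sq : ∀ a → 0ℚ ≤ a * a
  0≤sq a with ℚ.≤-total 0ℚ a
  ... | inj₁ p = 0≤* p p
  ... | inj₂ p = subst (0ℚ ≤_) (solve 1 (λ a → (:- a) :* (:- a) := a :* a) refl a) (0≤* q q)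
    where
    q : 0ℚ ≤ - a
    q = ℚ.neg-antimono-≤ p

  p≤q⇒0≤q-p : ∀ {p q} → p ≤ q → 0ℚ ≤ q - p
  p≤q⇒0≤q-p {p} {q} p≤q = subst (_≤ q - p) (ℚ.+-inverseʳ p) (ℚ.+-monoˡ-≤ (- p) p≤q)

  p≤p+q : ∀ p {q} → 0ℚ ≤ q → p ≤ p + q
  p≤p+q p {q} q≥0 = ≤-by q q≥0 refl

  -- The embedding of ℕ into ℚ

  abstract

    -- Kept abstract so that `ι n` is an opaque atom for the ring solver and the type checker,
    -- instead of unfolding to a normalised fraction.
    ι : ℕ → ℚ
    ι n = pos n / 1

    ι-def : ∀ n → ι n ≡ pos n / 1
    ι-def n = refl

    ι-0 : ι 0 ≡ 0ℚ
    ι-0 = refl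

    ι-1 : ι 1 ≡ 1ℚ
    ι-1 = refl

    ι-+ : ∀ m n → ι (m ℕ.+ n) ≡ ι m + ι n
    ι-+ m n = sym (frac+ m n 0)

    ι-mono : ∀ {m n} → m ℕ.≤ n → ι m ≤ ι n
    ι-mono {m} {n} m≤n = frac≤ m 1 n 1 (ℕ.*-monoˡ-≤ 1 m≤n)

  ι-suc : ∀ n → ι (suc n) ≡ 1ℚ + ι n
  ι-suc n = trans (ι-+ 1 n) (cong (_+ ι n) ι-1)

  ι-* : ∀ m n → ι (m ℕ.* n) ≡ ι m * ι n
  ι-* zero    n = trans ι-0 (sym (trans (cong (_* ι n) ι-0) (ℚ.*-zeroˡ (ι n))))
  ι-* (suc m) n = begin
    ι (n ℕ.+ m ℕ.* n)    ≡⟨ ι-+ n (m ℕ.* n) ⟩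
    ι n + ι (m ℕ.* n)    ≡⟨ cong (ι n +_) (ι-* m n) ⟩
    ι n + ι m * ι n      ≡⟨ solve 2 (λ n m → n :+ m :* n := (con 1ℚ :+ m) :* n) refl (ι n) (ι m) ⟩
    (1ℚ + ι m) * ι n     ≡⟨ cong (_* ι n) (ι-suc m) ⟨
    ι (suc m) * ι n      ∎
    where open ≡-Reasoning

  ι-2 : ι 2 ≡ 1ℚ + 1ℚ
  ι-2 = trans (ι-suc 1) (cong (1ℚ +_) ι-1)

  ι-3 : ι 3 ≡ 1ℚ + (1ℚ + 1ℚ)
  ι-3 = trans (ι-suc 2) (cong (1ℚ +_) ι-2)

  0≤ι : ∀ n → 0ℚ ≤ ι n
  0≤ι n = subst (_≤ ι n) ι-0 (ι-mono {0} z≤n)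

  1≤ι : ∀ n → .{{NonZero n}} → 1ℚ ≤ ι n
  1≤ι (suc n) = subst (_≤ ι (suc n)) ι-1 (ι-mono {1} (s≤s z≤n))

  0<ι : ∀ n → .{{NonZero n}} → 0ℚ < ι n
  0<ι n = ℚ.<-≤-trans 0<1 (1≤ι n)

  -- Finite sums

  ∑ : ℕ → (ℕ → ℚ) → ℚ
  ∑ zero    f = 0ℚ
  ∑ (suc n) f = ∑ n f + f n

  ∑-cong-< : ∀ n {f g} → (∀ i → i ℕ.< n → f i ≡ g i) → ∑ n f ≡ ∑ n g
  ∑-cong-< zero    h = refl
  ∑-cong-< (suc n) h =
    cong₂ _+_ (∑-cong-< n (λ i i<n → h i (ℕ.m<n⇒m<1+n i<n))) (h n (ℕ.n<1+n n))

  ∑-cong : ∀ n {f g} → (∀ i → f i ≡ g i) → ∑ n f ≡ ∑ n g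
  ∑-cong n h = ∑-cong-< n (λ i _ → h i)

  ∑-mono-< : ∀ n {f g} → (∀ i → i ℕ.< n → f i ≤ g i) → ∑ n f ≤ ∑ n g
  ∑-mono-< zero    h = ℚ.≤-refl
  ∑-mono-< (suc n) h =
    ℚ.+-mono-≤ (∑-mono-< n (λ i i<n → h i (ℕ.m<n⇒m<1+n i<n))) (h n (ℕ.n<1+n n))

  ∑-mono : ∀ n {f g} → (∀ i → f i ≤ g i) → ∑ n f ≤ ∑ n g
  ∑-mono n h = ∑-mono-< n (λ i _ → h i)

  ∑-0 : ∀ n → ∑ n (λ _ → 0ℚ) ≡ 0ℚ
  ∑-0 zero    = refl
  ∑-0 (suc n) = cong (_+ 0ℚ) (∑-0 n)

  ∑-nonneg : ∀ n {f} → (∀ i → 0ℚ ≤ f i) → 0ℚ ≤ ∑ n f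
  ∑-nonneg n {f} h = subst (_≤ ∑ n f) (∑-0 n) (∑-mono n h)

  ∑-+ : ∀ n f g → ∑ n (λ i → f i + g i) ≡ ∑ n f + ∑ n g
  ∑-+ zero    f g = refl
  ∑-+ (suc n) f g = trans (cong (_+ (f n + g n)) (∑-+ n f g))
    (solve 4 (λ a b c d → (a :+ b) :+ (c :+ d) := (a :+ c) :+ (b :+ d)) refl (∑ n f) (∑ n g) (f n) (g n))

  ∑-*ˡ : ∀ n c f → ∑ n (λ i → c * f i) ≡ c * ∑ n f
  ∑-*ˡ zero    c f = sym (ℚ.*-zeroʳ c)
  ∑-*ˡ (suc n) c f = trans (cong (_+ c * f n) (∑-*ˡ n c f)) (sym (ℚ.*-distribˡ-+ c (∑ n f) (f n)))

  ∑-*ʳ : ∀ n c f → ∑ n (λ i → f i * c) ≡ ∑ n f * c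
  ∑-*ʳ n c f = trans (∑-cong n (λ i → ℚ.*-comm (f i) c)) (trans (∑-*ˡ n c f) (ℚ.*-comm c (∑ n f)))

  ∑-const : ∀ n c → ∑ n (λ _ → c) ≡ ι n * c
  ∑-const zero    c = sym (trans (cong (_* c) ι-0) (ℚ.*-zeroˡ c))
  ∑-const (suc n) c = trans (cong (_+ c) (∑-const n c))
    (trans (solve 2 (λ n c → n :* c :+ c := (con 1ℚ :+ n) :* c) refl (ι n) c)
           (cong (_* c) (sym (ι-suc n))))

  ∑-swap : ∀ m n (f : ℕ → ℕ → ℚ) →
    ∑ m (λ i → ∑ n (λ j → f i j)) ≡ ∑ n (λ j → ∑ m (λ i → f i j))
  ∑-swap zero    n f = sym (∑-0 n)
  ∑-swap (suc m) n f = trans (cong (_+ ∑ n (f m)) (∑-swap m n f))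
    (sym (∑-+ n (λ j → ∑ m (λ i → f i j)) (f m)))

  ∑-split : ∀ m n f → ∑ (m ℕ.+ n) f ≡ ∑ m f + ∑ n (λ i → f (m ℕ.+ i))
  ∑-split m zero    f = trans (cong (λ k → ∑ k f) (ℕ.+-identityʳ m)) (sym (ℚ.+-identityʳ (∑ m f)))
  ∑-split m (suc n) f = trans (cong (λ k → ∑ k f) (ℕ.+-suc m n))
    (trans (cong (_+ f (m ℕ.+ n)) (∑-split m n f)) (ℚ.+-assoc (∑ m f) _ _))

  ∑-head : ∀ n f → ∑ (suc n) f ≡ f 0 + ∑ n (f ∘ suc)
  ∑-head n f = trans (∑-split 1 n f) (cong (_+ ∑ n (f ∘ suc)) (ℚ.+-identityˡ (f 0)))

  ∑-blocks : ∀ m n f → ∑ (n ℕ.* m) f ≡ ∑ n (λ b → ∑ m (λ a → f (b ℕ.* m ℕ.+ a)))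
  ∑-blocks m zero    f = refl
  ∑-blocks m (suc n) f = trans (cong (λ k → ∑ k f) (ℕ.+-comm m (n ℕ.* m)))
    (trans (∑-split (n ℕ.* m) m f) (cong (_+ ∑ m (λ a → f (n ℕ.* m ℕ.+ a))) (∑-blocks m n f)))

  ∑-≤-range : ∀ {m n} f → m ℕ.≤ n → (∀ i → 0ℚ ≤ f i) → ∑ m f ≤ ∑ n f
  ∑-≤-range {m} {n} f m≤n f≥0 = subst (λ k → ∑ m f ≤ ∑ k f) (ℕ.m+[n∸m]≡n m≤n)
    (ℚ.≤-trans (p≤p+q (∑ m f) (∑-nonneg (n ℕ.∸ m) (λ i → f≥0 (m ℕ.+ i))))
               (ℚ.≤-reflexive (sym (∑-split m (n ℕ.∸ m) f))))

  ∑-*-∑ : ∀ m n f g → ∑ m f * ∑ n g ≡ ∑ m (λ i → ∑ n (λ j → f i * g j))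
  ∑-*-∑ m n f g = trans (sym (∑-*ʳ m (∑ n g) f)) (∑-cong m (λ i → sym (∑-*ˡ n (f i) g)))

  -- Periodic functions on ℤ

  Periodic : ℕ → (ℤ → ℚ) → Set
  Periodic n F = ∀ x k → F (x ℤ.+ k ℤ.* pos n) ≡ F x

  periodic-∘ : ∀ {n F} → Periodic n F → (g : ℤ → ℤ) →
    (∀ x k → ∃ λ l → g (x ℤ.+ k ℤ.* pos n) ≡ g x ℤ.+ l ℤ.* pos n) → Periodic n (F ∘ g)
  periodic-∘ {F = F} pF g h x k = let l , eq = h x k in trans (cong F eq) (pF (g x) l)

  periodic-shift : ∀ {n F} c → Periodic n F → Periodic n (λ x → F (c ℤ.+ x))
  periodic-shift c pF = periodic-∘ pF (λ z → c ℤ.+ z) (λ x k → k , sym (ℤ.+-assoc c x _))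

  periodic-reflect : ∀ {n F} c → Periodic n F → Periodic n (λ x → F (c ℤ.- x))
  periodic-reflect {n} c pF = periodic-∘ pF (λ z → c ℤ.- z) (λ x k → ℤ.- k ,
    ℤS.solve 4 (λ c x k n → c ℤS.:- (x ℤS.:+ k ℤS.:* n) ℤS.:= (c ℤS.:- x) ℤS.:+ (ℤS.:- k) ℤS.:* n) refl c x k (pos n))

  periodic-* : ∀ {n F G} → Periodic n F → Periodic n G → Periodic n (λ x → F x * G x)
  periodic-* pF pG x k = cong₂ _*_ (pF x k) (pG x k)

  periodic-multiple : ∀ {m n F} → m ℕ∣.∣ n → Periodic m F → Periodic n F
  periodic-multiple {m} {n} {F} (ℕ∣.divides q refl) pF x k =
    trans (cong (λ z → F (x ℤ.+ k ℤ.* z)) (ℤ.pos-* q m))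
      (trans (cong (λ z → F (x ℤ.+ z)) (sym (ℤ.*-assoc k (pos q) (pos m)))) (pF x (k ℤ.* pos q)))

  +-cancelʳ : ∀ {a b c} → a + c ≡ b + c → a ≡ b
  +-cancelʳ {a} {b} {c} eq = trans (sym (undo a c)) (trans (cong (_- c) eq) (undo b c))
    where
    undo : ∀ a c → (a + c) - c ≡ a
    undo = solve 2 (λ a c → (a :+ c) :- c := a) refl

  -- Moving the start by one drops the first term and appends one that equals it by periodicity.
  -- Induction then runs in both directions of ℤ.
  ∑-shift : ∀ {n F} → Periodic n F → ∀ x → ∑ n (λ i → F (x ℤ.+ pos i)) ≡ ∑ n (λ i → F (pos i))
  ∑-shift {n} {F} pF = go
    where
    step : ∀ x → ∑ n (λ i → F (ℤ.suc x ℤ.+ pos i)) ≡ ∑ n (λ i → F (x ℤ.+ pos i))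
    step x = sym (+-cancelʳ (begin
      ∑ n g + g n                          ≡⟨ ∑-head n g ⟩
      g 0 + ∑ n (g ∘ suc)                  ≡⟨ cong₂ _+_ g0 (∑-cong n next) ⟩
      g n + ∑ n (λ i → F (ℤ.suc x ℤ.+ pos i))  ≡⟨ ℚ.+-comm (g n) _ ⟩
      ∑ n (λ i → F (ℤ.suc x ℤ.+ pos i)) + g n  ∎))
      where
      open ≡-Reasoning
      g : ℕ → ℚ
      g i = F (x ℤ.+ pos i)
      g0 : g 0 ≡ g n
      g0 = trans (cong F (ℤ.+-identityʳ x))
        (trans (sym (pF x ℤ.1ℤ)) (cong (λ z → F (x ℤ.+ z)) (ℤ.*-identityˡ (pos n))))
      next : ∀ i → g (suc i) ≡ F (ℤ.suc x ℤ.+ pos i)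
      next i = cong F (ℤS.solve 2 (λ x i → x ℤS.:+ (ℤS.con ℤ.1ℤ ℤS.:+ i) ℤS.:= (ℤS.con ℤ.1ℤ ℤS.:+ x) ℤS.:+ i) refl x (pos i))
    go : ∀ x → ∑ n (λ i → F (x ℤ.+ pos i)) ≡ ∑ n (λ i → F (pos i))
    go (pos zero)       = refl
    go (pos (suc m))    = trans (step (pos m)) (go (pos m))
    go ℤ.-[1+ zero ]    = sym (step ℤ.-[1+ 0 ])
    go ℤ.-[1+ suc m ]   = trans (sym (step ℤ.-[1+ suc m ])) (go ℤ.-[1+ m ])

  -- The indicator of divisibility

  abstract

    -- The delta function of ℤ/n, lifted to a periodic function on ℤ; it is the unit of convolution.
    𝟙 : ℕ → ℤ → ℚ
    𝟙 n x with pos n ∣ℤ? x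
    ... | yes _ = 1ℚ
    ... | no  _ = 0ℚ

    𝟙-yes : ∀ {n x} → pos n ∣ℤ x → 𝟙 n x ≡ 1ℚ
    𝟙-yes {n} {x} d with pos n ∣ℤ? x
    ... | yes _ = refl
    ... | no ¬d = contradiction d ¬d

    𝟙-no : ∀ {n x} → ¬ (pos n ∣ℤ x) → 𝟙 n x ≡ 0ℚ
    𝟙-no {n} {x} ¬d with pos n ∣ℤ? x
    ... | yes d = contradiction d ¬d
    ... | no _  = refl

  𝟙-cong : ∀ {n x y} → (pos n ∣ℤ x → pos n ∣ℤ y) → (pos n ∣ℤ y → pos n ∣ℤ x) → 𝟙 n x ≡ 𝟙 n y
  𝟙-cong {n} {x} {y} f g with pos n ∣ℤ? x
  ... | yes d = trans (𝟙-yes d) (sym (𝟙-yes (f d)))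
  ... | no ¬d = trans (𝟙-no ¬d) (sym (𝟙-no (¬d ∘ g)))

  0≤𝟙 : ∀ n x → 0ℚ ≤ 𝟙 n x
  0≤𝟙 n x with pos n ∣ℤ? x
  ... | yes d = subst (0ℚ ≤_) (sym (𝟙-yes d)) 0≤1
  ... | no ¬d = ℚ.≤-reflexive (sym (𝟙-no ¬d))

  𝟙≤1 : ∀ n x → 𝟙 n x ≤ 1ℚ
  𝟙≤1 n x with pos n ∣ℤ? x
  ... | yes d = ℚ.≤-reflexive (𝟙-yes d)
  ... | no ¬d = subst (_≤ 1ℚ) (sym (𝟙-no ¬d)) 0≤1

  𝟙-neg : ∀ n x → 𝟙 n (ℤ.- x) ≡ 𝟙 n x
  𝟙-neg n x = 𝟙-cong
    (λ d → subst (pos n ∣ℤ_) (ℤ.neg-involutive x) (ℤ∣.∣m⇒∣-m d)) ℤ∣.∣m⇒∣-m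

  𝟙-minus : ∀ n x y → 𝟙 n (x ℤ.- y) ≡ 𝟙 n (y ℤ.- x)
  𝟙-minus n x y = trans (sym (𝟙-neg n (x ℤ.- y)))
    (cong (𝟙 n) (ℤS.solve 2 (λ x y → ℤS.:- (x ℤS.:- y) ℤS.:= y ℤS.:- x) refl x y))

  𝟙-periodic : ∀ n → Periodic n (𝟙 n)
  𝟙-periodic n x k = 𝟙-cong (λ d → ℤ∣.∣m+n∣n⇒∣m d kn) (λ d → ℤ∣.∣m∣n⇒∣m+n d kn)
    where
    kn : pos n ∣ℤ k ℤ.* pos n
    kn = divides k refl

  𝟙-small : ∀ {n i} → .{{NonZero i}} → i ℕ.< n → 𝟙 n (pos i) ≡ 0ℚ
  𝟙-small {n} {i} i<n = 𝟙-no (λ d → ℕ.<⇒≱ i<n (ℕ∣.∣⇒≤ (ℤ∣.∣⇒∣ᵤ d)))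

  𝟙-zero : ∀ n → 𝟙 n (pos 0) ≡ 1ℚ
  𝟙-zero n = 𝟙-yes (divides (pos 0) refl)

  -- After a shift of the summation by `x`, the only index in [0, n) with a nonzero delta is 0.
  sift : ∀ {n F} → .{{NonZero n}} → Periodic n F → ∀ x → ∑ n (λ y → 𝟙 n (pos y ℤ.- x) * F (pos y)) ≡ F x
  sift {suc m} {F} pF x = begin
    ∑ n (λ y → G (pos y))                     ≡⟨ ∑-shift pG x ⟨
    ∑ n (λ i → G (x ℤ.+ pos i))               ≡⟨ ∑-cong n (λ i → cong (λ z → 𝟙 n z * F (x ℤ.+ pos i)) (cancel x (pos i))) ⟩
    ∑ n (λ i → 𝟙 n (pos i) * F (x ℤ.+ pos i)) ≡⟨ ∑-head m _ ⟩
    𝟙 n (pos 0) * F (x ℤ.+ pos 0) + ∑ m (λ i → 𝟙 n (pos (suc i)) * F (x ℤ.+ pos (suc i)))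
      ≡⟨ cong₂ _+_ (trans (cong (_* F (x ℤ.+ pos 0)) (𝟙-zero n)) (ℚ.*-identityˡ (F (x ℤ.+ pos 0))))
           (trans (∑-cong-< m λ i i<m → trans (cong (_* F (x ℤ.+ pos (suc i))) (𝟙-small (s≤s i<m))) (ℚ.*-zeroˡ (F (x ℤ.+ pos (suc i))))) (∑-0 m)) ⟩
    F (x ℤ.+ pos 0) + 0ℚ                      ≡⟨ ℚ.+-identityʳ (F (x ℤ.+ pos 0)) ⟩
    F (x ℤ.+ pos 0)                           ≡⟨ cong F (ℤ.+-identityʳ x) ⟩
    F x                                       ∎
    where
    open ≡-Reasoning
    n = suc m
    G : ℤ → ℚ
    G y = 𝟙 n (y ℤ.- x) * F y
    pG : Periodic n G
    pG = periodic-* (periodic-∘ (𝟙-periodic n) (ℤ._- x) (λ y k → k ,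
      ℤS.solve 3 (λ y x k → (y ℤS.:+ k) ℤS.:- x ℤS.:= (y ℤS.:- x) ℤS.:+ k) refl y x (k ℤ.* pos n))) pF
    cancel : ∀ x i → (x ℤ.+ i) ℤ.- x ≡ i
    cancel = ℤS.solve 2 (λ x i → (x ℤS.:+ i) ℤS.:- x ℤS.:= i) refl

  sift′ : ∀ {n F} → .{{NonZero n}} → Periodic n F → ∀ x → ∑ n (λ y → 𝟙 n (x ℤ.- pos y) * F (pos y)) ≡ F x
  sift′ {n} {F} pF x = trans (∑-cong n (λ y → cong (_* F (pos y)) (𝟙-minus n x (pos y)))) (sift pF x)

  ∑-𝟙 : ∀ {n} → .{{NonZero n}} → ∀ x → ∑ n (λ y → 𝟙 n (x ℤ.- pos y)) ≡ 1ℚ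
  ∑-𝟙 {n} x = trans (∑-cong n (λ y → sym (ℚ.*-identityʳ _))) (sift′ {F = λ _ → 1ℚ} (λ _ _ → refl) x)

  -- Units and affine changes of variable

  Unit : ℕ → ℤ → Set
  Unit n u = ∃₂ λ v k → u ℤ.* v ≡ ℤ.1ℤ ℤ.+ k ℤ.* pos n

  -- No permutation of residues is constructed: `F (u i)` is expanded by `sift`, the sums are
  -- swapped, and for each y the number of i with u i ≡ y is 1, since this says i ≡ v y for the
  -- inverse v of u.
  ∑-unit : ∀ {n F} → .{{NonZero n}} → ∀ u → Unit n u → Periodic n F →
    ∑ n (λ i → F (u ℤ.* pos i)) ≡ ∑ n (λ i → F (pos i))
  ∑-unit {n} {F} u (v , k , uv) pF = begin
    ∑ n (λ i → F (u ℤ.* pos i))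
      ≡⟨ ∑-cong n (λ i → sift pF (u ℤ.* pos i)) ⟨
    ∑ n (λ i → ∑ n (λ y → 𝟙 n (pos y ℤ.- u ℤ.* pos i) * F (pos y)))
      ≡⟨ ∑-swap n n _ ⟩
    ∑ n (λ y → ∑ n (λ i → 𝟙 n (pos y ℤ.- u ℤ.* pos i) * F (pos y)))
      ≡⟨ ∑-cong n (λ y → ∑-*ʳ n (F (pos y)) _) ⟩
    ∑ n (λ y → ∑ n (λ i → 𝟙 n (pos y ℤ.- u ℤ.* pos i)) * F (pos y))
      ≡⟨ ∑-cong n (λ y → trans (cong (_* F (pos y)) (count (pos y))) (ℚ.*-identityˡ (F (pos y)))) ⟩
    ∑ n (λ y → F (pos y)) ∎
    where
    open ≡-Reasoning
    to : ∀ y i → pos n ∣ℤ y ℤ.- u ℤ.* i → pos n ∣ℤ v ℤ.* y ℤ.- i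
    -- The quantity 1 + kn - uv vanishes by `uv`. It is carried along as an explicit summand so that
    -- the rest is a polynomial identity for the solver.
    to y i d = subst (pos n ∣ℤ_)
      (trans (ℤS.solve 6 (λ u v y i k n →
          v ℤS.:* (y ℤS.:- u ℤS.:* i) ℤS.:+ (k ℤS.:* i) ℤS.:* n ℤS.:=
          (v ℤS.:* y ℤS.:- i) ℤS.:+ i ℤS.:* (ℤS.con ℤ.1ℤ ℤS.:+ k ℤS.:* n ℤS.:- u ℤS.:* v)) refl u v y i k (pos n))
        (trans (cong (λ t → (v ℤ.* y ℤ.- i) ℤ.+ i ℤ.* (ℤ.1ℤ ℤ.+ k ℤ.* pos n ℤ.- t)) uv)
          (ℤS.solve 3 (λ w i t → w ℤS.:+ i ℤS.:* (t ℤS.:- t) ℤS.:= w) refl (v ℤ.* y ℤ.- i) i (ℤ.1ℤ ℤ.+ k ℤ.* pos n))))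
      (ℤ∣.∣m∣n⇒∣m+n (ℤ∣.∣n⇒∣m*n v d) (divides (k ℤ.* i) refl))
    from : ∀ y i → pos n ∣ℤ v ℤ.* y ℤ.- i → pos n ∣ℤ y ℤ.- u ℤ.* i
    from y i d = subst (pos n ∣ℤ_)
      (trans (ℤS.solve 6 (λ u v y i k n →
          u ℤS.:* (v ℤS.:* y ℤS.:- i) ℤS.:- (k ℤS.:* y) ℤS.:* n ℤS.:=
          (y ℤS.:- u ℤS.:* i) ℤS.:- y ℤS.:* (ℤS.con ℤ.1ℤ ℤS.:+ k ℤS.:* n ℤS.:- u ℤS.:* v)) refl u v y i k (pos n))
        (trans (cong (λ t → (y ℤ.- u ℤ.* i) ℤ.- y ℤ.* (ℤ.1ℤ ℤ.+ k ℤ.* pos n ℤ.- t)) uv)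
          (ℤS.solve 3 (λ w i t → w ℤS.:- i ℤS.:* (t ℤS.:- t) ℤS.:= w) refl (y ℤ.- u ℤ.* i) y (ℤ.1ℤ ℤ.+ k ℤ.* pos n))))
      (ℤ∣.∣m∣n⇒∣m-n (ℤ∣.∣n⇒∣m*n u d) (divides (k ℤ.* y) refl))
    count : ∀ y → ∑ n (λ i → 𝟙 n (y ℤ.- u ℤ.* pos i)) ≡ 1ℚ
    count y = trans (∑-cong n (λ i → 𝟙-cong (to y (pos i)) (from y (pos i)))) (∑-𝟙 (v ℤ.* y))

  ∑-affine : ∀ {n F} → .{{NonZero n}} → ∀ u → Unit n u → Periodic n F → ∀ c →
    ∑ n (λ i → F (c ℤ.+ u ℤ.* pos i)) ≡ ∑ n (λ i → F (pos i))
  ∑-affine {F = F} u unit pF c = trans (∑-unit {F = λ x → F (c ℤ.+ x)} u unit (periodic-shift c pF)) (∑-shift pF c)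

  ∑-reflect : ∀ {n F} → .{{NonZero n}} → Periodic n F → ∀ c →
    ∑ n (λ i → F (c ℤ.- pos i)) ≡ ∑ n (λ i → F (pos i))
  ∑-reflect {n} {F} pF c = trans
    (∑-cong n (λ i → cong (λ z → F (c ℤ.+ z)) (sym (ℤ.-1*i≡-i (pos i)))))
    (∑-affine {F = F} ℤ.-1ℤ (ℤ.-1ℤ , pos 0 , refl) pF c)

  -- Bézout coefficients and the Chinese remainder theorem

  bézout : ∀ {m n} → Coprime m n → ∃₂ λ m′ n′ → m′ ℤ.* pos m ℤ.+ n′ ℤ.* pos n ≡ ℤ.1ℤ
  bézout {m} {n} c with Coprime.coprime-Bézout c
  ... | Bézout.+- x y eq = pos x , ℤ.- pos y , (begin
    pos x ℤ.* pos m ℤ.+ (ℤ.- pos y) ℤ.* pos n  ≡⟨ cong (ℤ._+ (ℤ.- pos y) ℤ.* pos n)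
       (trans (sym (ℤ.pos-* x m)) (trans (cong pos (sym eq)) (cong (λ z → ℤ.1ℤ ℤ.+ z) (ℤ.pos-* y n)))) ⟩
    (ℤ.1ℤ ℤ.+ pos y ℤ.* pos n) ℤ.+ (ℤ.- pos y) ℤ.* pos n
      ≡⟨ ℤS.solve 2 (λ y n → (ℤS.con ℤ.1ℤ ℤS.:+ y ℤS.:* n) ℤS.:+ (ℤS.:- y) ℤS.:* n ℤS.:= ℤS.con ℤ.1ℤ) refl (pos y) (pos n) ⟩
    ℤ.1ℤ ∎)
    where open ≡-Reasoning
  ... | Bézout.-+ x y eq = ℤ.- pos x , pos y , (begin
    (ℤ.- pos x) ℤ.* pos m ℤ.+ pos y ℤ.* pos n  ≡⟨ cong (λ z → (ℤ.- pos x) ℤ.* pos m ℤ.+ z)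
       (trans (sym (ℤ.pos-* y n)) (trans (cong pos (sym eq)) (cong (λ z → ℤ.1ℤ ℤ.+ z) (ℤ.pos-* x m)))) ⟩
    (ℤ.- pos x) ℤ.* pos m ℤ.+ (ℤ.1ℤ ℤ.+ pos x ℤ.* pos m)
      ≡⟨ ℤS.solve 2 (λ y n → (ℤS.:- y) ℤS.:* n ℤS.:+ (ℤS.con ℤ.1ℤ ℤS.:+ y ℤS.:* n) ℤS.:= ℤS.con ℤ.1ℤ) refl (pos x) (pos m) ⟩
    ℤ.1ℤ ∎)
    where open ≡-Reasoning

  coprime⇒unit : ∀ {m n} → Coprime m n → Unit n (pos m)
  coprime⇒unit {m} {n} c = let m′ , n′ , eq = bézout c in m′ , ℤ.- n′ ,
    trans (ℤS.solve 4 (λ m m′ n n′ → m ℤS.:* m′ ℤS.:= (m′ ℤS.:* m ℤS.:+ n′ ℤS.:* n) ℤS.:+ (ℤS.:- n′) ℤS.:* n) refl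
             (pos m) m′ (pos n) n′)
          (cong (ℤ._+ (ℤ.- n′) ℤ.* pos n) eq)

  -- Explicit Bézout coefficients make the lift of a pair of residues linear in the pair, so it
  -- commutes with the subtractions inside convolutions.
  module CRT {m n : ℕ} .{{_ : NonZero m}} .{{_ : NonZero n}} (m′ n′ : ℤ)
             (bez : m′ ℤ.* pos m ℤ.+ n′ ℤ.* pos n ≡ ℤ.1ℤ) where

    crt : ℤ → ℤ → ℤ
    crt a b = a ℤ.* (n′ ℤ.* pos n) ℤ.+ b ℤ.* (m′ ℤ.* pos m)

    crt-mod-m : ∀ a b → crt a b ≡ a ℤ.+ ((b ℤ.- a) ℤ.* m′) ℤ.* pos m
    crt-mod-m a b = trans
      (ℤS.solve 6 (λ a b m m′ n n′ → a ℤS.:* (n′ ℤS.:* n) ℤS.:+ b ℤS.:* (m′ ℤS.:* m) ℤS.:=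
         a ℤS.:* (m′ ℤS.:* m ℤS.:+ n′ ℤS.:* n) ℤS.:+ ((b ℤS.:- a) ℤS.:* m′) ℤS.:* m) refl a b (pos m) m′ (pos n) n′)
      (cong (ℤ._+ ((b ℤ.- a) ℤ.* m′) ℤ.* pos m) (trans (cong (a ℤ.*_) bez) (ℤ.*-identityʳ a)))

    crt-mod-n : ∀ a b → crt a b ≡ b ℤ.+ ((a ℤ.- b) ℤ.* n′) ℤ.* pos n
    crt-mod-n a b = trans
      (ℤS.solve 6 (λ a b m m′ n n′ → a ℤS.:* (n′ ℤS.:* n) ℤS.:+ b ℤS.:* (m′ ℤS.:* m) ℤS.:=
         b ℤS.:* (m′ ℤS.:* m ℤS.:+ n′ ℤS.:* n) ℤS.:+ ((a ℤS.:- b) ℤS.:* n′) ℤS.:* n) refl a b (pos m) m′ (pos n) n′)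
      (cong (ℤ._+ ((a ℤ.- b) ℤ.* n′) ℤ.* pos n) (trans (cong (b ℤ.*_) bez) (ℤ.*-identityʳ b)))

    -- Splitting into blocks writes x = a + m b. For fixed a the lift of (a, b) is a + m (m′ b - m′
    -- a), which differs from this by an affine change of b whose coefficient m′ is a unit modulo n.
    ∑-crt : ∀ {F} → Periodic (m ℕ.* n) F →
      ∑ (m ℕ.* n) (λ x → F (pos x)) ≡ ∑ m (λ a → ∑ n (λ b → F (crt (pos a) (pos b))))
    ∑-crt {F} pF = begin
      ∑ (m ℕ.* n) (λ x → F (pos x))                     ≡⟨ cong (λ k → ∑ k (λ x → F (pos x))) (ℕ.*-comm m n) ⟩
      ∑ (n ℕ.* m) (λ x → F (pos x))                     ≡⟨ ∑-blocks m n _ ⟩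
      ∑ n (λ b → ∑ m (λ a → F (pos (b ℕ.* m ℕ.+ a))))   ≡⟨ ∑-swap n m _ ⟩
      ∑ m (λ a → ∑ n (λ b → F (pos (b ℕ.* m ℕ.+ a))))   ≡⟨ ∑-cong m (λ a → ∑-cong n (λ b → cong F (index a b))) ⟩
      ∑ m (λ a → ∑ n (λ b → F (pos a ℤ.+ pos m ℤ.* pos b)))  ≡⟨ ∑-cong m (λ a → sym (fibre (pos a))) ⟩
      ∑ m (λ a → ∑ n (λ b → F (crt (pos a) (pos b))))   ∎
      where
      open ≡-Reasoning
      index : ∀ a b → pos (b ℕ.* m ℕ.+ a) ≡ pos a ℤ.+ pos m ℤ.* pos b
      index a b = trans (cong (ℤ._+ pos a) (ℤ.pos-* b m))
        (ℤS.solve 3 (λ a b m → b ℤS.:* m ℤS.:+ a ℤS.:= a ℤS.:+ m ℤS.:* b) refl (pos a) (pos b) (pos m))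
      unit : Unit n m′
      unit = pos m , ℤ.- n′ ,
        trans (ℤS.solve 4 (λ m m′ n n′ → m′ ℤS.:* m ℤS.:= (m′ ℤS.:* m ℤS.:+ n′ ℤS.:* n) ℤS.:+ (ℤS.:- n′) ℤS.:* n) refl
                 (pos m) m′ (pos n) n′)
              (cong (ℤ._+ (ℤ.- n′) ℤ.* pos n) bez)
      fibre : ∀ a → ∑ n (λ b → F (crt a (pos b))) ≡ ∑ n (λ b → F (a ℤ.+ pos m ℤ.* pos b))
      fibre a = trans
        (∑-cong n (λ b → cong F (trans (crt-mod-m a (pos b))
          (ℤS.solve 4 (λ a b m m′ → a ℤS.:+ ((b ℤS.:- a) ℤS.:* m′) ℤS.:* m ℤS.:=
             a ℤS.:+ m ℤS.:* ((ℤS.:- (m′ ℤS.:* a)) ℤS.:+ m′ ℤS.:* b)) refl a (pos b) (pos m) m′))))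
        (∑-affine {F = λ b → F (a ℤ.+ pos m ℤ.* b)} m′ unit periodic-fibre (ℤ.- (m′ ℤ.* a)))
        where
        periodic-fibre : Periodic n (λ b → F (a ℤ.+ pos m ℤ.* b))
        periodic-fibre b k = trans
          (cong F (trans
            (ℤS.solve 5 (λ a b k m n → a ℤS.:+ m ℤS.:* (b ℤS.:+ k ℤS.:* n) ℤS.:=
               (a ℤS.:+ m ℤS.:* b) ℤS.:+ k ℤS.:* (m ℤS.:* n)) refl a b k (pos m) (pos n))
            (cong (λ z → (a ℤ.+ pos m ℤ.* b) ℤ.+ k ℤ.* z) (sym (ℤ.pos-* m n)))))
          (pF (a ℤ.+ pos m ℤ.* b) k)

  ∑-multiplicative : ∀ {m n F G} → .{{NonZero m}} → .{{NonZero n}} → Coprime m n → Periodic m F → Periodic n G →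
    ∑ (m ℕ.* n) (λ x → F (pos x) * G (pos x)) ≡ ∑ m (λ a → F (pos a)) * ∑ n (λ b → G (pos b))
  ∑-multiplicative {m} {n} {F} {G} c pF pG with bézout c
  ... | m′ , n′ , bez = begin
    ∑ (m ℕ.* n) (λ x → F (pos x) * G (pos x))
      ≡⟨ ∑-crt (periodic-* (periodic-multiple {F = F} (ℕ∣.m∣m*n n) pF) (periodic-multiple {F = G} (ℕ∣.n∣m*n m) pG)) ⟩
    ∑ m (λ a → ∑ n (λ b → F (crt (pos a) (pos b)) * G (crt (pos a) (pos b))))
      ≡⟨ ∑-cong m (λ a → ∑-cong n (λ b → cong₂ _*_
           (trans (cong F (crt-mod-m (pos a) (pos b))) (pF (pos a) ((pos b ℤ.- pos a) ℤ.* m′)))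
           (trans (cong G (crt-mod-n (pos a) (pos b))) (pG (pos b) ((pos a ℤ.- pos b) ℤ.* n′))))) ⟩
    ∑ m (λ a → ∑ n (λ b → F (pos a) * G (pos b)))
      ≡⟨ ∑-*-∑ m n _ _ ⟨
    ∑ m (λ a → F (pos a)) * ∑ n (λ b → G (pos b)) ∎
    where
    open ≡-Reasoning
    open CRT {m} {n} m′ n′ bez

  infix 9 _²

  _² : ℚ → ℚ
  a ² = a * a

  -- Convolution kernels

  -- Convolution with Ψ on ℤ/D has operator norm at most N.
  record Kernel (D : ℕ) (s N : ℚ) (Ψ : ℤ → ℚ) : Set where
    field
      {{nonZero}} : NonZero D
      periodic    : Periodic D Ψ
      total       : ∑ D (λ i → Ψ (pos i)) ≡ s
      0<N         : 0ℚ < N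
      norm        : ∀ v → Periodic D v →
        ∑ D (λ i → (∑ D (λ j → v (pos j) * Ψ (pos i ℤ.- pos j))) ²) ≤ N ² * ∑ D (λ j → v (pos j) ²)

  -- Constants live at modulus 1, so a constant factor at one prime does not enlarge the modulus of
  -- a product of kernels.
  kernel-1 : Kernel 1 1ℚ 1ℚ (λ _ → 1ℚ)
  kernel-1 = record
    { periodic = λ _ _ → refl
    ; total    = refl
    ; 0<N      = 0<1
    ; norm     = λ v _ → ℚ.≤-reflexive
        (solve 1 (λ a → con 0ℚ :+ (con 0ℚ :+ a :* con 1ℚ) :* (con 0ℚ :+ a :* con 1ℚ) :=
                        (con 1ℚ :* con 1ℚ) :* (con 0ℚ :+ a :* a)) refl (v (pos 0)))
    }

  -- Convolution with `𝟙 p` is the identity, by `sift′`.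
  kernel-𝟙 : ∀ p → {{NonZero p}} → Kernel p 1ℚ 1ℚ (𝟙 p)
  kernel-𝟙 p = record
    { periodic = 𝟙-periodic p
    ; total    = trans (sym (∑-reflect (𝟙-periodic p) (pos 0))) (∑-𝟙 (pos 0))
    ; 0<N      = 0<1
    ; norm     = λ v pv → ℚ.≤-reflexive (trans
        (∑-cong p (λ i → cong _² (trans
          (∑-cong p (λ j → ℚ.*-comm (v (pos j)) (𝟙 p (pos i ℤ.- pos j))))
          (sift′ pv (pos i)))))
        (sym (ℚ.*-identityˡ (∑ p (λ j → v (pos j) ²)))))
    }

  -- Expanding the square and summing over i first leaves the pair sum of v(j) v(l) (p 𝟙(j - l) -
  -- 1), which is p ∑ v² - (∑ v)². The negative square is dropped.
  kernel-autocorrelation : ∀ {p σ Ψ} → {{NonZero p}} → Periodic p Ψ →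
    ∑ p (λ i → Ψ (pos i)) ≡ 0ℚ →
    (∀ j l → ∑ p (λ i → Ψ (pos i ℤ.- j) * Ψ (pos i ℤ.- l)) ≡ ι p * 𝟙 p (j ℤ.- l) - 1ℚ) →
    0ℚ < σ → ι p ≤ σ ² → Kernel p 0ℚ σ Ψ
  kernel-autocorrelation {p} {σ} {Ψ} pΨ total auto σ>0 p≤σ² = record
    { periodic = pΨ ; total = total ; 0<N = σ>0 ; norm = norm }
    where
    norm : ∀ v → Periodic p v →
      ∑ p (λ i → (∑ p (λ j → v (pos j) * Ψ (pos i ℤ.- pos j))) ²) ≤ σ ² * ∑ p (λ j → v (pos j) ²)
    norm v pv = begin
      ∑ p (λ i → (∑ p (λ j → v (pos j) * Ψ (pos i ℤ.- pos j))) ²)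
        ≡⟨ ∑-cong p (λ i → ∑-*-∑ p p _ _) ⟩
      ∑ p (λ i → ∑ p (λ j → ∑ p (λ l → (v (pos j) * Ψ (pos i ℤ.- pos j)) * (v (pos l) * Ψ (pos i ℤ.- pos l)))))
        ≡⟨ ∑-swap p p _ ⟩
      ∑ p (λ j → ∑ p (λ i → ∑ p (λ l → (v (pos j) * Ψ (pos i ℤ.- pos j)) * (v (pos l) * Ψ (pos i ℤ.- pos l)))))
        ≡⟨ ∑-cong p (λ j → ∑-swap p p _) ⟩
      ∑ p (λ j → ∑ p (λ l → ∑ p (λ i → (v (pos j) * Ψ (pos i ℤ.- pos j)) * (v (pos l) * Ψ (pos i ℤ.- pos l)))))
        ≡⟨ ∑-cong p (λ j → ∑-cong p (λ l → pair j l)) ⟩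
      ∑ p (λ j → ∑ p (λ l → (ι p * v (pos j)) * (𝟙 p (pos j ℤ.- pos l) * v (pos l)) + - v (pos j) * v (pos l)))
        ≡⟨ ∑-cong p (λ j → trans (∑-+ p _ _) (cong₂ _+_ (trans (∑-*ˡ p (ι p * v (pos j)) _) (cong (ι p * v (pos j) *_) (sift′ pv (pos j))))
                                                        (∑-*ˡ p (- v (pos j)) _))) ⟩
      ∑ p (λ j → (ι p * v (pos j)) * v (pos j) + - v (pos j) * V)
        ≡⟨ ∑-cong p (λ j → solve 3 (λ n v w → n :* v :* v :+ (:- v) :* w := n :* (v :* v) :+ (:- w) :* v) refl (ι p) (v (pos j)) V) ⟩
      ∑ p (λ j → ι p * v (pos j) ² + - V * v (pos j))
        ≡⟨ trans (∑-+ p _ _) (cong₂ _+_ (∑-*ˡ p (ι p) _) (∑-*ˡ p (- V) _)) ⟩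
      ι p * V₂ + - V * V
        ≤⟨ ≤-by (V ²) (0≤sq V) (solve 3 (λ n a w → n :* a := n :* a :+ (:- w) :* w :+ w :* w) refl (ι p) V₂ V) ⟩
      ι p * V₂
        ≤⟨ *-monoʳ (∑-nonneg p (λ j → 0≤sq (v (pos j)))) p≤σ² ⟩
      σ ² * V₂ ∎
      where
      open ℚ.≤-Reasoning
      V V₂ : ℚ
      V = ∑ p (λ j → v (pos j))
      V₂ = ∑ p (λ j → v (pos j) ²)
      pair : ∀ j l → ∑ p (λ i → (v (pos j) * Ψ (pos i ℤ.- pos j)) * (v (pos l) * Ψ (pos i ℤ.- pos l))) ≡
        (ι p * v (pos j)) * (𝟙 p (pos j ℤ.- pos l) * v (pos l)) + - v (pos j) * v (pos l)
      pair j l = trans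
        (∑-cong p (λ i → solve 4 (λ a x b y → (a :* x) :* (b :* y) := (a :* b) :* (x :* y)) refl
                           (v (pos j)) (Ψ (pos i ℤ.- pos j)) (v (pos l)) (Ψ (pos i ℤ.- pos l))))
        (trans (∑-*ˡ p (v (pos j) * v (pos l)) _) (trans (cong (v (pos j) * v (pos l) *_) (auto (pos j) (pos l)))
          (solve 4 (λ a b n d → (a :* b) :* (n :* d :- con 1ℚ) := (n :* a) :* (d :* b) :+ (:- a) :* b) refl
             (v (pos j)) (v (pos l)) (ι p) (𝟙 p (pos j ℤ.- pos l)))))

  -- In the coordinates of the Chinese remainder theorem the operator is a tensor product. For fixed
  -- second coordinate b, the norm of Ψ is applied to `V b`, which is v already convolved with Θ in
  -- the second coordinate; the norm of Θ is then applied for each fixed first coordinate.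
  kernel-* : ∀ {D E s t N M Ψ Θ} → Coprime D E → Kernel D s N Ψ → Kernel E t M Θ →
    Kernel (D ℕ.* E) (s * t) (N * M) (λ x → Ψ x * Θ x)
  kernel-* {D} {E} {s} {t} {N} {M} {Ψ} {Θ} c K L = record
    { nonZero  = ℕ.m*n≢0 D E
    ; periodic = pΨΘ
    ; total    = trans (∑-multiplicative {F = Ψ} {G = Θ} c K.periodic L.periodic) (cong₂ _*_ K.total L.total)
    ; 0<N      = *-pos K.0<N L.0<N
    ; norm     = norm
    }
    where
    module K = Kernel K
    module L = Kernel L
    bez = proj₂ (proj₂ (bézout c))
    D′ E′ : ℤ
    D′ = proj₁ (bézout c)
    E′ = proj₁ (proj₂ (bézout c))
    open CRT {D} {E} D′ E′ bez
    DE : ℕ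
    DE = D ℕ.* E
    pΨΘ : Periodic DE (λ x → Ψ x * Θ x)
    pΨΘ = periodic-* (periodic-multiple {F = Ψ} (ℕ∣.m∣m*n E) K.periodic) (periodic-multiple {F = Θ} (ℕ∣.n∣m*n D) L.periodic)

    crt-period-D : ∀ a b k → crt (a ℤ.+ k ℤ.* pos D) b ≡ crt a b ℤ.+ (k ℤ.* E′) ℤ.* pos DE
    crt-period-D a b k = trans
      (ℤS.solve 7 (λ a b k d d′ e e′ →
         (a ℤS.:+ k ℤS.:* d) ℤS.:* (e′ ℤS.:* e) ℤS.:+ b ℤS.:* (d′ ℤS.:* d) ℤS.:=
         (a ℤS.:* (e′ ℤS.:* e) ℤS.:+ b ℤS.:* (d′ ℤS.:* d)) ℤS.:+ (k ℤS.:* e′) ℤS.:* (d ℤS.:* e)) refl a b k (pos D) D′ (pos E) E′)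
      (cong (λ z → crt a b ℤ.+ (k ℤ.* E′) ℤ.* z) (sym (ℤ.pos-* D E)))

    crt-period-E : ∀ a b k → crt a (b ℤ.+ k ℤ.* pos E) ≡ crt a b ℤ.+ (k ℤ.* D′) ℤ.* pos DE
    crt-period-E a b k = trans
      (ℤS.solve 7 (λ a b k d d′ e e′ →
         a ℤS.:* (e′ ℤS.:* e) ℤS.:+ (b ℤS.:+ k ℤS.:* e) ℤS.:* (d′ ℤS.:* d) ℤS.:=
         (a ℤS.:* (e′ ℤS.:* e) ℤS.:+ b ℤS.:* (d′ ℤS.:* d)) ℤS.:+ (k ℤS.:* d′) ℤS.:* (d ℤS.:* e)) refl a b k (pos D) D′ (pos E) E′)
      (cong (λ z → crt a b ℤ.+ (k ℤ.* D′) ℤ.* z) (sym (ℤ.pos-* D E)))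

    crt-minus : ∀ a b a′ b′ → crt a b ℤ.- crt a′ b′ ≡ crt (a ℤ.- a′) (b ℤ.- b′)
    crt-minus a b a′ b′ = ℤS.solve 6 (λ a b a′ b′ u w →
      (a ℤS.:* u ℤS.:+ b ℤS.:* w) ℤS.:- (a′ ℤS.:* u ℤS.:+ b′ ℤS.:* w) ℤS.:=
      (a ℤS.:- a′) ℤS.:* u ℤS.:+ (b ℤS.:- b′) ℤS.:* w) refl a b a′ b′ (E′ ℤ.* pos E) (D′ ℤ.* pos D)

    Ψ-crt : ∀ a b a′ b′ → Ψ (crt a b ℤ.- crt a′ b′) ≡ Ψ (a ℤ.- a′)
    Ψ-crt a b a′ b′ = trans (cong Ψ (trans (crt-minus a b a′ b′) (crt-mod-m (a ℤ.- a′) (b ℤ.- b′))))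
      (K.periodic (a ℤ.- a′) (((b ℤ.- b′) ℤ.- (a ℤ.- a′)) ℤ.* D′))

    Θ-crt : ∀ a b a′ b′ → Θ (crt a b ℤ.- crt a′ b′) ≡ Θ (b ℤ.- b′)
    Θ-crt a b a′ b′ = trans (cong Θ (trans (crt-minus a b a′ b′) (crt-mod-n (a ℤ.- a′) (b ℤ.- b′))))
      (L.periodic (b ℤ.- b′) (((a ℤ.- a′) ℤ.- (b ℤ.- b′)) ℤ.* E′))

    norm : ∀ v → Periodic DE v →
      ∑ DE (λ i → (∑ DE (λ j → v (pos j) * (Ψ (pos i ℤ.- pos j) * Θ (pos i ℤ.- pos j)))) ²)
        ≤ (N * M) ² * ∑ DE (λ j → v (pos j) ²)
    norm v pv = begin
      ∑ DE (λ i → T (pos i) ²)                             ≡⟨ ∑-crt (periodic-* pT pT) ⟩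
      ∑ D (λ a → ∑ E (λ b → T (crt (pos a) (pos b)) ²))    ≡⟨ ∑-cong D (λ a → ∑-cong E (λ b → cong _² (T-crt (pos a) b))) ⟩
      ∑ D (λ a → ∑ E (λ b → (∑ D (λ a′ → V b (pos a′) * Ψ (pos a ℤ.- pos a′))) ²))
                                                           ≡⟨ ∑-swap D E _ ⟩
      ∑ E (λ b → ∑ D (λ a → (∑ D (λ a′ → V b (pos a′) * Ψ (pos a ℤ.- pos a′))) ²))
                                                           ≤⟨ ∑-mono E (λ b → K.norm (V b) (pV b)) ⟩
      ∑ E (λ b → N ² * ∑ D (λ a′ → V b (pos a′) ²))        ≡⟨ ∑-*ˡ E (N ²) _ ⟩
      N ² * ∑ E (λ b → ∑ D (λ a′ → V b (pos a′) ²))        ≡⟨ cong (N ² *_) (∑-swap E D _) ⟩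
      N ² * ∑ D (λ a′ → ∑ E (λ b → V b (pos a′) ²))        ≤⟨ *-monoˡ (0≤sq N) (∑-mono D (λ a′ → L.norm (W (pos a′)) (pW (pos a′)))) ⟩
      N ² * ∑ D (λ a′ → M ² * ∑ E (λ b′ → W (pos a′) (pos b′) ²))
                                                           ≡⟨ cong (N ² *_) (∑-*ˡ D (M ²) _) ⟩
      N ² * (M ² * ∑ D (λ a′ → ∑ E (λ b′ → W (pos a′) (pos b′) ²)))
                                                           ≡⟨ cong (λ z → N ² * (M ² * z)) (∑-crt {λ x → v x ²} (periodic-* pv pv)) ⟨
      N ² * (M ² * ∑ DE (λ j → v (pos j) ²))               ≡⟨ solve 3 (λ n m x → (n :* n) :* ((m :* m) :* x) := ((n :* m) :* (n :* m)) :* x) refl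
                                                                N M (∑ DE (λ j → v (pos j) ²)) ⟩
      (N * M) ² * ∑ DE (λ j → v (pos j) ²)                 ∎
      where
      open ℚ.≤-Reasoning
      T : ℤ → ℚ
      T x = ∑ DE (λ j → v (pos j) * (Ψ (x ℤ.- pos j) * Θ (x ℤ.- pos j)))
      W : ℤ → ℤ → ℚ
      W a b = v (crt a b)
      V : ℕ → ℤ → ℚ
      V b a = ∑ E (λ b′ → W a (pos b′) * Θ (pos b ℤ.- pos b′))
      pW : ∀ a → Periodic E (W a)
      pW a b k = trans (cong v (crt-period-E a b k)) (pv (crt a b) (k ℤ.* D′))
      pV : ∀ b → Periodic D (V b)
      pV b a k = ∑-cong E (λ b′ → cong (_* Θ (pos b ℤ.- pos b′))
        (trans (cong v (crt-period-D a (pos b′) k)) (pv (crt a (pos b′)) (k ℤ.* E′))))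
      pT : Periodic DE T
      pT x k = ∑-cong DE (λ j → cong (v (pos j) *_) (trans
        (cong (λ z → Ψ z * Θ z) (ℤS.solve 3 (λ x y j → (x ℤS.:+ y) ℤS.:- j ℤS.:= (x ℤS.:- j) ℤS.:+ y) refl x (k ℤ.* pos DE) (pos j)))
        (pΨΘ (x ℤ.- pos j) k)))
      T-crt : ∀ a b → T (crt a (pos b)) ≡ ∑ D (λ a′ → V b (pos a′) * Ψ (a ℤ.- pos a′))
      T-crt a b = trans
        (∑-crt {λ y → v y * (Ψ (crt a (pos b) ℤ.- y) * Θ (crt a (pos b) ℤ.- y))}
               (periodic-* pv (periodic-reflect {F = λ x → Ψ x * Θ x} (crt a (pos b)) pΨΘ)))
        (∑-cong D λ a′ → trans
          (∑-cong E λ b′ → trans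
            (cong₂ (λ x y → W (pos a′) (pos b′) * (x * y)) (Ψ-crt a (pos b) (pos a′) (pos b′)) (Θ-crt a (pos b) (pos a′) (pos b′)))
            (solve 3 (λ w x y → w :* (x :* y) := (w :* y) :* x) refl (W (pos a′) (pos b′)) (Ψ (a ℤ.- pos a′)) (Θ (pos b ℤ.- pos b′))))
          (∑-*ʳ E (Ψ (a ℤ.- pos a′)) _))

  -- Quadratic forms of kernels at intervals

  pairs : ℕ → (ℤ → ℚ) → ℚ
  pairs h F = ∑ h (λ i → ∑ h (λ j → F (pos i ℤ.- pos j)))

  -- Meant with m the mean value of F over a period and c an operator norm: a main term quadratic in
  -- the window length and an error linear in it.
  Bound : (m c : ℚ) → (ℤ → ℚ) → Set
  Bound m c F = ∀ h → pairs h F ≤ m * ι h ² + c * ι h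

  ∑-full-periods : ∀ {D G} → .{{NonZero D}} → Periodic D G → ∀ t k →
    ∑ (t ℕ.+ k ℕ.* D) (λ i → G (pos i)) ≡ ∑ t (λ i → G (pos i)) + ι k * ∑ D (λ i → G (pos i))
  ∑-full-periods {D} {G} pG t zero = begin
    ∑ (t ℕ.+ 0) g         ≡⟨ cong (λ n → ∑ n g) (ℕ.+-identityʳ t) ⟩
    ∑ t g                 ≡⟨ solve 2 (λ x y → x := x :+ con 0ℚ :* y) refl (∑ t g) (∑ D g) ⟩
    ∑ t g + 0ℚ * ∑ D g    ≡⟨ cong (λ z → ∑ t g + z * ∑ D g) ι-0 ⟨
    ∑ t g + ι 0 * ∑ D g   ∎
    where
    open ≡-Reasoning
    g : ℕ → ℚ
    g i = G (pos i)
  ∑-full-periods {D} {G} pG t (suc k) = begin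
    ∑ (t ℕ.+ (D ℕ.+ k ℕ.* D)) g           ≡⟨ cong (λ n → ∑ n g) (trans (cong (t ℕ.+_) (ℕ.+-comm D (k ℕ.* D))) (sym (ℕ.+-assoc t _ D))) ⟩
    ∑ ((t ℕ.+ k ℕ.* D) ℕ.+ D) g           ≡⟨ ∑-split (t ℕ.+ k ℕ.* D) D g ⟩
    ∑ (t ℕ.+ k ℕ.* D) g + ∑ D (λ i → G (pos (t ℕ.+ k ℕ.* D) ℤ.+ pos i))
                                          ≡⟨ cong₂ _+_ (∑-full-periods {G = G} pG t k) (∑-shift pG (pos (t ℕ.+ k ℕ.* D))) ⟩
    (∑ t g + ι k * ∑ D g) + ∑ D g         ≡⟨ solve 3 (λ x y s → (x :+ y :* s) :+ s := x :+ (con 1ℚ :+ y) :* s) refl (∑ t g) (ι k) (∑ D g) ⟩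
    ∑ t g + (1ℚ + ι k) * ∑ D g            ≡⟨ cong (λ z → ∑ t g + z * ∑ D g) (ι-suc k) ⟨
    ∑ t g + ι (suc k) * ∑ D g             ∎
    where
    open ≡-Reasoning
    g : ℕ → ℚ
    g i = G (pos i)

  -- The quadratic form of Ψ at the indicator v of [0, t), bounded by 2N v·(Ψ ∗ v) ≤ (Ψ ∗ v)² + N² v².
  kernel-bound-short : ∀ {D s N Ψ} → Kernel D s N Ψ → ∀ t → t ℕ.≤ D → pairs t Ψ ≤ N * ι t
  kernel-bound-short {D} {s} {N} {Ψ} K t t≤D = *-cancelˡ (ℚ.+-mono-< 0<N 0<N) (begin
    (N + N) * pairs t Ψ                        ≡⟨ cong ((N + N) *_) (window-sum pY) ⟨
    (N + N) * ∑ D (λ i → v (pos i) * Y (pos i))  ≡⟨ ∑-*ˡ D (N + N) _ ⟨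
    ∑ D (λ i → (N + N) * (v (pos i) * Y (pos i)))  ≤⟨ ∑-mono D (λ i → am-gm (v (pos i)) (Y (pos i))) ⟩
    ∑ D (λ i → Y (pos i) ² + N ² * v (pos i) ²)  ≡⟨ trans (∑-+ D _ _) (cong (∑ D (λ i → Y (pos i) ²) +_) (∑-*ˡ D (N ²) _)) ⟩
    ∑ D (λ i → Y (pos i) ²) + N ² * V₂         ≡⟨ cong (_+ N ² * V₂) (∑-cong D (λ i → cong _²
                                                    (window-sum (periodic-reflect {F = Ψ} (pos i) periodic)))) ⟨
    ∑ D (λ i → (∑ D (λ j → v (pos j) * Ψ (pos i ℤ.- pos j))) ²) + N ² * V₂
                                               ≤⟨ ℚ.+-monoˡ-≤ (N ² * V₂) (norm v pv) ⟩
    N ² * V₂ + N ² * V₂                        ≤⟨ ℚ.+-mono-≤ (*-monoˡ (0≤sq N) V₂≤t) (*-monoˡ (0≤sq N) V₂≤t) ⟩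
    N ² * ι t + N ² * ι t                      ≡⟨ solve 2 (λ n t → (n :* n) :* t :+ (n :* n) :* t := (n :+ n) :* (n :* t)) refl N (ι t) ⟩
    (N + N) * (N * ι t)                        ∎)
    where
    open Kernel K
    open ℚ.≤-Reasoning
    v Y : ℤ → ℚ
    v x = ∑ t (λ j → 𝟙 D (x ℤ.- pos j))
    Y x = ∑ t (λ j → Ψ (x ℤ.- pos j))
    V₂ : ℚ
    V₂ = ∑ D (λ i → v (pos i) ²)
    periodic-window : ∀ {G} → Periodic D G → Periodic D (λ x → ∑ t (λ j → G (x ℤ.- pos j)))
    periodic-window {G} pG x k = ∑-cong t (λ j → trans
      (cong G (ℤS.solve 3 (λ x y j → (x ℤS.:+ y) ℤS.:- j ℤS.:= (x ℤS.:- j) ℤS.:+ y) refl x (k ℤ.* pos D) (pos j)))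
      (pG (x ℤ.- pos j) k))
    pv : Periodic D v
    pv = periodic-window (𝟙-periodic D)
    pY : Periodic D Y
    pY = periodic-window periodic
    window-sum : ∀ {G} → Periodic D G → ∑ D (λ i → v (pos i) * G (pos i)) ≡ ∑ t (λ j → G (pos j))
    window-sum {G} pG = trans (∑-cong D (λ i → sym (∑-*ʳ t (G (pos i)) _)))
      (trans (∑-swap D t _) (∑-cong t (λ j → sift {F = G} pG (pos j))))
    -- Here t ≤ D enters: an interval of at most D integers meets each residue class at most once.
    v≤1 : ∀ x → v x ≤ 1ℚ
    v≤1 x = ℚ.≤-trans (∑-≤-range _ t≤D (λ j → 0≤𝟙 D (x ℤ.- pos j))) (ℚ.≤-reflexive (∑-𝟙 x))
    V₂≤t : V₂ ≤ ι t
    V₂≤t = ℚ.≤-trans (ℚ.≤-reflexive (window-sum pv))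
      (ℚ.≤-trans (∑-mono t (λ j → v≤1 (pos j))) (ℚ.≤-reflexive (trans (∑-const t 1ℚ) (ℚ.*-identityʳ (ι t)))))
    am-gm : ∀ a b → (N + N) * (a * b) ≤ b ² + N ² * a ²
    am-gm a b = ≤-by ((b - N * a) ²) (0≤sq (b - N * a))
      (solve 3 (λ n a b → b :* b :+ (n :* n) :* (a :* a) := (n :+ n) :* (a :* b) :+ (b :- n :* a) :* (b :- n :* a)) refl N a b)

  -- With h = t + kD, full periods contribute m (h² − t²) exactly; only the pairs in [0, t)² need the norm.
  kernel-bound : ∀ {D s N m Ψ} → Kernel D s N Ψ → 0ℚ ≤ m → m * ι D ≡ s → Bound m N Ψ
  kernel-bound {D} {s} {N} {m} {Ψ} K m≥0 mD≡s h = begin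
    ∑ h (λ i → ∑ h (λ j → Ψ (pos i ℤ.- pos j)))                 ≡⟨ ∑-cong h (λ i → row i) ⟩
    ∑ h (λ i → ∑ t (λ j → Ψ (pos i ℤ.- pos j)) + ι k * s)        ≡⟨ trans (∑-+ h _ _) (cong (∑ h (λ i → ∑ t (λ j → Ψ (pos i ℤ.- pos j))) +_) (∑-const h (ι k * s))) ⟩
    ∑ h (λ i → ∑ t (λ j → Ψ (pos i ℤ.- pos j))) + ι h * (ι k * s) ≡⟨ cong (_+ ι h * (ι k * s)) (trans (∑-swap h t _) (∑-cong t column)) ⟩
    ∑ t (λ j → ∑ t (λ i → Ψ (pos i ℤ.- pos j)) + ι k * s) + ι h * (ι k * s)
                                                                 ≡⟨ cong (_+ ι h * (ι k * s)) (trans (∑-+ t _ _) (cong₂ _+_ (∑-swap t t _) (∑-const t (ι k * s)))) ⟩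
    (pairs t Ψ + ι t * (ι k * s)) + ι h * (ι k * s)              ≤⟨ ℚ.+-monoˡ-≤ (ι h * (ι k * s)) (ℚ.+-monoˡ-≤ (ι t * (ι k * s))
                                                                      (ℚ.≤-trans (kernel-bound-short K t (ℕ.<⇒≤ (ℕ/.m%n<n h D))) (*-monoˡ (ℚ.<⇒≤ 0<N) (ι-mono t≤h)))) ⟩
    (N * ι h + ι t * (ι k * s)) + ι h * (ι k * s)                ≤⟨ ≤-by (m * ι t ²) (0≤* m≥0 (0≤sq (ι t))) algebra ⟩
    m * ι h ² + N * ι h                                          ∎
    where
    open Kernel K
    open ℚ.≤-Reasoning
    t k : ℕ
    t = h ℕ/.% D
    k = h ℕ/./ D
    h≡ : h ≡ t ℕ.+ k ℕ.* D
    h≡ = ℕ/.m≡m%n+[m/n]*n h D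
    t≤h : t ℕ.≤ h
    t≤h = ℕ/.m%n≤m h D
    full : ∀ {G} → Periodic D G → ∑ D (λ i → G (pos i)) ≡ s →
      ∑ h (λ i → G (pos i)) ≡ ∑ t (λ i → G (pos i)) + ι k * s
    full {G} pG eq = trans (cong (λ n → ∑ n (λ i → G (pos i))) h≡)
      (trans (∑-full-periods {G = G} pG t k) (cong (λ z → ∑ t (λ i → G (pos i)) + ι k * z) eq))
    row : ∀ i → ∑ h (λ j → Ψ (pos i ℤ.- pos j)) ≡ ∑ t (λ j → Ψ (pos i ℤ.- pos j)) + ι k * s
    row i = full (periodic-reflect {F = Ψ} (pos i) periodic) (trans (∑-reflect periodic (pos i)) total)
    column : ∀ j → ∑ h (λ i → Ψ (pos i ℤ.- pos j)) ≡ ∑ t (λ i → Ψ (pos i ℤ.- pos j)) + ι k * s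
    column j = full {λ x → Ψ (x ℤ.- pos j)}
      (λ x l → trans (cong Ψ (ℤS.solve 3 (λ x y j → (x ℤS.:+ y) ℤS.:- j ℤS.:= (x ℤS.:- j) ℤS.:+ y) refl x (l ℤ.* pos D) (pos j)))
                     (periodic (x ℤ.- pos j) l))
      (trans (∑-cong D (λ i → cong Ψ (ℤ.+-comm (pos i) (ℤ.- pos j)))) (trans (∑-shift periodic (ℤ.- pos j)) total))
    ιh : ι h ≡ ι t + ι k * ι D
    ιh = trans (cong ι h≡) (trans (ι-+ t (k ℕ.* D)) (cong (ι t +_) (ι-* k D)))
    algebra : m * ι h ² + N * ι h ≡ ((N * ι h + ι t * (ι k * s)) + ι h * (ι k * s)) + m * ι t ²
    algebra = subst₂ (λ H S → m * H ² + N * H ≡ ((N * H + ι t * (ι k * S)) + H * (ι k * S)) + m * ι t ²) (sym ιh) mD≡s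
      (solve 5 (λ m n t k d →
         m :* ((t :+ k :* d) :* (t :+ k :* d)) :+ n :* (t :+ k :* d) :=
         ((n :* (t :+ k :* d) :+ t :* (k :* (m :* d))) :+ (t :+ k :* d) :* (k :* (m :* d))) :+ m :* (t :* t))
        refl m N (ι t) (ι k) (ι D))

  -- Combinations of kernels

  infixl 6 _⊕_

  -- A nonnegative combination of kernels of moduli dividing n, with total mean m and total norm N.
  data Combination (n : ℕ) : ℚ → ℚ → (ℤ → ℚ) → Set where
    kernel : ∀ {D s N m Ψ} → D ℕ∣.∣ n → Kernel D s N Ψ → 0ℚ ≤ m → m * ι D ≡ s → Combination n m N Ψ
    _⊕_    : ∀ {m m′ N N′ F G} → Combination n m N F → Combination n m′ N′ G →
             Combination n (m + m′) (N + N′) (λ x → F x + G x)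
    scale  : ∀ {m N F} c → 0ℚ ≤ c → Combination n m N F → Combination n (c * m) (c * N) (λ x → c * F x)
    -- The indices are rational expressions that agree only propositionally once products are
    -- expanded; this constructor transports along such equalities.
    respects   : ∀ {m m′ N N′ F G} → m ≡ m′ → N ≡ N′ → (∀ x → F x ≡ G x) →
             Combination n m N F → Combination n m′ N′ G

  -- The product is multiplied out by distributivity, first along the right factor while the left
  -- one is a single kernel, otherwise along the left. At the leaves, divisors of coprime moduli are
  -- coprime and `kernel-*` applies.
  combination-* : ∀ {a b m m′ N N′ F G} → Coprime a b → Combination a m N F → Combination b m′ N′ G →
    Combination (a ℕ.* b) (m * m′) (N * N′) (λ x → F x * G x)
  combination-* {a} {b} c (kernel {D} {s} {N} {m} d K m≥0 eq) (kernel {D′} {s′} {N′} {m′} d′ K′ m′≥0 eq′) =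
    kernel (ℕ∣.*-pres-∣ d d′) (kernel-* (λ (x , y) → c (ℕ∣.∣-trans x d , ℕ∣.∣-trans y d′)) K K′) (0≤* m≥0 m′≥0) (begin
      (m * m′) * ι (D ℕ.* D′)      ≡⟨ cong ((m * m′) *_) (ι-* D D′) ⟩
      (m * m′) * (ι D * ι D′)      ≡⟨ solve 4 (λ m m′ d d′ → (m :* m′) :* (d :* d′) := (m :* d) :* (m′ :* d′)) refl m m′ (ι D) (ι D′) ⟩
      (m * ι D) * (m′ * ι D′)      ≡⟨ cong₂ _*_ eq eq′ ⟩
      s * s′                       ∎)
    where open ≡-Reasoning
  combination-* c F@(kernel {N = N} {m} {Ψ} _ _ _ _) (_⊕_ {m₁} {m₂} {N₁} {N₂} {F₁} {F₂} G G′) =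
    respects (sym (ℚ.*-distribˡ-+ m m₁ m₂)) (sym (ℚ.*-distribˡ-+ N N₁ N₂)) (λ x → sym (ℚ.*-distribˡ-+ (Ψ x) (F₁ x) (F₂ x)))
      (combination-* c F G ⊕ combination-* c F G′)
  combination-* c F@(kernel {N = N} {m} {Ψ} _ _ _ _) (scale {m′} {N′} {F′} k k≥0 G) =
    respects (swap k m m′) (swap k N N′) (λ x → swap k (Ψ x) (F′ x)) (scale k k≥0 (combination-* c F G))
    where
    swap : ∀ k a b → k * (a * b) ≡ a * (k * b)
    swap = solve 3 (λ k a b → k :* (a :* b) := a :* (k :* b)) refl
  combination-* c F@(kernel {N = N} {m} {Ψ} _ _ _ _) (respects p q e G) =
    respects (cong (m *_) p) (cong (N *_) q) (λ x → cong (Ψ x *_) (e x)) (combination-* c F G)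
  combination-* {m′ = m} {N′ = N} {G = F} c (_⊕_ {m₁} {m₂} {N₁} {N₂} {F₁} {F₂} G G′) H =
    respects (sym (ℚ.*-distribʳ-+ m m₁ m₂)) (sym (ℚ.*-distribʳ-+ N N₁ N₂)) (λ x → sym (ℚ.*-distribʳ-+ (F x) (F₁ x) (F₂ x)))
      (combination-* c G H ⊕ combination-* c G′ H)
  combination-* {m′ = m} {N′ = N} {G = F} c (scale {m′} {N′} {F′} k k≥0 G) H =
    respects (sym (ℚ.*-assoc k m′ m)) (sym (ℚ.*-assoc k N′ N)) (λ x → sym (ℚ.*-assoc k (F′ x) (F x)))
      (scale k k≥0 (combination-* c G H))
  combination-* {m′ = m} {N′ = N} {G = F} c (respects p q e G) H =
    respects (cong (_* m) p) (cong (_* N) q) (λ x → cong (_* F x) (e x)) (combination-* c G H)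

  combination-bound : ∀ {n m N F} → Combination n m N F → Bound m N F
  combination-bound (kernel d K m≥0 eq) h = kernel-bound K m≥0 eq h
  combination-bound (_⊕_ {m} {m′} {N} {N′} {F} {G} A B) h = begin
    pairs h (λ x → F x + G x)                       ≡⟨ trans (∑-cong h (λ i → ∑-+ h _ _)) (∑-+ h _ _) ⟩
    pairs h F + pairs h G                           ≤⟨ ℚ.+-mono-≤ (combination-bound A h) (combination-bound B h) ⟩
    (m * ι h ² + N * ι h) + (m′ * ι h ² + N′ * ι h) ≡⟨ solve 6 (λ m n m′ n′ h k → (m :* k :+ n :* h) :+ (m′ :* k :+ n′ :* h) :=
                                                          (m :+ m′) :* k :+ (n :+ n′) :* h) refl m N m′ N′ (ι h) (ι h ²) ⟩
    (m + m′) * ι h ² + (N + N′) * ι h               ∎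
    where open ℚ.≤-Reasoning
  combination-bound (scale {m} {N} {F} c c≥0 A) h = begin
    pairs h (λ x → c * F x)               ≡⟨ trans (∑-cong h (λ i → ∑-*ˡ h c _)) (∑-*ˡ h c _) ⟩
    c * pairs h F                         ≤⟨ *-monoˡ c≥0 (combination-bound A h) ⟩
    c * (m * ι h ² + N * ι h)             ≡⟨ solve 5 (λ c m n h k → c :* (m :* k :+ n :* h) := (c :* m) :* k :+ (c :* n) :* h) refl
                                               c m N (ι h) (ι h ²) ⟩
    (c * m) * ι h ² + (c * N) * ι h       ∎
    where open ℚ.≤-Reasoning
  combination-bound (respects p q e A) h =
    subst₂ _≤_ (∑-cong h (λ i → ∑-cong h (λ j → e (pos i ℤ.- pos j)))) (cong₂ (λ m N → m * ι h ² + N * ι h) p q)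
      (combination-bound A h)

  -- Quadratic residues

  periodic-minus : ∀ {n F} c → Periodic n F → Periodic n (λ x → F (x ℤ.- c))
  periodic-minus {n} c pF = periodic-∘ pF (λ x → x ℤ.- c) (λ x k → k ,
    ℤS.solve 3 (λ x y c → (x ℤS.:+ y) ℤS.:- c ℤS.:= (x ℤS.:- c) ℤS.:+ y) refl x (k ℤ.* pos n) c)

  ∑-minus : ∀ {n F} → Periodic n F → ∀ c → ∑ n (λ x → F (pos x ℤ.- c)) ≡ ∑ n (λ x → F (pos x))
  ∑-minus {n} {F} pF c = trans (∑-cong n (λ x → cong F (ℤ.+-comm (pos x) (ℤ.- c)))) (∑-shift pF (ℤ.- c))

  unit-* : ∀ {n} u v → Unit n u → Unit n v → Unit n (u ℤ.* v)
  unit-* {n} u v (u′ , k , eq) (v′ , l , eq′) = u′ ℤ.* v′ , k ℤ.+ l ℤ.+ k ℤ.* l ℤ.* pos n ,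
    trans (ℤS.solve 4 (λ u v u′ v′ → u ℤS.:* v ℤS.:* (u′ ℤS.:* v′) ℤS.:= (u ℤS.:* u′) ℤS.:* (v ℤS.:* v′)) refl u v u′ v′)
      (trans (cong₂ ℤ._*_ eq eq′)
        (ℤS.solve 3 (λ k l n → (ℤS.con ℤ.1ℤ ℤS.:+ k ℤS.:* n) ℤS.:* (ℤS.con ℤ.1ℤ ℤS.:+ l ℤS.:* n) ℤS.:=
           ℤS.con ℤ.1ℤ ℤS.:+ (k ℤS.:+ l ℤS.:+ k ℤS.:* l ℤS.:* n) ℤS.:* n) refl k l (pos n)))

  module Residues (p : ℕ) {{_ : NonZero p}} where

    roots : ℤ → ℚ
    roots x = ∑ p (λ y → 𝟙 p (pos y ℤ.* pos y ℤ.- x))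

    roots-periodic : Periodic p roots
    roots-periodic x k = ∑-cong p (λ y → periodic-reflect (pos y ℤ.* pos y) (𝟙-periodic p) x k)

    ∑-roots : ∑ p (λ x → roots (pos x)) ≡ ι p
    ∑-roots = trans (∑-swap p p _)
      (trans (∑-cong p (λ y → ∑-𝟙 (pos y ℤ.* pos y))) (trans (∑-const p 1ℚ) (ℚ.*-identityʳ (ι p))))

    ∑-pred : ∀ f → ∑ p f ≡ f 0 + ∑ (ℕ.pred p) (f ∘ suc)
    ∑-pred f = trans (cong (λ n → ∑ n f) (sym (ℕ.suc-pred p))) (∑-head (ℕ.pred p) f)

    ι-pred : ι (ℕ.pred p) ≡ ι p - 1ℚ
    ι-pred = trans (solve 1 (λ a → a := (con 1ℚ :+ a) :- con 1ℚ) refl (ι (ℕ.pred p)))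
      (cong (_- 1ℚ) (trans (sym (ι-suc (ℕ.pred p))) (cong ι (ℕ.suc-pred p))))

    -- The number of solutions of y² - z² = a - b, counted through z = y + w.
    ∑-roots-roots : Prime p → 2 ℕ.< p → ∀ a b →
      ∑ p (λ x → roots (pos x ℤ.- a) * roots (pos x ℤ.- b)) ≡ (ι p - 1ℚ) + ι p * 𝟙 p (a ℤ.- b)
    ∑-roots-roots p-prime 2<p a b = begin
      ∑ p (λ x → roots (pos x ℤ.- a) * roots (pos x ℤ.- b))
        ≡⟨ ∑-cong p (λ x → ∑-*-∑ p p _ _) ⟩
      ∑ p (λ x → ∑ p (λ y → ∑ p (λ z → A x y * B x z)))
        ≡⟨ trans (∑-swap p p _) (∑-cong p (λ y → ∑-swap p p _)) ⟩
      ∑ p (λ y → ∑ p (λ z → ∑ p (λ x → A x y * B x z)))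
        ≡⟨ ∑-cong p (λ y → ∑-cong p (λ z → eliminate y z)) ⟩
      ∑ p (λ y → ∑ p (λ z → Q (pos y) (pos z)))
        ≡⟨ ∑-cong p (λ y → ∑-shift (Q-periodic (pos y)) (pos y)) ⟨
      ∑ p (λ y → ∑ p (λ w → Q (pos y) (pos y ℤ.+ pos w)))
        ≡⟨ ∑-swap p p _ ⟩
      ∑ p (λ w → ∑ p (λ y → Q (pos y) (pos y ℤ.+ pos w)))
        ≡⟨ ∑-cong p (λ w → ∑-cong p (λ y → cong (𝟙 p) (linear (pos y) (pos w)))) ⟩
      ∑ p (λ w → L w)
        -- The condition is now linear in y with slope 2w. For w = 0 it reads a ≡ b whatever y is;
        -- for each of the p - 1 other w the slope is a unit and exactly one y satisfies it.
        ≡⟨ ∑-pred L ⟩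
      L 0 + ∑ (ℕ.pred p) (L ∘ suc)
        ≡⟨ cong₂ _+_ (trans (∑-cong p (λ y → trans (cong (𝟙 p) (L0 (pos y))) (𝟙-minus p b a))) (∑-const p _))
                     (trans (∑-cong-< (ℕ.pred p) Lsuc) (trans (∑-const (ℕ.pred p) 1ℚ) (trans (ℚ.*-identityʳ _) ι-pred))) ⟩
      ι p * 𝟙 p (a ℤ.- b) + (ι p - 1ℚ)
        ≡⟨ ℚ.+-comm (ι p * 𝟙 p (a ℤ.- b)) (ι p - 1ℚ) ⟩
      (ι p - 1ℚ) + ι p * 𝟙 p (a ℤ.- b) ∎
      where
      open ≡-Reasoning
      A B : ℕ → ℕ → ℚ
      A x y = 𝟙 p (pos y ℤ.* pos y ℤ.- (pos x ℤ.- a))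
      B x z = 𝟙 p (pos z ℤ.* pos z ℤ.- (pos x ℤ.- b))
      Q : ℤ → ℤ → ℚ
      Q y z = 𝟙 p (z ℤ.* z ℤ.- ((y ℤ.* y ℤ.+ a) ℤ.- b))
      L : ℕ → ℚ
      L w = ∑ p (λ y → 𝟙 p ((pos w ℤ.* pos w ℤ.- (a ℤ.- b)) ℤ.+ (pos 2 ℤ.* pos w) ℤ.* pos y))
      eliminate : ∀ y z → ∑ p (λ x → A x y * B x z) ≡ Q (pos y) (pos z)
      eliminate y z = trans
        (∑-cong p (λ x → cong (λ t → 𝟙 p t * B x z)
          (ℤS.solve 3 (λ y x a → y ℤS.:- (x ℤS.:- a) ℤS.:= (y ℤS.:+ a) ℤS.:- x) refl (pos y ℤ.* pos y) (pos x) a)))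
        (sift′ {F = λ x → 𝟙 p (pos z ℤ.* pos z ℤ.- (x ℤ.- b))}
          (periodic-minus {F = λ x → 𝟙 p (pos z ℤ.* pos z ℤ.- x)} b
            (periodic-reflect (pos z ℤ.* pos z) (𝟙-periodic p)))
          (pos y ℤ.* pos y ℤ.+ a))
      Q-periodic : ∀ y → Periodic p (Q y)
      Q-periodic y = periodic-∘ (𝟙-periodic p) _ (λ z k → (k ℤ.* z ℤ.+ k ℤ.* z ℤ.+ k ℤ.* k ℤ.* pos p) ,
        ℤS.solve 4 (λ z k n c → (z ℤS.:+ k ℤS.:* n) ℤS.:* (z ℤS.:+ k ℤS.:* n) ℤS.:- c ℤS.:=
          (z ℤS.:* z ℤS.:- c) ℤS.:+ (k ℤS.:* z ℤS.:+ k ℤS.:* z ℤS.:+ k ℤS.:* k ℤS.:* n) ℤS.:* n) refl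
          z k (pos p) ((y ℤ.* y ℤ.+ a) ℤ.- b))
      linear : ∀ y w → (y ℤ.+ w) ℤ.* (y ℤ.+ w) ℤ.- ((y ℤ.* y ℤ.+ a) ℤ.- b) ≡
        (w ℤ.* w ℤ.- (a ℤ.- b)) ℤ.+ (pos 2 ℤ.* w) ℤ.* y
      linear y w = ℤS.solve 4 (λ y w a b →
        (y ℤS.:+ w) ℤS.:* (y ℤS.:+ w) ℤS.:- ((y ℤS.:* y ℤS.:+ a) ℤS.:- b) ℤS.:=
        (w ℤS.:* w ℤS.:- (a ℤS.:- b)) ℤS.:+ (ℤS.con (pos 2) ℤS.:* w) ℤS.:* y) refl y w a b
      L0 : ∀ y → (pos 0 ℤ.* pos 0 ℤ.- (a ℤ.- b)) ℤ.+ (pos 2 ℤ.* pos 0) ℤ.* y ≡ b ℤ.- a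
      L0 y = ℤS.solve 3 (λ a b y → (ℤS.con (pos 0) ℤS.:- (a ℤS.:- b)) ℤS.:+ ℤS.con (pos 0) ℤS.:* y ℤS.:= b ℤS.:- a) refl a b y
      unit : ∀ n → .{{NonZero n}} → n ℕ.< p → Unit p (pos n)
      unit n n<p = coprime⇒unit (Coprime.sym (Coprime.prime⇒coprime p-prime n<p))
      Lsuc : ∀ w → w ℕ.< ℕ.pred p → L (suc w) ≡ 1ℚ
      Lsuc w w<p-1 = trans
        (∑-affine (pos 2 ℤ.* pos (suc w))
          (unit-* (pos 2) (pos (suc w)) (unit 2 2<p)
            (unit (suc w) (subst (suc w ℕ.<_) (ℕ.suc-pred p) (s≤s w<p-1))))
          (𝟙-periodic p) (pos (suc w) ℤ.* pos (suc w) ℤ.- (a ℤ.- b)))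
        (Kernel.total (kernel-𝟙 p))

    -- For odd prime p, `χ` is the Legendre symbol. Its reflection is a kernel of its own because
    -- the correlation of the weight contains both r(k) and r(-k).
    χ χ⁻ : ℤ → ℚ
    χ x = roots x - 1ℚ
    χ⁻ x = χ (ℤ.- x)

    χ-periodic : Periodic p χ
    χ-periodic x k = cong (_- 1ℚ) (roots-periodic x k)

    ∑-χ : ∑ p (λ x → χ (pos x)) ≡ 0ℚ
    ∑-χ = trans (∑-+ p _ _) (trans (cong₂ _+_ ∑-roots (∑-const p (- 1ℚ)))
      (solve 1 (λ a → a :+ a :* (:- con 1ℚ) := con 0ℚ) refl (ι p)))

    ∑-χχ : Prime p → 2 ℕ.< p → ∀ a b →
      ∑ p (λ x → χ (pos x ℤ.- a) * χ (pos x ℤ.- b)) ≡ ι p * 𝟙 p (a ℤ.- b) - 1ℚ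
    ∑-χχ p-prime 2<p a b = begin
      ∑ p (λ x → χ (pos x ℤ.- a) * χ (pos x ℤ.- b))
        ≡⟨ ∑-cong p (λ x → solve 2 (λ r s → (r :- con 1ℚ) :* (s :- con 1ℚ) := r :* s :+ ((con 1ℚ :+ (:- con 1ℚ) :* r) :+ (:- con 1ℚ) :* s)) refl
                             (roots (pos x ℤ.- a)) (roots (pos x ℤ.- b))) ⟩
      ∑ p (λ x → roots (pos x ℤ.- a) * roots (pos x ℤ.- b) + ((1ℚ + - 1ℚ * roots (pos x ℤ.- a)) + - 1ℚ * roots (pos x ℤ.- b)))
        ≡⟨ trans (∑-+ p _ _) (cong₂ _+_ (∑-roots-roots p-prime 2<p a b)
             (trans (∑-+ p _ _) (cong₂ _+_ (trans (∑-+ p _ _) (cong₂ _+_ (∑-const p 1ℚ) (minus a))) (minus b)))) ⟩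
      ((ι p - 1ℚ) + ι p * 𝟙 p (a ℤ.- b)) + ((ι p * 1ℚ + - 1ℚ * ι p) + - 1ℚ * ι p)
        ≡⟨ solve 2 (λ n x → ((n :- con 1ℚ) :+ n :* x) :+ ((n :* con 1ℚ :+ (:- con 1ℚ) :* n) :+ (:- con 1ℚ) :* n) := n :* x :- con 1ℚ) refl
             (ι p) (𝟙 p (a ℤ.- b)) ⟩
      ι p * 𝟙 p (a ℤ.- b) - 1ℚ ∎
      where
      open ≡-Reasoning
      minus : ∀ c → ∑ p (λ x → - 1ℚ * roots (pos x ℤ.- c)) ≡ - 1ℚ * ι p
      minus c = trans (∑-*ˡ p (- 1ℚ) _) (cong (- 1ℚ *_) (trans (∑-minus roots-periodic c) ∑-roots))

    kernel-χ : Prime p → 2 ℕ.< p → ∀ {σ} → 0ℚ < σ → ι p ≤ σ ² → Kernel p 0ℚ σ χ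
    kernel-χ p-prime 2<p = kernel-autocorrelation χ-periodic ∑-χ (∑-χχ p-prime 2<p)

    -- The substitution x ↦ -x turns the autocorrelation at (j, l) into that of `χ` at (-j, -l).
    kernel-χ⁻ : Prime p → 2 ℕ.< p → ∀ {σ} → 0ℚ < σ → ι p ≤ σ ² → Kernel p 0ℚ σ χ⁻
    kernel-χ⁻ p-prime 2<p = kernel-autocorrelation
      (λ x k → trans (cong χ (neg0 (x ℤ.+ k ℤ.* pos p)))
        (trans (periodic-reflect {F = χ} (pos 0) χ-periodic x k) (cong χ (sym (neg0 x)))))
      (trans (∑-cong p (λ i → cong χ (neg0 (pos i)))) (trans (∑-reflect χ-periodic (pos 0)) ∑-χ))
      (λ j l → trans
        (∑-cong p (λ i → cong₂ (λ x y → χ x * χ y) (reflect (pos i) j) (reflect (pos i) l)))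
        (trans (∑-reflect {F = λ x → χ (x ℤ.- (ℤ.- j)) * χ (x ℤ.- (ℤ.- l))}
                  (periodic-* {F = λ x → χ (x ℤ.- (ℤ.- j))} (periodic-minus {F = χ} (ℤ.- j) χ-periodic) (periodic-minus {F = χ} (ℤ.- l) χ-periodic)) (pos 0))
          (trans (∑-χχ p-prime 2<p (ℤ.- j) (ℤ.- l))
            (cong (λ t → ι p * t - 1ℚ) (trans (cong (𝟙 p) (negs j l)) (𝟙-minus p l j))))))
      where
      neg0 : ∀ x → ℤ.- x ≡ pos 0 ℤ.- x
      neg0 x = sym (ℤ.+-identityˡ (ℤ.- x))
      reflect : ∀ i j → ℤ.- (i ℤ.- j) ≡ (pos 0 ℤ.- i) ℤ.- (ℤ.- j)
      reflect = ℤS.solve 2 (λ i j → ℤS.:- (i ℤS.:- j) ℤS.:= (ℤS.con (pos 0) ℤS.:- i) ℤS.:- (ℤS.:- j)) refl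
      negs : ∀ j l → (ℤ.- j) ℤ.- (ℤ.- l) ≡ l ℤ.- j
      negs = ℤS.solve 2 (λ j l → (ℤS.:- j) ℤS.:- (ℤS.:- l) ℤS.:= l ℤS.:- j) refl

  -- A weight f supported on the squares modulo n; y bounds the variance of its sum over a window
  -- relative to the squared mean (see chebyshev).
  record Sieve (n : ℕ) (y : ℚ) : Set where
    field
      {{nonZero}}  : NonZero n
      f C          : ℤ → ℚ
      S m B        : ℚ
      f-periodic   : Periodic n f
      f-support    : ∀ x → f x ≡ 0ℚ ⊎ IsSquareMod n x
      f-total      : ∑ n (λ x → f (pos x)) ≡ S
      correlation  : ∀ a b → ∑ n (λ x → f (pos x ℤ.- a) * f (pos x ℤ.- b)) ≡ C (a ℤ.- b)
      combination  : Combination n m B C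
      main-term    : m * ι n ≡ S ²
      error-term   : ι n * B ≤ S ² * y
      0<S          : 0ℚ < S
      0≤B          : 0ℚ ≤ B
      1≤y          : 1ℚ ≤ y

  -- Weights at single primes and their products

  prime∤1 : ∀ {p} → Prime p → ¬ (p ℕ∣.∣ 1)
  prime∤1 p-prime p∣1 with ℕ∣.∣1⇒≡1 p∣1
  ... | refl with p-prime
  ... | ()

  1≤* : ∀ {a b} → 1ℚ ≤ a → 1ℚ ≤ b → 1ℚ ≤ a * b
  1≤* p q = *-mono-≤ {1ℚ} {_} {1ℚ} {_} 0≤1 (ℚ.≤-trans 0≤1 q) p q

  sieve-1 : Sieve 1 1ℚ
  sieve-1 = record
    { f = λ _ → 1ℚ ; C = λ _ → 1ℚ ; S = 1ℚ ; m = 1ℚ ; B = 1ℚ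
    ; f-periodic  = λ _ _ → refl
    ; f-support   = λ _ → inj₂ (λ p p-prime p∣1 → contradiction p∣1 (prime∤1 p-prime))
    ; f-total     = refl
    ; correlation = λ _ _ → refl
    ; combination = kernel ℕ∣.∣-refl kernel-1 0≤1 (trans (ℚ.*-identityˡ (ι 1)) ι-1)
    ; main-term   = trans (ℚ.*-identityˡ (ι 1)) ι-1
    ; error-term  = ℚ.≤-reflexive (trans (ℚ.*-identityʳ (ι 1)) ι-1)
    ; 0<S = 0<1 ; 0≤B = 0≤1 ; 1≤y = ℚ.≤-refl
    }

  -- `B` adds the norms of all kernels, including the constant one, whose pair sums have no error at
  -- all. This overcount is what makes `B`, and with it the ratio n B / S², multiplicative.
  sieve-* : ∀ {a b y z} → Coprime a b → Sieve a y → Sieve b z → Sieve (a ℕ.* b) (y * z)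
  sieve-* {a} {b} {y} {z} c P Q = record
    { nonZero     = ℕ.m*n≢0 a b
    ; f           = λ x → P.f x * Q.f x
    ; C           = λ x → P.C x * Q.C x
    ; S           = P.S * Q.S
    ; f-periodic  = periodic-* (periodic-multiple {F = P.f} (ℕ∣.m∣m*n b) P.f-periodic)
                               (periodic-multiple {F = Q.f} (ℕ∣.n∣m*n a) Q.f-periodic)
    ; f-support   = support
    ; f-total     = trans (∑-multiplicative {F = P.f} {G = Q.f} c P.f-periodic Q.f-periodic) (cong₂ _*_ P.f-total Q.f-total)
    ; correlation = λ i j → trans
        (∑-cong (a ℕ.* b) (λ x → interchange (P.f (pos x ℤ.- i)) (Q.f (pos x ℤ.- i)) (P.f (pos x ℤ.- j)) (Q.f (pos x ℤ.- j))))
        (trans (∑-multiplicative {F = λ x → P.f (x ℤ.- i) * P.f (x ℤ.- j)} {G = λ x → Q.f (x ℤ.- i) * Q.f (x ℤ.- j)} c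
                  (periodic-* {F = λ x → P.f (x ℤ.- i)} (periodic-minus {F = P.f} i P.f-periodic) (periodic-minus {F = P.f} j P.f-periodic))
                  (periodic-* {F = λ x → Q.f (x ℤ.- i)} (periodic-minus {F = Q.f} i Q.f-periodic) (periodic-minus {F = Q.f} j Q.f-periodic)))
               (cong₂ _*_ (P.correlation i j) (Q.correlation i j)))
    ; combination = combination-* c P.combination Q.combination
    ; main-term   = trans (cong ((P.m * Q.m) *_) (ι-* a b))
        (trans (interchange P.m Q.m (ι a) (ι b)) (trans (cong₂ _*_ P.main-term Q.main-term) (interchange P.S P.S Q.S Q.S)))
    ; error-term  = subst₂ _≤_
        (trans (interchange (ι a) P.B (ι b) Q.B) (cong (_* (P.B * Q.B)) (sym (ι-* a b))))
        (trans (interchange (P.S ²) y (Q.S ²) z) (cong (_* (y * z)) (interchange P.S P.S Q.S Q.S)))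
        (*-mono-≤ (0≤* (0≤ι a) P.0≤B) (0≤* (0≤sq Q.S) (ℚ.≤-trans 0≤1 Q.1≤y)) P.error-term Q.error-term)
    ; 0<S = *-pos P.0<S Q.0<S ; 0≤B = 0≤* P.0≤B Q.0≤B ; 1≤y = 1≤* P.1≤y Q.1≤y
    }
    where
    module P = Sieve P
    module Q = Sieve Q
    interchange : ∀ a b c d → (a * b) * (c * d) ≡ (a * c) * (b * d)
    interchange = solve 4 (λ a b c d → (a :* b) :* (c :* d) := (a :* c) :* (b :* d)) refl
    support : ∀ x → P.f x * Q.f x ≡ 0ℚ ⊎ IsSquareMod (a ℕ.* b) x
    support x with P.f-support x | Q.f-support x
    ... | inj₁ e | _      = inj₁ (trans (cong (_* Q.f x) e) (ℚ.*-zeroˡ (Q.f x)))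
    ... | inj₂ _ | inj₁ e = inj₁ (trans (cong (P.f x *_) e) (ℚ.*-zeroʳ (P.f x)))
    ... | inj₂ s | inj₂ t = inj₂ square
      where
      square : IsSquareMod (a ℕ.* b) x
      square p p-prime p∣ab with euclidsLemma a b p-prime p∣ab
      ... | inj₁ p∣a = s p p-prime p∣a
      ... | inj₂ p∣b = t p p-prime p∣b

  square-mod-prime : ∀ {p x} → Prime p → ∀ z → pos p ∣ℤ z ℤ.* z ℤ.- x → IsSquareMod p x
  square-mod-prime p-prime z d l l-prime l∣p with prime⇒irreducible p-prime l∣p
  ... | inj₁ refl = contradiction ℕ∣.∣-refl (prime∤1 l-prime)
  ... | inj₂ refl = z , ℤ∣.∣⇒∣ᵤ d

  -- The constructive form of "a nonvanishing sum has a nonvanishing term"; it extracts a square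
  -- root of x when the root count at x is not zero.
  ∑-support : ∀ n {g} {P : ℕ → Set} → (∀ i → g i ≡ 0ℚ ⊎ P i) → ∑ n g ≡ 0ℚ ⊎ ∃ P
  ∑-support zero    h = inj₁ refl
  ∑-support (suc n) h with ∑-support n h | h n
  ... | inj₂ w | _      = inj₂ w
  ... | inj₁ _ | inj₂ w = inj₂ (n , w)
  ... | inj₁ e | inj₁ e′ = inj₁ (cong₂ _+_ e e′)

  𝟙-support : ∀ n x → 𝟙 n x ≡ 0ℚ ⊎ pos n ∣ℤ x
  𝟙-support n x with pos n ∣ℤ? x
  ... | yes d = inj₂ d
  ... | no ¬d = inj₁ (𝟙-no ¬d)

  -- The hypothesis says κ = 2p/(p + 1), and this is at least 1 because p ≥ 1.
  1≤local : ∀ {p} κ {ρ} → 1ℚ ≤ p → κ * (p + 1ℚ) ≡ p + p → 0ℚ ≤ ρ → 1ℚ ≤ κ * (1ℚ + ρ)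
  1≤local {p} κ {ρ} 1≤p eq ρ≥0 = *-cancelˡ (ℚ.+-mono-≤-< (ℚ.≤-trans 0≤1 1≤p) 0<1) (begin
    (p + 1ℚ) * 1ℚ               ≡⟨ ℚ.*-identityʳ (p + 1ℚ) ⟩
    p + 1ℚ                      ≤⟨ ℚ.+-monoʳ-≤ p 1≤p ⟩
    p + p                       ≤⟨ p≤p+q (p + p) (0≤* (0≤+ p≥0 p≥0) ρ≥0) ⟩
    (p + p) + (p + p) * ρ       ≡⟨ cong (λ t → t + t * ρ) eq ⟨
    κ * (p + 1ℚ) + κ * (p + 1ℚ) * ρ ≡⟨ solve 3 (λ k p r → k :* (p :+ con 1ℚ) :+ k :* (p :+ con 1ℚ) :* r := (p :+ con 1ℚ) :* (k :* (con 1ℚ :+ r))) refl κ p ρ ⟩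
    (p + 1ℚ) * (κ * (1ℚ + ρ))   ∎)
    where
    open ℚ.≤-Reasoning
    p≥0 : 0ℚ ≤ p
    p≥0 = ℚ.≤-trans 0≤1 1≤p

  -- The constant weight has S = 2 and B = 2, so n B = S² and any y ≥ 1 is admissible. The value of
  -- y is chosen to have the same shape as at odd primes.
  sieve-2 : ∀ {κ ρ} → Prime 2 → κ * (ι 2 + 1ℚ) ≡ ι 2 + ι 2 → 0ℚ ≤ ρ → Sieve 2 (κ * (1ℚ + ρ))
  sieve-2 {κ} {ρ} 2-prime eq ρ≥0 = record
    { f = λ _ → 1ℚ ; C = λ _ → 1ℚ + 1ℚ ; S = 1ℚ + 1ℚ
    ; f-periodic  = λ _ _ → refl
    ; f-support   = λ x → inj₂ (square x)
    ; f-total     = refl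
    ; correlation = λ _ _ → refl
    ; combination = scale (1ℚ + 1ℚ) 0≤2 (kernel (ℕ∣.1∣ 2) kernel-1 0≤1 (trans (ℚ.*-identityˡ (ι 1)) ι-1))
    ; main-term   = cong ((1ℚ + 1ℚ) * 1ℚ *_) ι-2
    ; error-term  = subst (λ t → t * ((1ℚ + 1ℚ) * 1ℚ) ≤ (1ℚ + 1ℚ) ² * (κ * (1ℚ + ρ))) (sym ι-2)
                      (*-monoˡ {1ℚ} {_} {(1ℚ + 1ℚ) ²} (0≤sq (1ℚ + 1ℚ)) 1≤y)
    ; 0<S = ℚ.+-mono-< 0<1 0<1 ; 0≤B = 0≤* 0≤2 0≤1 ; 1≤y = 1≤y
    }
    where
    0≤2 : 0ℚ ≤ 1ℚ + 1ℚ
    0≤2 = 0≤+ 0≤1 0≤1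
    1≤y : 1ℚ ≤ κ * (1ℚ + ρ)
    1≤y = 1≤local κ (1≤ι 2) eq ρ≥0
    r² : ∀ r → r ℕ.< 2 → pos r ℤ.* pos r ≡ pos r
    r² 0 _ = refl
    r² 1 _ = refl
    r² (suc (suc _)) (s≤s (s≤s ()))
    square : ∀ x → IsSquareMod 2 x
    square x = square-mod-prime 2-prime (pos r) (divides (ℤ.- q) (trans (cong (ℤ._- x) (r² r (ℤ/.n%ℕd<d x 2)))
      (trans (cong (λ z → pos r ℤ.- z) (ℤ/.a≡a%ℕn+[a/ℕn]*n x 2))
        (ℤS.solve 2 (λ r q → r ℤS.:- (r ℤS.:+ q ℤS.:* ℤS.con (pos 2)) ℤS.:= (ℤS.:- q) ℤS.:* ℤS.con (pos 2)) refl (pos r) q))))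
      where
      r : ℕ
      r = x ℤ/.%ℕ 2
      q : ℤ
      q = x ℤ/./ℕ 2

  -- ρ is a rational stand-in for 1/√p, rounded up: the last hypothesis says ρ ≥ 1/√p, so σ = pρ is
  -- at least √p and bounds the norms of both χ kernels.
  sieve-odd : ∀ {p κ ρ} → Prime p → 2 ℕ.< p → κ * (ι p + 1ℚ) ≡ ι p + ι p → 0ℚ < ρ → 1ℚ ≤ ι p * ρ ² →
    Sieve p (κ * (1ℚ + ρ))
  sieve-odd {p} {κ} {ρ} p-prime 2<p eq ρ>0 1≤pρ² = record
    { f           = f
    ; C           = λ k → ((n + 1ℚ) * 1ℚ + (n + 1ℚ) * 𝟙 p k) + (χ k + χ⁻ k)
    ; S           = n + 1ℚ
    ; f-periodic  = λ x k → cong₂ _+_ (roots-periodic x k) (𝟙-periodic p x k)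
    ; f-support   = support
    ; f-total     = trans (∑-+ p _ _) (cong₂ _+_ ∑-roots (Kernel.total (kernel-𝟙 p)))
    ; correlation = correlation
    ; combination =
        (scale (n + 1ℚ) n+1≥0 (kernel (ℕ∣.1∣ p) kernel-1 0≤1 (trans (ℚ.*-identityˡ (ι 1)) ι-1))
          ⊕ scale (n + 1ℚ) n+1≥0 (kernel ℕ∣.∣-refl (kernel-𝟙 p) (ℚ.<⇒≤ 0<1/n) 1/n*n≡1))
          ⊕ (kernel ℕ∣.∣-refl (kernel-χ p-prime 2<p σ>0 n≤σ²) ℚ.≤-refl (ℚ.*-zeroˡ n)
          ⊕ kernel ℕ∣.∣-refl (kernel-χ⁻ p-prime 2<p σ>0 n≤σ²) ℚ.≤-refl (ℚ.*-zeroˡ n))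
    -- Both χ kernels have mean 0, so the mean is (p + 1)(1 + 1/p), and p times it is (p + 1)².
    ; main-term   = trans (solve 2 (λ n w → (((n :+ con 1ℚ) :* con 1ℚ :+ (n :+ con 1ℚ) :* w) :+ (con 0ℚ :+ con 0ℚ)) :* n :=
                                     (n :+ con 1ℚ) :* (n :+ w :* n)) refl n 1/n)
                          (cong (λ t → (n + 1ℚ) * (n + t)) 1/n*n≡1)
    -- Here p B = 2p(p + 1) + 2p²ρ, while S² κ (1 + ρ) = 2p(p + 1)(1 + ρ); the slack is 2pρ.
    ; error-term  = ≤-by ((n + n) * ρ) (0≤* (0≤+ n≥0 n≥0) (ℚ.<⇒≤ ρ>0)) (trans
        (solve 3 (λ n k r → ((n :+ con 1ℚ) :* (n :+ con 1ℚ)) :* (k :* (con 1ℚ :+ r)) :=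
                   (k :* (n :+ con 1ℚ)) :* ((n :+ con 1ℚ) :* (con 1ℚ :+ r))) refl n κ ρ)
        (trans (cong (_* ((n + 1ℚ) * (1ℚ + ρ))) eq)
          (solve 2 (λ n r → (n :+ n) :* ((n :+ con 1ℚ) :* (con 1ℚ :+ r)) :=
            n :* (((n :+ con 1ℚ) :* con 1ℚ :+ (n :+ con 1ℚ) :* con 1ℚ) :+ (n :* r :+ n :* r)) :+ (n :+ n) :* r) refl n ρ)))
    ; 0<S = ℚ.+-mono-≤-< n≥0 0<1
    ; 0≤B = 0≤+ (0≤+ (0≤* n+1≥0 0≤1) (0≤* n+1≥0 0≤1)) (0≤+ (ℚ.<⇒≤ σ>0) (ℚ.<⇒≤ σ>0))
    ; 1≤y = 1≤local κ (1≤ι p) eq (ℚ.<⇒≤ ρ>0)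
    }
    where
    instance
      p≢0 : NonZero p
      p≢0 = prime⇒nonZero p-prime
      n-positive : ℚ.Positive (ι p)
      n-positive = ℚ.positive (0<ι p)
      n-nonZero : ℚ.NonZero (ι p)
      n-nonZero = ℚ.pos⇒nonZero (ι p)
    open Residues p
    n σ 1/n : ℚ
    n = ι p
    σ = n * ρ
    1/n = ℚ.1/ n
    f : ℤ → ℚ
    f x = roots x + 𝟙 p x
    n≥0 : 0ℚ ≤ n
    n≥0 = 0≤ι p
    n+1≥0 : 0ℚ ≤ n + 1ℚ
    n+1≥0 = 0≤+ n≥0 0≤1
    0<1/n : 0ℚ < 1/n
    0<1/n = ℚ.positive⁻¹ 1/n {{ℚ.1/pos⇒pos n}}
    1/n*n≡1 : 1/n * n ≡ 1ℚ
    1/n*n≡1 = ℚ.*-inverseˡ n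
    σ>0 : 0ℚ < σ
    σ>0 = *-pos (0<ι p) ρ>0
    n≤σ² : n ≤ σ ²
    n≤σ² = subst₂ _≤_ (ℚ.*-identityʳ n) (solve 2 (λ n r → n :* (n :* (r :* r)) := (n :* r) :* (n :* r)) refl n ρ)
             (*-monoˡ n≥0 1≤pρ²)
    support : ∀ x → f x ≡ 0ℚ ⊎ IsSquareMod p x
    support x with ∑-support p (λ y → 𝟙-support p (pos y ℤ.* pos y ℤ.- x)) | 𝟙-support p x
    ... | inj₂ (y , d) | _      = inj₂ (square-mod-prime p-prime (pos y) d)
    ... | inj₁ _ | inj₂ d       = inj₂ (square-mod-prime p-prime (pos 0) (subst (pos p ∣ℤ_) (sym (ℤ.+-identityˡ (ℤ.- x))) (ℤ∣.∣m⇒∣-m d)))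
    ... | inj₁ e | inj₁ e′      = inj₁ (cong₂ _+_ e e′)
    correlation : ∀ a b → ∑ p (λ x → f (pos x ℤ.- a) * f (pos x ℤ.- b)) ≡
      ((n + 1ℚ) * 1ℚ + (n + 1ℚ) * 𝟙 p (a ℤ.- b)) + (χ (a ℤ.- b) + χ⁻ (a ℤ.- b))
    correlation a b = begin
      ∑ p (λ x → f (pos x ℤ.- a) * f (pos x ℤ.- b))
        ≡⟨ ∑-cong p (λ x → solve 4 (λ r i s j → (r :+ i) :* (s :+ j) := r :* s :+ (j :* r :+ i :* (s :+ j))) refl
             (roots (pos x ℤ.- a)) (𝟙 p (pos x ℤ.- a)) (roots (pos x ℤ.- b)) (𝟙 p (pos x ℤ.- b))) ⟩
      ∑ p (λ x → roots (pos x ℤ.- a) * roots (pos x ℤ.- b) +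
        (𝟙 p (pos x ℤ.- b) * roots (pos x ℤ.- a) + 𝟙 p (pos x ℤ.- a) * f (pos x ℤ.- b)))
        ≡⟨ trans (∑-+ p _ _) (cong₂ _+_ (∑-roots-roots p-prime 2<p a b) (trans (∑-+ p _ _) (cong₂ _+_
             (sift {F = λ x → roots (x ℤ.- a)} (periodic-minus {F = roots} a roots-periodic) b)
             (sift {F = λ x → f (x ℤ.- b)} (periodic-minus {F = f} b (λ x k → cong₂ _+_ (roots-periodic x k) (𝟙-periodic p x k))) a)))) ⟩
      ((n - 1ℚ) + n * 𝟙 p (a ℤ.- b)) + (roots (b ℤ.- a) + (roots (a ℤ.- b) + 𝟙 p (a ℤ.- b)))
        ≡⟨ cong (λ z → ((n - 1ℚ) + n * 𝟙 p (a ℤ.- b)) + (roots z + (roots (a ℤ.- b) + 𝟙 p (a ℤ.- b)))) (swap a b) ⟩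
      ((n - 1ℚ) + n * 𝟙 p (a ℤ.- b)) + (roots (ℤ.- (a ℤ.- b)) + (roots (a ℤ.- b) + 𝟙 p (a ℤ.- b)))
        ≡⟨ solve 4 (λ n i r s → ((n :- con 1ℚ) :+ n :* i) :+ (r :+ (s :+ i)) :=
             ((n :+ con 1ℚ) :* con 1ℚ :+ (n :+ con 1ℚ) :* i) :+ ((s :- con 1ℚ) :+ (r :- con 1ℚ))) refl
             n (𝟙 p (a ℤ.- b)) (roots (ℤ.- (a ℤ.- b))) (roots (a ℤ.- b)) ⟩
      ((n + 1ℚ) * 1ℚ + (n + 1ℚ) * 𝟙 p (a ℤ.- b)) + (χ (a ℤ.- b) + χ⁻ (a ℤ.- b)) ∎
      where
      open ≡-Reasoning
      swap : ∀ a b → b ℤ.- a ≡ ℤ.- (a ℤ.- b)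
      swap = ℤS.solve 2 (λ a b → b ℤS.:- a ℤS.:= ℤS.:- (a ℤS.:- b)) refl

  ι-*-/ : ∀ a d → .{{_ : NonZero d}} → ι d * (pos a / d) ≡ ι a
  ι-*-/ a (suc d) = trans (cong (_* (pos a / suc d)) (ι-def (suc d))) (trans (ℚ.toℚᵘ-injective
    (ℚᵘ.≃-trans (ℚ.toℚᵘ-homo-* (pos (suc d) / 1) (pos a / suc d))
    (ℚᵘ.≃-trans (ℚᵘ.*-cong (ℚ.toℚᵘ-fromℚᵘ (ℚᵘ.mkℚᵘ (pos (suc d)) 0)) (ℚ.toℚᵘ-fromℚᵘ (ℚᵘ.mkℚᵘ (pos a) d)))
    (ℚᵘ.≃-trans (ℚᵘ.*≡* (ℤS.solve 2 (λ a d → (d ℤS.:* a) ℤS.:* ℤS.con (pos 1) ℤS.:= a ℤS.:* (ℤS.con (pos 1) ℤS.:* d)) refl (pos a) (pos (suc d))))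
                (ℚᵘ.≃-sym (ℚ.toℚᵘ-fromℚᵘ (ℚᵘ.mkℚᵘ (pos a) 0))))))) (sym (ι-def a)))

  -- Variance and Chebyshev's inequality

  module Variance {n : ℕ} {y : ℚ} (sieve : Sieve n y) where
    open Sieve sieve

    window : ℤ → ℕ → ℚ
    window x h = ∑ h (λ j → f (x ℤ.- pos j))

    first-moment : ∀ h → ∑ n (λ x → window (pos x) h) ≡ ι h * S
    first-moment h = trans (∑-swap n h _)
      (trans (∑-cong h (λ j → trans (∑-minus f-periodic (pos j)) f-total)) (∑-const h S))

    second-moment : ∀ h → ∑ n (λ x → window (pos x) h ²) ≤ m * ι h ² + B * ι h
    second-moment h = subst (_≤ m * ι h ² + B * ι h) (sym expand) (combination-bound combination h)
      where
      expand : ∑ n (λ x → window (pos x) h ²) ≡ pairs h C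
      expand = trans (∑-cong n (λ x → ∑-*-∑ h h _ _))
        (trans (∑-swap n h _) (∑-cong h (λ j → trans (∑-swap n h _) (∑-cong h (λ l → correlation (pos j) (pos l))))))

    -- Scaling the deviation by n avoids dividing by it. After expansion the quadratic terms carry
    -- the factor m n - S², which `main-term` makes zero, and only the error linear in h survives.
    variance : ∀ h → ∑ n (λ x → (ι n * window (pos x) h - ι h * S) ²) ≤ ι n ² * (B * ι h)
    variance h = begin
      ∑ n (λ x → (N * window (pos x) h - H * S) ²)
        ≡⟨ ∑-cong n (λ x → solve 3 (λ n w k → (n :* w :- k) :* (n :* w :- k) := (n :* n) :* (w :* w) :+ ((:- (n :* k :+ n :* k)) :* w :+ k :* k)) refl
             N (window (pos x) h) (H * S)) ⟩
      ∑ n (λ x → N ² * window (pos x) h ² + (- (N * (H * S) + N * (H * S)) * window (pos x) h + (H * S) ²))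
        ≡⟨ trans (∑-+ n _ _) (cong₂ _+_ (∑-*ˡ n (N ²) _) (trans (∑-+ n _ _) (cong₂ _+_
             (trans (∑-*ˡ n (- (N * (H * S) + N * (H * S))) _) (cong (- (N * (H * S) + N * (H * S)) *_) (first-moment h)))
             (∑-const n ((H * S) ²))))) ⟩
      N ² * ∑ n (λ x → window (pos x) h ²) + (- (N * (H * S) + N * (H * S)) * (H * S) + N * (H * S) ²)
        ≤⟨ ℚ.+-monoˡ-≤ _ (*-monoˡ (0≤sq N) (second-moment h)) ⟩
      N ² * (m * H ² + B * H) + (- (N * (H * S) + N * (H * S)) * (H * S) + N * (H * S) ²)
        ≡⟨ solve 5 (λ n m h b s → (n :* n) :* (m :* (h :* h) :+ b :* h) :+
               ((:- (n :* (h :* s) :+ n :* (h :* s))) :* (h :* s) :+ n :* ((h :* s) :* (h :* s))) :=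
             (n :* n) :* (b :* h) :+ (n :* (h :* h)) :* (m :* n :- s :* s)) refl N m H B S ⟩
      N ² * (B * H) + (N * H ²) * (m * N - S ²)
        ≡⟨ cong (λ t → N ² * (B * H) + (N * H ²) * (t - S ²)) main-term ⟩
      N ² * (B * H) + (N * H ²) * (S ² - S ²)
        ≡⟨ solve 3 (λ a b s → a :+ b :* (s :- s) := a) refl (N ² * (B * H)) (N * H ²) (S ²) ⟩
      N ² * (B * H) ∎
      where
      open ℚ.≤-Reasoning
      N H : ℚ
      N = ι n
      H = ι h

    -- Emptiness is tested by the total weight being zero, which is decidable in ℚ and is all that
    -- the deviation estimate uses.
    empty : ℤ → ℕ → ℚ
    empty x h with window x h ℚ.≟ 0ℚ
    ... | yes _ = 1ℚ
    ... | no  _ = 0ℚ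

    empty-yes : ∀ x h → window x h ≡ 0ℚ → empty x h ≡ 1ℚ
    empty-yes x h eq with window x h ℚ.≟ 0ℚ
    ... | yes _  = refl
    ... | no neq = contradiction eq neq

    0≤empty : ∀ x h → 0ℚ ≤ empty x h
    0≤empty x h with window x h ℚ.≟ 0ℚ
    ... | yes _ = 0≤1
    ... | no _  = ℚ.≤-refl

    deviation-of-empty : ∀ x h → (ι h * S) ² * empty x h ≤ (ι n * window x h - ι h * S) ²
    deviation-of-empty x h with window x h ℚ.≟ 0ℚ
    ... | yes eq = ℚ.≤-reflexive (trans
      (solve 2 (λ n k → (k :* k) :* con 1ℚ := (n :* con 0ℚ :- k) :* (n :* con 0ℚ :- k)) refl (ι n) (ι h * S))
      (cong (λ w → (ι n * w - ι h * S) ²) (sym eq)))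
    ... | no _   = subst (_≤ (ι n * window x h - ι h * S) ²) (sym (ℚ.*-zeroʳ ((ι h * S) ²))) (0≤sq (ι n * window x h - ι h * S))

    -- On an empty window the squared deviation is exactly (hS)², so the count Z satisfies (hS)² Z ≤
    -- n² B h. Then `error-term` replaces n B by S² y, and h S² cancels.
    chebyshev : ∀ h → .{{NonZero h}} → ι h * ∑ n (λ x → empty (pos x) h) ≤ ι n * y
    chebyshev h = *-cancelˡ {c = H * S ²} (*-pos (0<ι h) (*-pos 0<S 0<S)) (begin
      (H * S ²) * (H * Z)                               ≡⟨ solve 3 (λ h s z → (h :* (s :* s)) :* (h :* z) := ((h :* s) :* (h :* s)) :* z) refl H S Z ⟩
      (H * S) ² * Z                                     ≡⟨ ∑-*ˡ n ((H * S) ²) _ ⟨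
      ∑ n (λ x → (H * S) ² * empty (pos x) h)           ≤⟨ ∑-mono n (λ x → deviation-of-empty (pos x) h) ⟩
      ∑ n (λ x → (N * window (pos x) h - H * S) ²)      ≤⟨ variance h ⟩
      N ² * (B * H)                                     ≡⟨ solve 3 (λ n b h → (n :* n) :* (b :* h) := (n :* h) :* (n :* b)) refl N B H ⟩
      (N * H) * (N * B)                                 ≤⟨ *-monoˡ (0≤* (0≤ι n) (0≤ι h)) error-term ⟩
      (N * H) * (S ² * y)                               ≡⟨ solve 4 (λ n h s y → (n :* h) :* (s :* y) := (h :* s) :* (n :* y)) refl N H (S ²) y ⟩
      (H * S ²) * (N * y)                               ∎)
      where
      open ℚ.≤-Reasoning
      N H Z : ℚ
      N = ι n
      H = ι h
      Z = ∑ n (λ x → empty (pos x) h)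

    -- The number of empty windows that end at x, over the lengths 1, ..., n; index h stands for
    -- length h + 1.
    empties : ℤ → ℚ
    empties x = ∑ n (λ h → empty x (suc h))

    ∑-harmonic : ∀ k → ∑ k (λ h → pos 1 / suc h) ≡ harmonic 0 k
    ∑-harmonic zero    = refl
    ∑-harmonic (suc k) = cong (_+ pos 1 / suc k) (∑-harmonic k)

    ∑-empties : ∑ n (λ x → empties (pos x)) ≤ (ι n * y) * harmonic 0 n
    ∑-empties = begin
      ∑ n (λ x → empties (pos x))                           ≡⟨ ∑-swap n n _ ⟩
      ∑ n (λ h → ∑ n (λ x → empty (pos x) (suc h)))         ≤⟨ ∑-mono n (λ h → divide h) ⟩
      ∑ n (λ h → (ι n * y) * (pos 1 / suc h))               ≡⟨ ∑-*ˡ n (ι n * y) _ ⟩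
      (ι n * y) * ∑ n (λ h → pos 1 / suc h)                 ≡⟨ cong ((ι n * y) *_) (∑-harmonic n) ⟩
      (ι n * y) * harmonic 0 n                              ∎
      where
      open ℚ.≤-Reasoning
      divide : ∀ h → ∑ n (λ x → empty (pos x) (suc h)) ≤ (ι n * y) * (pos 1 / suc h)
      divide h = *-cancelˡ (0<ι (suc h)) (ℚ.≤-trans (chebyshev (suc h)) (ℚ.≤-reflexive (trans
        (solve 1 (λ a → a := a :* con 1ℚ) refl (ι n * y))
        (trans (cong ((ι n * y) *_) (sym (trans (ι-*-/ 1 (suc h)) ι-1)))
          (solve 3 (λ a d r → a :* (d :* r) := d :* (a :* r)) refl (ι n * y) (ι (suc h)) (pos 1 / suc h))))))

  -- From empty windows to squared gaps

  ∑-odd : ∀ g → ∑ g (λ m → 1ℚ + (ι m + ι m)) ≡ ι g * ι g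
  ∑-odd zero    = sym (trans (cong (_* ι 0) ι-0) (ℚ.*-zeroˡ (ι 0)))
  ∑-odd (suc g) = trans (cong (_+ (1ℚ + (ι g + ι g))) (∑-odd g))
    (trans (solve 1 (λ g → g :* g :+ (con 1ℚ :+ (g :+ g)) := (con 1ℚ :+ g) :* (con 1ℚ :+ g)) refl (ι g))
           (cong (λ t → t * t) (sym (ι-suc g))))

  1≤harmonic : ∀ n → .{{NonZero n}} → 1ℚ ≤ harmonic 0 n
  1≤harmonic (suc zero)    = ℚ.≤-refl
  1≤harmonic (suc (suc n)) = ℚ.≤-trans (1≤harmonic (suc n))
    (p≤p+q (harmonic 0 (suc n)) (ℚ.nonNegative⁻¹ _ {{ℚ.normalize-nonNeg 1 (suc (suc n))}}))

  module Gaps {q : ℕ} {y : ℚ} (sieve : Sieve q y) {s : ℕ → ℕ} (enum : EnumeratesSquaresMod q s) where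
    open Sieve sieve
    open Variance sieve
    open EnumeratesSquaresMod enum

    s-mono : ∀ {i j} → i ℕ.≤ j → s i ℕ.≤ s j
    s-mono {i} {zero}  z≤n = ℕ.≤-refl
    s-mono {i} {suc j} i≤1+j with ℕ.m≤n⇒m<n∨m≡n i≤1+j
    ... | inj₁ (s≤s i≤j) = ℕ.≤-trans (s-mono i≤j) (ℕ.<⇒≤ (increasing j))
    ... | inj₂ refl      = ℕ.≤-refl

    f-between : ∀ i x → s i ℕ.< x → x ℕ.< s (suc i) → f (pos x) ≡ 0ℚ
    f-between i x lo hi with f-support (pos x)
    ... | inj₁ eq = eq
    ... | inj₂ sq with complete x sq
    ... | j , refl with ℕ.≤-total j i
    ... | inj₁ j≤i = contradiction (s-mono j≤i) (ℕ.<⇒≱ lo)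
    ... | inj₂ i≤j with ℕ.m≤n⇒m<n∨m≡n i≤j
    ... | inj₁ i<j = contradiction (s-mono i<j) (ℕ.<⇒≱ hi)
    ... | inj₂ refl = contradiction lo (ℕ.<-irrefl refl)

    -- q ≡ 0² modulo each of its primes, so q occurs in the enumeration and the successor of a
    -- smaller term cannot pass it.
    next≤q : ∀ k → s k ℕ.< q → s (suc k) ℕ.≤ q
    next≤q k sk<q with complete q q-square
      where
      q-square : IsSquareMod q (pos q)
      q-square p _ p∣q = pos 0 , ℤ∣.∣⇒∣ᵤ (subst (pos p ∣ℤ_) (sym (ℤ.+-identityˡ (ℤ.- pos q))) (ℤ∣.∣m⇒∣-m (ℤ∣.∣ᵤ⇒∣ p∣q)))
    ... | j , refl with ℕ.≤-total j k
    ... | inj₁ j≤k = contradiction (s-mono j≤k) (ℕ.<⇒≱ sk<q)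
    ... | inj₂ k≤j with ℕ.m≤n⇒m<n∨m≡n k≤j
    ... | inj₁ k<j  = s-mono k<j
    ... | inj₂ refl = contradiction sk<q (ℕ.<-irrefl refl)

    -- Windows run backwards from their end. From s i + m, a window of length h ≤ m reaches down to
    -- s i + m - h + 1 at the lowest, still above s i.
    window-between : ∀ i m h → h ℕ.≤ m → s i ℕ.+ m ℕ.< s (suc i) → window (pos (s i ℕ.+ m)) h ≡ 0ℚ
    window-between i m h h≤m hi = trans (∑-cong-< h λ j j<h → trans
        (cong f (trans (ℤ.m-n≡m⊖n (s i ℕ.+ m) j) (ℤ.⊖-≥ (j≤ j (ℕ.<-≤-trans j<h h≤m)))))
        (f-between i _
          (subst (ℕ._≤_ (suc (s i))) (sym (ℕ.+-∸-assoc (s i) (ℕ.<⇒≤ (ℕ.<-≤-trans j<h h≤m))))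
            (ℕ.≤-trans (ℕ.≤-reflexive (sym (ℕ.+-comm (s i) 1))) (ℕ.+-monoʳ-≤ (s i) (ℕ.m<n⇒0<n∸m (ℕ.<-≤-trans j<h h≤m)))))
          (ℕ.≤-<-trans (ℕ.m∸n≤m (s i ℕ.+ m) j) hi)))
      (∑-0 h)
      where
      j≤ : ∀ j → j ℕ.< m → j ℕ.≤ s i ℕ.+ m
      j≤ j j<m = ℕ.≤-trans (ℕ.<⇒≤ j<m) (ℕ.m≤n+m m (s i))

    empties-≥ : ∀ i m → s i ℕ.+ m ℕ.< s (suc i) → m ℕ.≤ q → ι m ≤ empties (pos (s i ℕ.+ m))
    empties-≥ i m hi m≤q = begin
      ι m                                              ≡⟨ trans (sym (ℚ.*-identityʳ (ι m))) (sym (∑-const m 1ℚ)) ⟩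
      ∑ m (λ _ → 1ℚ)                                   ≡⟨ ∑-cong-< m (λ h h<m → empty-yes (pos (s i ℕ.+ m)) (suc h) (window-between i m (suc h) h<m hi)) ⟨
      ∑ m (λ h → empty (pos (s i ℕ.+ m)) (suc h))      ≤⟨ ∑-≤-range _ m≤q (λ h → 0≤empty (pos (s i ℕ.+ m)) (suc h)) ⟩
      empties (pos (s i ℕ.+ m))                        ∎
      where open ℚ.≤-Reasoning

    -- A squared gap g² is the sum of 1 + 2m over m < g. At distance m after a square the m windows
    -- of lengths 1, ..., m ending there are empty, so the cost of that position is at least 1 + 2m.
    cost : ℕ → ℚ
    cost x = 1ℚ + (empties (pos x) + empties (pos x))

    0≤cost : ∀ x → 0ℚ ≤ cost x
    0≤cost x = 0≤+ 0≤1 (0≤+ e e)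
      where
      e : 0ℚ ≤ empties (pos x)
      e = ∑-nonneg q (λ h → 0≤empty (pos x) (suc h))

    gap : ℕ → ℕ
    gap i = s (suc i) ℕ.∸ s i

    gap² : ∀ i → s (suc i) ℕ.≤ q → ι (gap i ℕ.^ 2) ≤ ∑ (gap i) (λ m → cost (s i ℕ.+ m))
    gap² i next≤q = begin
      ι (gap i ℕ.^ 2)                          ≡⟨ cong (λ t → ι (gap i ℕ.* t)) (ℕ.*-identityʳ (gap i)) ⟩
      ι (gap i ℕ.* gap i)                      ≡⟨ ι-* (gap i) (gap i) ⟩
      ι (gap i) * ι (gap i)                    ≡⟨ ∑-odd (gap i) ⟨
      ∑ (gap i) (λ m → 1ℚ + (ι m + ι m))       ≤⟨ ∑-mono-< (gap i) (λ m m<g → ℚ.+-monoʳ-≤ 1ℚ (ℚ.+-mono-≤ (bound m m<g) (bound m m<g))) ⟩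
      ∑ (gap i) (λ m → cost (s i ℕ.+ m))       ∎
      where
      open ℚ.≤-Reasoning
      below : ∀ m → m ℕ.< gap i → s i ℕ.+ m ℕ.< s (suc i)
      below m m<g = subst (s i ℕ.+ m ℕ.<_) (ℕ.m+[n∸m]≡n (ℕ.<⇒≤ (increasing i))) (ℕ.+-monoʳ-< (s i) m<g)
      bound : ∀ m → m ℕ.< gap i → ι m ≤ empties (pos (s i ℕ.+ m))
      bound m m<g = empties-≥ i m (below m m<g) (ℕ.≤-trans (ℕ.<⇒≤ m<g) (ℕ.≤-trans (ℕ.m∸n≤m (s (suc i)) (s i)) next≤q))

    partial : ℕ → ℕ
    partial k = sum (map (λ i → gap i ℕ.^ 2) (filter (λ i → s i ℕ.<? q) (upTo k)))

    partial-suc : ∀ k → partial (suc k) ≡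
      partial k ℕ.+ sum (map (λ i → gap i ℕ.^ 2) (filter (λ i → s i ℕ.<? q) (k ∷ [])))
    partial-suc k = begin
      sum (map g (filter P? (upTo (suc k))))            ≡⟨ cong (λ l → sum (map g (filter P? l))) (List.upTo-∷ʳ k) ⟨
      sum (map g (filter P? (upTo k ++ k ∷ [])))        ≡⟨ cong (λ l → sum (map g l)) (List.filter-++ P? (upTo k) (k ∷ [])) ⟩
      sum (map g (filter P? (upTo k) ++ filter P? (k ∷ [])))  ≡⟨ cong sum (List.map-++ g (filter P? (upTo k)) _) ⟩
      sum (map g (filter P? (upTo k)) ++ map g (filter P? (k ∷ [])))  ≡⟨ sum-++ (map g (filter P? (upTo k))) _ ⟩
      partial k ℕ.+ sum (map g (filter P? (k ∷ [])))    ∎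
      where
      open ≡-Reasoning
      P? = λ i → s i ℕ.<? q
      g = λ i → gap i ℕ.^ 2

    -- The minimum with q lets one induction cover both phases: below q each gap extends the charged
    -- interval by exactly its length, and from q on the filter discards the new term.
    partial-≤ : ∀ k → ι (partial k) ≤ ∑ (s k ℕ.⊓ q) cost
    partial-≤ zero = subst (_≤ ∑ (s 0 ℕ.⊓ q) cost) (sym ι-0) (∑-nonneg (s 0 ℕ.⊓ q) 0≤cost)
    partial-≤ (suc k) with s k ℕ.<? q
    ... | yes sk<q = begin
      ι (partial (suc k))                      ≡⟨ cong ι (partial-suc k) ⟩
      ι (partial k ℕ.+ sum (map (λ i → gap i ℕ.^ 2) (filter (λ i → s i ℕ.<? q) (k ∷ []))))
        ≡⟨ cong (λ l → ι (partial k ℕ.+ sum (map (λ i → gap i ℕ.^ 2) l))) (List.filter-accept (λ i → s i ℕ.<? q) sk<q) ⟩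
      ι (partial k ℕ.+ (gap k ℕ.^ 2 ℕ.+ 0))    ≡⟨ cong (λ t → ι (partial k ℕ.+ t)) (ℕ.+-identityʳ (gap k ℕ.^ 2)) ⟩
      ι (partial k ℕ.+ gap k ℕ.^ 2)            ≡⟨ ι-+ (partial k) (gap k ℕ.^ 2) ⟩
      ι (partial k) + ι (gap k ℕ.^ 2)          ≤⟨ ℚ.+-mono-≤ (partial-≤ k) (gap² k (next≤q k sk<q)) ⟩
      ∑ (s k ℕ.⊓ q) cost + ∑ (gap k) (λ m → cost (s k ℕ.+ m))
        ≡⟨ cong (λ t → ∑ t cost + ∑ (gap k) (λ m → cost (s k ℕ.+ m))) (ℕ.m≤n⇒m⊓n≡m (ℕ.<⇒≤ sk<q)) ⟩
      ∑ (s k) cost + ∑ (gap k) (λ m → cost (s k ℕ.+ m))  ≡⟨ ∑-split (s k) (gap k) cost ⟨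
      ∑ (s k ℕ.+ gap k) cost                   ≡⟨ cong (λ t → ∑ t cost) (ℕ.m+[n∸m]≡n (ℕ.<⇒≤ (increasing k))) ⟩
      ∑ (s (suc k)) cost                       ≡⟨ cong (λ t → ∑ t cost) (ℕ.m≤n⇒m⊓n≡m (next≤q k sk<q)) ⟨
      ∑ (s (suc k) ℕ.⊓ q) cost                 ∎
      where open ℚ.≤-Reasoning
    ... | no sk≮q = begin
      ι (partial (suc k))                      ≡⟨ cong ι (partial-suc k) ⟩
      ι (partial k ℕ.+ sum (map (λ i → gap i ℕ.^ 2) (filter (λ i → s i ℕ.<? q) (k ∷ []))))
        ≡⟨ cong (λ l → ι (partial k ℕ.+ sum (map (λ i → gap i ℕ.^ 2) l))) (List.filter-reject (λ i → s i ℕ.<? q) sk≮q) ⟩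
      ι (partial k ℕ.+ 0)                      ≡⟨ cong ι (ℕ.+-identityʳ (partial k)) ⟩
      ι (partial k)                            ≤⟨ partial-≤ k ⟩
      ∑ (s k ℕ.⊓ q) cost                       ≤⟨ ∑-≤-range cost (ℕ.⊓-monoˡ-≤ q (ℕ.<⇒≤ (increasing k))) 0≤cost ⟩
      ∑ (s (suc k) ℕ.⊓ q) cost                 ∎
      where open ℚ.≤-Reasoning

    ∑-squared-gaps-≤ : ι (∑-squared-gaps q s) ≤ ι 3 * ((ι q * y) * harmonic 0 q)
    ∑-squared-gaps-≤ = begin
      ι (∑-squared-gaps q s)                   ≤⟨ partial-≤ q ⟩
      ∑ (s q ℕ.⊓ q) cost                       ≤⟨ ∑-≤-range cost (ℕ.m⊓n≤n (s q) q) 0≤cost ⟩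
      ∑ q cost                                 ≡⟨ trans (∑-+ q _ _) (cong₂ _+_ (∑-const q 1ℚ) (∑-+ q _ _)) ⟩
      -- The summand 1 of the cost is absorbed using y ≥ 1 and H_q ≥ 1; with the two copies of `E`
      -- this gives the factor 3.
      ι q * 1ℚ + (E + E)                       ≤⟨ ℚ.+-mono-≤ 1-term (ℚ.+-mono-≤ ∑-empties ∑-empties) ⟩
      Y + (Y + Y)                              ≡⟨ solve 1 (λ a → a :+ (a :+ a) := (con 1ℚ :+ (con 1ℚ :+ con 1ℚ)) :* a) refl Y ⟩
      (1ℚ + (1ℚ + 1ℚ)) * Y                     ≡⟨ cong (_* Y) ι-3 ⟨
      ι 3 * Y                                  ∎
      where
      open ℚ.≤-Reasoning
      E Y : ℚ
      E = ∑ q (λ x → empties (pos x))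
      Y = (ι q * y) * harmonic 0 q
      1-term : ι q * 1ℚ ≤ Y
      1-term = ℚ.≤-trans (*-monoˡ (0≤ι q) (1≤* 1≤y (1≤harmonic q))) (ℚ.≤-reflexive (sym (ℚ.*-assoc (ι q) y (harmonic 0 q))))

  -- Multiplicative quantities

  prime-factor : ∀ n → .{{NonZero n}} → n ≢ 1 → ∃ λ p → Prime p × p ∣ n
  prime-factor n n≢1 with factorise n
  ... | record { factors = [] ; isFactorisation = eq } = contradiction eq n≢1
  ... | record { factors = p ∷ ps ; isFactorisation = refl ; factorsPrime = p-prime ∷ _ } = p , p-prime , ℕ∣.m∣m*n (product ps)

  prime-coprime : ∀ {p n} → Prime p → ¬ (p ∣ n) → Coprime p n
  prime-coprime p-prime p∤n (d∣p , d∣n) with prime⇒irreducible p-prime d∣p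
  ... | inj₁ d≡1  = d≡1
  ... | inj₂ refl = contradiction d∣n p∤n

  PrimeDivisor : ℕ → Set
  PrimeDivisor q = ∃ λ p → Prime p × p ∣ q

  ∏ : {A : Set} → (A → ℚ) → List A → ℚ
  ∏ c = foldr (λ d r → c d * r) 1ℚ

  ∏-* : {A : Set} (c d : A → ℚ) → ∀ l → ∏ (λ x → c x * d x) l ≡ ∏ c l * ∏ d l
  ∏-* c d []      = refl
  ∏-* c d (x ∷ l) = trans (cong (c x * d x *_) (∏-* c d l))
    (solve 4 (λ a b x y → (a :* b) :* (x :* y) := (a :* x) :* (b :* y)) refl (c x) (d x) (∏ c l) (∏ d l))

  ∏-nonneg : {A : Set} {c : A → ℚ} → (∀ x → 0ℚ ≤ c x) → ∀ l → 0ℚ ≤ ∏ c l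
  ∏-nonneg h []      = 0≤1
  ∏-nonneg h (x ∷ l) = 0≤* (h x) (∏-nonneg h l)

  module _ {q : ℕ} where

    primes : List (PrimeDivisor q) → List ℕ
    primes = map proj₁

    primes-prime : ∀ l → All Prime (primes l)
    primes-prime []                    = []
    primes-prime ((p , p-prime , _) ∷ l) = p-prime ∷ primes-prime l

    coprime-product : ∀ {p} → Prime p → ∀ l → All (p ℕ.<_) (primes l) → Coprime p (product (primes l))
    coprime-product p-prime l p<l = prime-coprime p-prime λ p∣l →
      ℕ.<-irrefl refl (All.lookup p<l (factorisationHasAllPrimeFactors p-prime p∣l (primes-prime l)))

    -- The prime-by-prime assembly, shared by `Sieve` and `TotientWeight`. A strictly increasing
    -- list makes each prime coprime to the product of those after it.
    multiplicative : (W : ℕ → ℚ → Set) → W 1 1ℚ →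
      (∀ {a b s t} → Coprime a b → W a s → W b t → W (a ℕ.* b) (s * t)) →
      {c : PrimeDivisor q → ℚ} → (∀ d → W (proj₁ d) (c d)) →
      ∀ l → AllPairs ℕ._<_ (primes l) → W (product (primes l)) (∏ c l)
    multiplicative W w₁ w* w []      _          = w₁
    multiplicative W w₁ w* w (d ∷ l) (d<l ∷ inc) =
      w* (coprime-product (proj₁ (proj₂ d)) l d<l) (w d) (multiplicative W w₁ w* w l inc)

    product-∣ : ∀ l → AllPairs ℕ._<_ (primes l) → product (primes l) ∣ q
    product-∣ [] _ = ℕ∣.1∣ q
    product-∣ ((p , p-prime , p∣q) ∷ l) (p<l ∷ inc) with product-∣ l inc
    ... | ℕ∣.divides k eq = subst (p ℕ.* product (primes l) ∣_) (sym eq) (ℕ∣.*-monoˡ-∣ (product (primes l))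
      (Coprime.coprime-divisor (coprime-product p-prime l p<l) (subst (p ∣_) (trans eq (ℕ.*-comm k _)) p∣q)))

    -- The function mapped inside `primeDivisors`, named so that inductions can run over arbitrary
    -- lists in place of `upTo`.
    candidate : ℕ → Maybe (PrimeDivisor q)
    candidate p = Maybe.map (p ,_) (dec⇒maybe (prime? p ×-dec p ∣? q))

    candidates-all : ∀ {P : ℕ → Set} {xs} → All P xs → All P (primes (mapMaybe candidate xs))
    candidates-all []                = []
    candidates-all {xs = x ∷ _} (px ∷ pxs) with prime? x ×-dec x ∣? q
    ... | yes _ = px ∷ candidates-all pxs
    ... | no _  = candidates-all pxs

    candidates-increasing : ∀ {xs} → AllPairs ℕ._<_ xs → AllPairs ℕ._<_ (primes (mapMaybe candidate xs))
    candidates-increasing []                = []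
    candidates-increasing {x ∷ _} (x<xs ∷ inc) with prime? x ×-dec x ∣? q
    ... | yes _ = candidates-all x<xs ∷ candidates-increasing inc
    ... | no _  = candidates-increasing inc

    candidates-complete : ∀ {p xs} → Prime p → p ∣ q → p ∈ xs → p ∈ primes (mapMaybe candidate xs)
    candidates-complete {p} p-prime p∣q (here refl) with prime? p ×-dec p ∣? q
    ... | yes _ = here refl
    ... | no ¬d = contradiction (p-prime , p∣q) ¬d
    candidates-complete {p} {x ∷ _} p-prime p∣q (there p∈xs) with prime? x ×-dec x ∣? q
    ... | yes _ = there (candidates-complete p-prime p∣q p∈xs)
    ... | no _  = candidates-complete p-prime p∣q p∈xs

  primeDivisors-increasing : ∀ q → AllPairs ℕ._<_ (primes (primeDivisors q))
  primeDivisors-increasing q = candidates-increasing (AllPairs.applyUpTo⁺₁ _ (suc q) (λ i<j _ → i<j))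

  -- If the cofactor k were not 1, it would have a prime factor p. As p is also in the list, p²
  -- would divide q.
  product-primeDivisors : ∀ q → .{{NonZero q}} → SquareFree q → product (primes (primeDivisors q)) ≡ q
  product-primeDivisors q squareFree with product-∣ (primeDivisors q) (primeDivisors-increasing q)
  ... | ℕ∣.divides k eq with k ℕ.≟ 1
  ... | yes refl = sym (trans eq (ℕ.*-identityˡ _))
  ... | no k≢1   = contradiction (subst (_∣ 1) (sym (squareFree p p²∣q)) ℕ∣.∣-refl) (prime∤1 p-prime)
    where
    instance
      k≢0 : NonZero k
      k≢0 = ℕ.m*n≢0⇒m≢0 k {{subst NonZero eq (ℕ.≢-nonZero (ℕ.≢-nonZero⁻¹ q))}}
    p = proj₁ (prime-factor k k≢1)
    p-prime = proj₁ (proj₂ (prime-factor k k≢1))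
    p∣k = proj₂ (proj₂ (prime-factor k k≢1))
    p∣q : p ∣ q
    p∣q = subst (p ∣_) (sym eq) (ℕ∣.∣m⇒∣m*n _ p∣k)
    p²∣q : p ℕ.* p ∣ q
    p²∣q = subst (p ℕ.* p ∣_) (sym eq) (ℕ∣.*-pres-∣ p∣k
      (∈⇒∣product (candidates-complete p-prime p∣q (∈-upTo⁺ (s≤s (ℕ∣.∣⇒≤ p∣q))))))

  -- Euler's totient

  -- A multiplicatively built minorant of the indicator of the residues coprime to n. Since φ stands
  -- on the larger side of the final inequality, it is to be bounded from below, here by ∏ (p - 1).
  record TotientWeight (n : ℕ) (t : ℚ) : Set where
    field
      {{nonZero}} : NonZero n
      g           : ℤ → ℚ
      g-periodic  : Periodic n g
      g-total     : ∑ n (λ x → g (pos x)) ≡ t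
      0≤g         : ∀ x → 0ℚ ≤ g x
      g≤1         : ∀ x → g x ≤ 1ℚ
      g-vanishes  : ∀ x p → Prime p → p ∣ n → pos p ∣ℤ x → g x ≡ 0ℚ

  totientWeight-1 : TotientWeight 1 1ℚ
  totientWeight-1 = record
    { g = λ _ → 1ℚ ; g-periodic = λ _ _ → refl ; g-total = refl
    ; 0≤g = λ _ → 0≤1 ; g≤1 = λ _ → ℚ.≤-refl
    ; g-vanishes = λ x p p-prime p∣1 _ → contradiction p∣1 (prime∤1 p-prime)
    }

  totientWeight-* : ∀ {a b s t} → Coprime a b → TotientWeight a s → TotientWeight b t → TotientWeight (a ℕ.* b) (s * t)
  totientWeight-* {a} {b} c V W = record
    { nonZero    = ℕ.m*n≢0 a b
    ; g          = λ x → V.g x * W.g x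
    ; g-periodic = periodic-* (periodic-multiple {F = V.g} (ℕ∣.m∣m*n b) V.g-periodic)
                              (periodic-multiple {F = W.g} (ℕ∣.n∣m*n a) W.g-periodic)
    ; g-total    = trans (∑-multiplicative {F = V.g} {G = W.g} c V.g-periodic W.g-periodic) (cong₂ _*_ V.g-total W.g-total)
    ; 0≤g        = λ x → 0≤* (V.0≤g x) (W.0≤g x)
    ; g≤1        = λ x → *-mono-≤ {V.g x} {1ℚ} {W.g x} {1ℚ} (V.0≤g x) 0≤1 (V.g≤1 x) (W.g≤1 x)
    ; g-vanishes = vanishes
    }
    where
    module V = TotientWeight V
    module W = TotientWeight W
    vanishes : ∀ x p → Prime p → p ∣ a ℕ.* b → pos p ∣ℤ x → V.g x * W.g x ≡ 0ℚ
    vanishes x p p-prime p∣ab p∣x with euclidsLemma a b p-prime p∣ab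
    ... | inj₁ p∣a = trans (cong (_* W.g x) (V.g-vanishes x p p-prime p∣a p∣x)) (ℚ.*-zeroˡ (W.g x))
    ... | inj₂ p∣b = trans (cong (V.g x *_) (W.g-vanishes x p p-prime p∣b p∣x)) (ℚ.*-zeroʳ (V.g x))

  totientWeight-prime : ∀ {p} → Prime p → TotientWeight p (ι p - 1ℚ)
  totientWeight-prime {p} p-prime = record
    { g          = λ x → 1ℚ + - 1ℚ * 𝟙 p x
    ; g-periodic = λ x k → cong (λ t → 1ℚ + - 1ℚ * t) (𝟙-periodic p x k)
    ; g-total    = trans (∑-+ p _ _) (cong₂ _+_ (trans (∑-const p 1ℚ) (ℚ.*-identityʳ (ι p)))
                     (trans (∑-*ˡ p (- 1ℚ) _) (cong (- 1ℚ *_) (Kernel.total (kernel-𝟙 p)))))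
    ; 0≤g        = λ x → ≤-by (1ℚ - 𝟙 p x) (p≤q⇒0≤q-p (𝟙≤1 p x))
                     (solve 1 (λ t → con 1ℚ :+ (:- con 1ℚ) :* t := con 0ℚ :+ (con 1ℚ :- t)) refl (𝟙 p x))
    ; g≤1        = λ x → ≤-by (𝟙 p x) (0≤𝟙 p x)
                     (solve 1 (λ t → con 1ℚ := (con 1ℚ :+ (:- con 1ℚ) :* t) :+ t) refl (𝟙 p x))
    ; g-vanishes = vanishes
    }
    where
    instance
      p≢0 : NonZero p
      p≢0 = prime⇒nonZero p-prime
    vanishes : ∀ x l → Prime l → l ∣ p → pos l ∣ℤ x → 1ℚ + - 1ℚ * 𝟙 p x ≡ 0ℚ
    vanishes x l l-prime l∣p l∣x with prime⇒irreducible p-prime l∣p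
    ... | inj₂ refl = cong (λ t → 1ℚ + - 1ℚ * t) (𝟙-yes l∣x)
    ... | inj₁ refl = contradiction ℕ∣.∣-refl (prime∤1 l-prime)

  ∑-≤-count : ∀ {P : ℕ → Set} (P? : ∀ k → Dec (P k)) {f} → (∀ k → P k → f k ≤ 1ℚ) → (∀ k → ¬ P k → f k ≤ 0ℚ) →
    ∀ n → ∑ n f ≤ ι (length (filter P? (upTo n)))
  ∑-≤-count P? f≤1 f≤0 zero = ℚ.≤-reflexive (sym ι-0)
  ∑-≤-count {P} P? {f} f≤1 f≤0 (suc n) = begin
    ∑ n f + f n                                                              ≤⟨ ℚ.+-mono-≤ (∑-≤-count P? f≤1 f≤0 n) (step (P? n)) ⟩
    ι (length (filter P? (upTo n))) + ι (length (filter P? (n ∷ [])))        ≡⟨ ι-+ (length (filter P? (upTo n))) _ ⟨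
    ι (length (filter P? (upTo n)) ℕ.+ length (filter P? (n ∷ [])))          ≡⟨ cong ι (List.length-++ (filter P? (upTo n))) ⟨
    ι (length (filter P? (upTo n) ++ filter P? (n ∷ [])))                    ≡⟨ cong (ι ∘ length) (List.filter-++ P? (upTo n) (n ∷ [])) ⟨
    ι (length (filter P? (upTo n ++ n ∷ [])))                                ≡⟨ cong (ι ∘ length ∘ filter P?) (List.upTo-∷ʳ n) ⟩
    ι (length (filter P? (upTo (suc n))))                                    ∎
    where
    open ℚ.≤-Reasoning
    step : Dec (P n) → f n ≤ ι (length (filter P? (n ∷ [])))
    step (yes pn) = ℚ.≤-trans (f≤1 n pn) (ℚ.≤-reflexive (trans (sym ι-1) (cong (ι ∘ length) (sym (List.filter-accept P? pn)))))
    step (no ¬pn) = ℚ.≤-trans (f≤0 n ¬pn) (0≤ι (length (filter P? (n ∷ []))))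

  -- A residue not coprime to q shares a prime with q, and there the weight vanishes; elsewhere it
  -- is at most 1.
  totientWeight-≤φ : ∀ {q t} → TotientWeight q t → t ≤ ι (φ q)
  totientWeight-≤φ {q} W = subst (_≤ ι (φ q)) g-total
    (∑-≤-count (λ k → coprime? k q) (λ k _ → g≤1 (pos k)) not-coprime q)
    where
    open TotientWeight W
    not-coprime : ∀ k → ¬ Coprime k q → g (pos k) ≤ 0ℚ
    not-coprime k ¬c with prime-factor (GCD.gcd k q) {{ℕ.≢-nonZero (GCD.gcd[m,n]≢0 k q (inj₂ (ℕ.≢-nonZero⁻¹ q)))}} (¬c ∘ Coprime.gcd≡1⇒coprime)
    ... | p , p-prime , p∣gcd = ℚ.≤-reflexive (g-vanishes (pos k) p p-prime
      (ℕ∣.∣-trans p∣gcd (GCD.gcd[m,n]∣n k q)) (ℤ∣.∣ᵤ⇒∣ (ℕ∣.∣-trans p∣gcd (GCD.gcd[m,n]∣m k q))))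

  -- The local factors

  -- For odd p, the reciprocal of the density (p + 1)/(2p) of the squares modulo p; it is the ratio
  -- p B / S² without its χ terms.
  κ : ℕ → ℚ
  κ p = pos (p ℕ.+ p) / suc p

  κ-def : ∀ p → κ p * (ι p + 1ℚ) ≡ ι p + ι p
  κ-def p = trans (ℚ.*-comm (κ p) (ι p + 1ℚ)) (trans (cong (_* κ p) (trans (ℚ.+-comm (ι p) 1ℚ) (sym (ι-suc p))))
    (trans (ι-*-/ (p ℕ.+ p) (suc p)) (ι-+ p p)))

  0≤κ : ∀ p → 0ℚ ≤ κ p
  0≤κ p = ℚ.nonNegative⁻¹ (κ p) {{ℚ.normalize-nonNeg (p ℕ.+ p) (suc p)}}

  -- Since κ p · p / (2 (p − 1)) = p²/(p² − 1), this is ∏ p²/(p² − 1) ≤ ∏_{n ≥ a} n²/((n − 1)(n + 1)) = a/(a − 1).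
  ∏κ-≤ : ∀ {q} a (l : List (PrimeDivisor q)) → All (a ℕ.≤_) (primes l) → AllPairs ℕ._<_ (primes l) → .{{NonZero a}} →
    (ι a - 1ℚ) * (∏ (κ ∘ proj₁) l * ι (product (primes l))) ≤ ι a * (ι (2 ℕ.^ length l) * ∏ (λ d → ι (proj₁ d) - 1ℚ) l)
  ∏κ-≤ a [] _ _ = subst (λ t → (ι a - 1ℚ) * (1ℚ * t) ≤ ι a * (t * 1ℚ)) (sym ι-1)
    (≤-by 1ℚ 0≤1 (solve 1 (λ a → a :* (con 1ℚ :* con 1ℚ) := (a :- con 1ℚ) :* (con 1ℚ :* con 1ℚ) :+ con 1ℚ) refl (ι a)))
  ∏κ-≤ a ((p , p-prime , p∣q) ∷ l) (a≤p ∷ _) (p<l ∷ inc) = begin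
    (A - 1ℚ) * ((κ p * K) * ι (p ℕ.* product (primes l)))  ≡⟨ cong (λ t → (A - 1ℚ) * ((κ p * K) * t)) (ι-* p _) ⟩
    (A - 1ℚ) * ((κ p * K) * (P * Q))                       ≡⟨ solve 5 (λ a k K p Q → (a :- con 1ℚ) :* ((k :* K) :* (p :* Q)) :=
                                                                ((a :- con 1ℚ) :* k) :* (((con 1ℚ :+ p) :- con 1ℚ) :* (K :* Q))) refl A (κ p) K P Q ⟩
    ((A - 1ℚ) * κ p) * (((1ℚ + P) - 1ℚ) * (K * Q))         ≤⟨ *-monoˡ (0≤* (p≤q⇒0≤q-p (1≤ι a)) (0≤κ p))
                                                                (subst (λ t → (t - 1ℚ) * (K * Q) ≤ t * (T * Φ)) (ι-suc p) (∏κ-≤ (suc p) l p<l inc)) ⟩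
    ((A - 1ℚ) * κ p) * ((1ℚ + P) * (T * Φ))                ≡⟨ solve 4 (λ a k p t → ((a :- con 1ℚ) :* k) :* ((con 1ℚ :+ p) :* t) :=
                                                                (a :- con 1ℚ) :* ((k :* (p :+ con 1ℚ)) :* t)) refl A (κ p) P (T * Φ) ⟩
    (A - 1ℚ) * ((κ p * (P + 1ℚ)) * (T * Φ))                ≡⟨ cong (λ t → (A - 1ℚ) * (t * (T * Φ))) (κ-def p) ⟩
    -- The claim 2p(a - 1) ≤ 2a(p - 1) is equivalent to a ≤ p. The recursive call used p + 1 as the
    -- lower bound for the remaining primes, so the product telescopes.
    (A - 1ℚ) * ((P + P) * (T * Φ))                         ≤⟨ ≤-by (((P - A) + (P - A)) * (T * Φ))
                                                                (0≤* (0≤+ P-A P-A) (0≤* (0≤ι (2 ℕ.^ length l)) Φ≥0))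
                                                                (solve 4 (λ a p t f → a :* ((con 1ℚ :+ con 1ℚ) :* t :* ((p :- con 1ℚ) :* f)) :=
                                                                   (a :- con 1ℚ) :* ((p :+ p) :* (t :* f)) :+ ((p :- a) :+ (p :- a)) :* (t :* f)) refl A P T Φ) ⟩
    A * ((1ℚ + 1ℚ) * T * ((P - 1ℚ) * Φ))                   ≡⟨ cong (λ t → A * (t * ((P - 1ℚ) * Φ))) (trans (cong (_* T) (sym ι-2)) (sym (ι-* 2 (2 ℕ.^ length l)))) ⟩
    A * (ι (2 ℕ.^ suc (length l)) * ((P - 1ℚ) * Φ))        ∎
    where
    open ℚ.≤-Reasoning
    A P K Q T Φ : ℚ
    A = ι a
    P = ι p
    K = ∏ (κ ∘ proj₁) l
    Q = ι (product (primes l))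
    T = ι (2 ℕ.^ length l)
    Φ = ∏ (λ d → ι (proj₁ d) - 1ℚ) l
    P-A : 0ℚ ≤ P - A
    P-A = p≤q⇒0≤q-p (ι-mono a≤p)
    Φ≥0 : 0ℚ ≤ Φ
    Φ≥0 = ∏-nonneg (λ d → p≤q⇒0≤q-p (1≤ι (proj₁ d) {{prime⇒nonZero (proj₁ (proj₂ d))}})) l

  -- Termwise bounds for square roots and the logarithm

  0<1/ : ∀ a .{{_ : ℚ.NonZero a}} → 0ℚ < a → 0ℚ < ℚ.1/ a
  0<1/ a {{nz}} a>0 = ℚ.positive⁻¹ ((ℚ.1/ a) {{nz}}) {{ℚ.1/pos⇒pos a {{ℚ.positive a>0}}}}

  √-seq-² : ∀ n k → √-seq n k ² ≤ ι n
  √-seq-² n k = *-cancelˡ {c = ι K ²} (*-pos (0<ι K) (0<ι K)) (begin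
    ι K ² * √-seq n k ²                        ≡⟨ solve 2 (λ k t → (k :* k) :* (t :* t) := (k :* t) :* (k :* t)) refl (ι K) (√-seq n k) ⟩
    (ι K * √-seq n k) ²                        ≡⟨ cong _² (ι-*-/ ⌊√ n ℕ.* (K ℕ.* K) ⌋ K) ⟩
    ι ⌊√ n ℕ.* (K ℕ.* K) ⌋ ²                   ≡⟨ ι-* ⌊√ n ℕ.* (K ℕ.* K) ⌋ _ ⟨
    ι (⌊√ n ℕ.* (K ℕ.* K) ⌋ ℕ.* ⌊√ n ℕ.* (K ℕ.* K) ⌋)  ≤⟨ ι-mono (proj₁ (⌊√⌋-spec (n ℕ.* (K ℕ.* K)))) ⟩
    ι (n ℕ.* (K ℕ.* K))                        ≡⟨ trans (ι-* n _) (cong (ι n *_) (ι-* K K)) ⟩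
    ι n * ι K ²                                ≡⟨ ℚ.*-comm (ι n) (ι K ²) ⟩
    ι K ² * ι n                                ∎)
    where
    open ℚ.≤-Reasoning
    K : ℕ
    K = suc k

  √-seq-positive : ∀ n k → .{{NonZero n}} → 0ℚ < √-seq n k
  √-seq-positive n k = ℚ.<-≤-trans 0<1
    (subst (_≤ √-seq n k) (ℚ.+-identityˡ 1ℚ) (proj₂ (proj₂ (proj₂ (√-positive n))) k z≤n))

  1/√-seq-positive : ∀ n k → .{{_ : NonZero n}} → 0ℚ < seq (1/√ n) k
  1/√-seq-positive n k = 0<1/ (√-seq n k) {{ℚ.>-nonZero (√-seq-positive n k)}} (√-seq-positive n k)

  -- The approximants of √n are rounded down, so their reciprocals are rounded up, which is the
  -- direction that `sieve-odd` asks for.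
  1/√-seq-² : ∀ n k → .{{_ : NonZero n}} → 1ℚ ≤ ι n * seq (1/√ n) k ²
  1/√-seq-² n k = begin
    1ℚ                     ≡⟨ cong _² inverse ⟨
    (√-seq n k * ρ) ²      ≡⟨ solve 2 (λ t r → (t :* r) :* (t :* r) := (t :* t) :* (r :* r)) refl (√-seq n k) ρ ⟩
    √-seq n k ² * ρ ²      ≤⟨ *-monoʳ (0≤sq ρ) (√-seq-² n k) ⟩
    ι n * ρ ²              ∎
    where
    open ℚ.≤-Reasoning
    ρ : ℚ
    ρ = seq (1/√ n) k
    inverse : √-seq n k * ρ ≡ 1ℚ
    -- `√-positive` supplies the threshold 0, so `reciprocal` drops no terms and index k on one side
    -- meets index k on the other.
    inverse = ℚ.*-inverseʳ (√-seq n k) {{ℚ.>-nonZero (√-seq-positive n k)}}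

  -- `L₀` is the right Riemann sum of mesh 1 for log q. Right sums of the decreasing 1/t grow under
  -- refinement, so every term of `log q` is at least `L₀`. As q ≥ 2 gives `L₀` ≥ ½, the leading 1
  -- of H_q costs two more copies of it.
  harmonic-≤-log : ∀ q k → .{{_ : NonZero q}} → 1 ℕ.< q → harmonic 0 q ≤ ι 3 * seq (log q) k
  harmonic-≤-log (suc zero) k (s≤s ())
  harmonic-≤-log (suc (suc r)) k _ = begin
    harmonic 0 (suc (suc r))        ≡⟨ harmonic-+ 0 1 (suc r) ⟩
    1ℚ + L₀                         ≤⟨ ℚ.+-monoˡ-≤ L₀ (ℚ.+-mono-≤ (half r) (half r)) ⟩
    (L₀ + L₀) + L₀                  ≡⟨ solve 1 (λ a → (a :+ a) :+ a := (con 1ℚ :+ (con 1ℚ :+ con 1ℚ)) :* a) refl L₀ ⟩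
    (1ℚ + (1ℚ + 1ℚ)) * L₀           ≡⟨ cong (_* L₀) ι-3 ⟨
    ι 3 * L₀                        ≤⟨ *-monoˡ (0≤ι 3) (subst (λ t → L₀ ≤ harmonic t (suc r ℕ.* suc k)) (ℕ.*-identityˡ (suc k)) (refine-≥ 1 (suc r) k)) ⟩
    ι 3 * harmonic (suc k) (suc r ℕ.* suc k) ∎
    where
    open ℚ.≤-Reasoning
    L₀ : ℚ
    L₀ = harmonic 1 (suc r)
    half : ∀ r → ℚ.½ ≤ harmonic 1 (suc r)
    half zero    = ℚ.≤-refl
    half (suc r) = ℚ.≤-trans (half r) (p≤p+q (harmonic 1 (suc r)) (ℚ.nonNegative⁻¹ _ {{ℚ.normalize-nonNeg 1 (suc (suc (suc r)))}}))

  -- Every term of the sequence 1/√p is at least 1/√p, and every term of log q at least H_q − 1, so the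
  -- bound already holds termwise, for each index k.
  module RationalBound (q : ℕ) .{{_ : NonZero q}} (1<q : 1 ℕ.< q) (squareFree : SquareFree q)
           (s : ℕ → ℕ) (enum : EnumeratesSquaresMod q s) (k : ℕ) where

    ρ : PrimeDivisor q → ℚ
    ρ (p , p-prime , _) = seq (1/√ p {{prime⇒nonZero p-prime}}) k

    sieve-prime : ∀ d → Sieve (proj₁ d) (κ (proj₁ d) * (1ℚ + ρ d))
    sieve-prime d@(p , p-prime , _) with p ℕ.≟ 2
    ... | yes refl = sieve-2 {κ 2} p-prime (κ-def 2) (ℚ.<⇒≤ (1/√-seq-positive 2 k))
    ... | no p≢2   = sieve-odd {p} {κ p} p-prime
      (ℕ.≤∧≢⇒< (ℕ.nonTrivial⇒n>1 p {{prime⇒nonTrivial p-prime}}) (p≢2 ∘ sym)) (κ-def p)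
      (1/√-seq-positive p k {{prime⇒nonZero p-prime}}) (1/√-seq-² p k {{prime⇒nonZero p-prime}})

    l : List (PrimeDivisor q)
    l = primeDivisors q

    K R Φ : ℚ
    K = ∏ (κ ∘ proj₁) l
    R = ∏ (λ d → 1ℚ + ρ d) l
    Φ = ∏ (λ d → ι (proj₁ d) - 1ℚ) l

    sieve : Sieve q (K * R)
    sieve = subst₂ Sieve (product-primeDivisors q squareFree) (∏-* (κ ∘ proj₁) (λ d → 1ℚ + ρ d) l)
      (multiplicative Sieve sieve-1 sieve-* sieve-prime l (primeDivisors-increasing q))

    Φ≤φ : Φ ≤ ι (φ q)
    Φ≤φ = totientWeight-≤φ (subst (λ n → TotientWeight n Φ) (product-primeDivisors q squareFree)
      (multiplicative TotientWeight totientWeight-1 totientWeight-* (λ d → totientWeight-prime (proj₁ (proj₂ d))) l (primeDivisors-increasing q)))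

    all-≥2 : ∀ l → All (2 ℕ.≤_) (primes {q} l)
    all-≥2 []                      = []
    all-≥2 ((p , p-prime , _) ∷ l) = ℕ.nonTrivial⇒n>1 p {{prime⇒nonTrivial p-prime}} ∷ all-≥2 l

    -- Every prime is at least 2, so the telescoping product is started at a = 2, and a/(a - 1) is
    -- the constant 2.
    Kq≤ : K * ι q ≤ ι 2 * (ι (2 ℕ.^ ω q) * ι (φ q))
    Kq≤ = ℚ.≤-trans
      (subst (_≤ ι 2 * (ι (2 ℕ.^ ω q) * Φ))
        (trans (cong₂ (λ a b → (a - 1ℚ) * (K * ι b)) ι-2 (product-primeDivisors q squareFree))
               (solve 1 (λ a → ((con 1ℚ :+ con 1ℚ) :- con 1ℚ) :* a := a) refl (K * ι q)))
        (∏κ-≤ 2 l (all-≥2 l) (primeDivisors-increasing q)))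
      (*-monoˡ (0≤ι 2) (*-monoˡ (0≤ι (2 ℕ.^ ω q)) Φ≤φ))

    0≤R : 0ℚ ≤ R
    0≤R = ∏-nonneg (λ d → 0≤+ 0≤1 (ℚ.<⇒≤ (1/√-seq-positive (proj₁ d) k {{prime⇒nonZero (proj₁ (proj₂ d))}}))) l

    seq-∏ : seq (∏[1+1/√p] q) k ≡ R
    seq-∏ = go l
      where
      go : ∀ (l : List (PrimeDivisor q)) →
        seq (foldr (λ (p , p-prime , _) r → (1ℝ Defs.+ 1/√ p {{prime⇒nonZero p-prime}}) Defs.* r) 1ℝ l) k ≡ ∏ (λ d → 1ℚ + ρ d) l
      go []      = refl
      go (d ∷ l) = cong ((1ℚ + ρ d) *_) (go l)

    L : ℚ
    L = seq (log q) k

    rational-bound : pos (∑-squared-gaps q s) / q ≤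
      (pos 18 / 1) * ((((pos (2 ℕ.^ ω q) / 1) * (pos (φ q) / q)) * L) * seq (∏[1+1/√p] q) k)
    rational-bound = *-cancelˡ (0<ι q) (begin
      ι q * (pos (∑-squared-gaps q s) / q)            ≡⟨ ι-*-/ (∑-squared-gaps q s) q ⟩
      ι (∑-squared-gaps q s)                          ≤⟨ Gaps.∑-squared-gaps-≤ sieve enum ⟩
      ι 3 * ((ι q * (K * R)) * harmonic 0 q)          ≤⟨ *-monoˡ (0≤ι 3) (*-mono-≤ (0≤* (0≤ι q) (ℚ.≤-trans 0≤1 (Sieve.1≤y sieve))) (ℚ.≤-trans harmonic≥0 H≤L) main H≤L) ⟩
      ι 3 * ((ι 2 * (T * F) * R) * (ι 3 * L))         ≡⟨ solve 6 (λ three two t f r l → three :* ((two :* (t :* f) :* r) :* (three :* l)) :=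
                                                           (three :* (two :* three)) :* (((t :* f) :* l) :* r)) refl (ι 3) (ι 2) T F R L ⟩
      (ι 3 * (ι 2 * ι 3)) * (((T * F) * L) * R)       ≡⟨ cong₂ (λ a f → a * (((T * f) * L) * R)) (trans (cong (ι 3 *_) (sym (ι-* 2 3))) (sym (ι-* 3 6))) (sym (ι-*-/ (φ q) q)) ⟩
      ι 18 * (((T * (ι q * (pos (φ q) / q))) * L) * R) ≡⟨ solve 6 (λ c t q f l r → c :* (((t :* (q :* f)) :* l) :* r) := q :* (c :* (((t :* f) :* l) :* r))) refl
                                                            (ι 18) T (ι q) (pos (φ q) / q) L R ⟩
      ι q * (ι 18 * (((T * (pos (φ q) / q)) * L) * R)) ≡⟨ cong (ι q *_) (trans (cong₂ (λ a b → a * (((b * (pos (φ q) / q)) * L) * R)) (ι-def 18) (ι-def (2 ℕ.^ ω q)))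
                                                            (cong (λ r → (pos 18 / 1) * ((((pos (2 ℕ.^ ω q) / 1) * (pos (φ q) / q)) * L) * r)) (sym seq-∏))) ⟩
      ι q * ((pos 18 / 1) * ((((pos (2 ℕ.^ ω q) / 1) * (pos (φ q) / q)) * L) * seq (∏[1+1/√p] q) k)) ∎)
      where
      open ℚ.≤-Reasoning
      T F : ℚ
      T = ι (2 ℕ.^ ω q)
      F = ι (φ q)
      H≤L : harmonic 0 q ≤ ι 3 * L
      H≤L = harmonic-≤-log q k 1<q
      harmonic≥0 : 0ℚ ≤ harmonic 0 q
      harmonic≥0 = ℚ.≤-trans 0≤1 (1≤harmonic q)
      main : ι q * (K * R) ≤ ι 2 * (T * F) * R
      main = subst (_≤ ι 2 * (T * F) * R) (solve 3 (λ k q r → (k :* q) :* r := q :* (k :* r)) refl K (ι q) R) (*-monoʳ 0≤R Kq≤)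

open import Defs
open import Data.Integer using (+_)
open import Data.Nat as ℕ using (ℕ; NonZero)
open import Data.Product using (∃; _×_; _,_)
open import Data.Rational using (_/_)
open SquareGaps.RationalBound using (rational-bound)

corollary1p1 : ∃ λ (C : ℝ) → 0ℝ < C ×
    ((q : ℕ) .{{_ : NonZero q}} → 1 ℕ.< q → SquareFree q →
    (s : ℕ → ℕ) → EnumeratesSquaresMod q s →
    let P = fromℚ (+ φ q / q) in
    fromℚ (+ ∑-squared-gaps q s / q)
    ≤ C * (fromℕ (2 ℕ.^ ω q) * P * log q * ∏[1+1/√p] q))
-- 18 = 3 · 2 · 3: the first 3 from the cost 1 + 2E of a position, the 2 from ∏ p²/(p² - 1), the
-- last 3 from H_q ≤ 3 log q.
corollary1p1 = fromℕ 18 , 18-positive , λ q 1<q squareFree s enum ε ε>0 →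
  0 , λ k _ → ℚ.≤-trans (rational-bound q 1<q squareFree s enum k) (SquareGaps.p≤p+q _ (ℚ.<⇒≤ ε>0))
  where
  open import Data.Rational as ℚ using (0ℚ; 1ℚ)
  import Data.Rational.Properties as ℚ
  open import Relation.Nullary.Decidable using (from-yes)
  18-positive : 0ℝ < fromℕ 18
  18-positive = 1ℚ , ℚ.positive⁻¹ 1ℚ , 0 , λ _ _ → from-yes ((0ℚ ℚ.+ 1ℚ) ℚ.≤? (+ 18 / 1))
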